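{- Let $\mathcal G$ be an infinite group, let $B=B^{ -1} \subseteq \mathcal G$ be a finite generating set containing the identity element of $\mathcal G$, and let $A \subseteq \mathcal G$ be a finite subset. If $|BA| < |A| + \tfrac{1}{2}|A|^{1/3}$, then $\mathcal G$ has a finite normal subgroup $N$ such that $\mathcal G/N$ is either cyclic or dihedral. Furthermore, $|N|< \frac{1}{4} |A|^{1/3}$.
   Context: $BA=\{ba: b\in B, a\in A\}$ and $B^{ -1}=\{b^{ -1}:b\in B\}$. Cyclic and dihedral groups may be finite or infinite. -}

module Defs where

open import Level using (Level; _⊔_)
open import Algebra.Bundles using (Group)
open import Data.Nat using (ℕ; zero; suc)
open import Data.Integer using (ℤ; +_; -[1+_])
open import Data.List using (List; []; _∷_; foldr; length)
open import Data.List.Relation.Unary.Any using (Any)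
open import Data.List.Relation.Unary.All using (All)
open import Data.List.Relation.Unary.AllPairs using (AllPairs)
open import Data.Product using (Σ; _×_; ∃; ∃-syntax; _,_)
open import Data.Sum using (_⊎_)
open import Relation.Nullary using (¬_)

-- Notions for a group G given as a stdlib Group bundle (equality is the setoid _≈_).
-- Finite subsets of G are represented by duplicate-free lists (up to _≈_).
module GroupNotions {c ℓ : Level} (G : Group c ℓ) where
  open Group G

  _∈ₗ_ : Carrier → List Carrier → Set (c ⊔ ℓ)
  x ∈ₗ L = Any (λ y → x ≈ y) L

  Distinct : List Carrier → Set (c ⊔ ℓ)
  Distinct L = AllPairs (λ x y → ¬ (x ≈ y)) L

  Enumerates : {p : Level} → (Carrier → Set p) → List Carrier → Set (c ⊔ ℓ ⊔ p)
  Enumerates P L = Distinct L × (∀ x → (P x → x ∈ₗ L) × (x ∈ₗ L → P x))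

  Infinite : Set (c ⊔ ℓ)
  Infinite = ¬ (Σ (List Carrier) λ L → ∀ x → x ∈ₗ L)

  ProdSet : List Carrier → List Carrier → Carrier → Set (c ⊔ ℓ)
  ProdSet B A x = Σ Carrier λ b → Σ Carrier λ a → b ∈ₗ B × a ∈ₗ A × x ≈ b ∙ a

  Symmetric : List Carrier → Set (c ⊔ ℓ)
  Symmetric B = ∀ b → b ∈ₗ B → (b ⁻¹) ∈ₗ B

  Generates : List Carrier → Set (c ⊔ ℓ)
  Generates B = ∀ g → Σ (List Carrier) λ ws → All (λ w → w ∈ₗ B) ws × g ≈ foldr _∙_ ε ws

  _^ℕ_ : Carrier → ℕ → Carrier
  g ^ℕ zero = ε
  g ^ℕ suc n = g ∙ (g ^ℕ n)

  _^ᶻ_ : Carrier → ℤ → Carrier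
  g ^ᶻ (+ n) = g ^ℕ n
  g ^ᶻ -[1+ n ] = (g ⁻¹) ^ℕ suc n

  IsNormalSubgroup : List Carrier → Set (c ⊔ ℓ)
  IsNormalSubgroup N =
    (ε ∈ₗ N) ×
    (∀ x y → x ∈ₗ N → y ∈ₗ N → (x ∙ y) ∈ₗ N) ×
    (∀ x → x ∈ₗ N → (x ⁻¹) ∈ₗ N) ×
    (∀ g x → x ∈ₗ N → ((g ∙ x) ∙ (g ⁻¹)) ∈ₗ N)

  _≡[_]_ : Carrier → List Carrier → Carrier → Set (c ⊔ ℓ)
  x ≡[ N ] y = ((x ⁻¹) ∙ y) ∈ₗ N

  QuotientCyclic : List Carrier → Set (c ⊔ ℓ)
  QuotientCyclic N = Σ Carrier λ g → ∀ x → ∃[ k ] (x ≡[ N ] (g ^ᶻ k))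

  -- G/N is dihedral (finite D_n, n ≥ 1, or infinite D_∞): there are cosets rN, sN with
  -- s² = 1, s r s⁻¹ = r⁻¹, s ∉ ⟨r⟩, and every element of G/N is r^k or r^k s.
  -- (i.e. G/N = ⟨r⟩ ⋊ ⟨s⟩ with s of order 2 acting by inversion)
  QuotientDihedral : List Carrier → Set (c ⊔ ℓ)
  QuotientDihedral N = Σ Carrier λ r → Σ Carrier λ s →
    ((s ∙ s) ≡[ N ] ε) ×
    (((s ∙ r) ∙ (s ⁻¹)) ≡[ N ] (r ⁻¹)) ×
    (∀ k → ¬ (s ≡[ N ] (r ^ᶻ k))) ×
    (∀ x → ∃[ k ] ((x ≡[ N ] (r ^ᶻ k)) ⊎ (x ≡[ N ] ((r ^ᶻ k) ∙ s))))

-- Let ∂A = BA ∖ A and k = |∂A|, so that 8k³ < |A|. Each word w of length m satisfies |wA ∖ A| ≤ km, hence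
-- by double counting any finite set E of words with distinct values satisfies Σ_{w ∈ E} (|A| − k|w|) ≤
-- |A|². By the Morse–Hedlund argument, either the factors of long shortlex-least words contain at least
-- min(j + 1, 2k + 1) words of every length j, which contradicts this inequality, or they contain high
-- powers of a word u with |u| ≤ 2k; in that case the inequality for the words uⁱ w bounds the index of ⟨u⟩.
-- So G is virtually cyclic, and the transfer into ⟨u⟩, twisted by the sign with which G acts on ⟨u⟩ by
-- conjugation, is a homomorphism to the infinite dihedral group with finite kernel N.
--
-- For the bound on N take a word t of infinite order with |t| ≤ 2. The cosets ⟨t⟩ x are the lines of a
-- partition of G; those meeting A leave it in both directions, so at most |t| k / 2 of them meet A, and A
-- is so large that they all do. Since N (if |t| = 1) or N ∪ N b (if t = b b' is a product of reflections)
-- has |t| |N| elements in distinct cosets, 2|N| ≤ k.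
--
-- Equality in G is not assumed decidable. Virtual cyclicity is first obtained only up to double negation;
-- this suffices to find t by search, because a short word either has finite order or visibly leaves A. Then
-- equality of short words, and of their cosets modulo ⟨t⟩, is decided by moving them into A.

module Submission where

open import Defs
open import Level using (Level; _⊔_)
open import Algebra.Bundles using (AbelianGroup; Group)
import Algebra.Properties.Group as GroupProperties
open import Data.Nat as ℕ using (_*_; _+_; _<_; _^_; _∸_; _≤_; _⊓_; suc; s≤s; zero; z≤n; ℕ)
open import Data.Integer as ℤ using (+_; -1ℤ; -[1+_]; 0ℤ; 1ℤ; ℤ; ∣_∣)
import Data.Integer.Properties as ℤ
open import Data.Integer.DivMod using (_%_; _%ℕ_; _/_; _/ℕ_; a≡a%n+[a/n]*n; a≡a%ℕn+[a/ℕn]*n; n%d<d; n%ℕd<d)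
open import Data.Product using (_,_; _×_; proj₁; proj₂; Σ; ∃)
open import Data.Empty using (⊥; ⊥-elim)
open import Relation.Nullary using (Dec; no; yes; ¬_)
import Relation.Binary.PropositionalEquality as ≡
import Data.Nat.Properties as ℕ
open import Data.Nat.Induction using (<-wellFounded)
open import Induction.WellFounded using (Acc; acc)
open import Data.Fin as Fin using (Fin; combine; fromℕ<; inject≤; remQuot; toℕ)
import Data.Fin.Properties as Fin
open import Data.List using (List; []; _++_; _∷_; _∷ʳ_; allFin; cartesianProduct; cartesianProductWith; concatMap; drop; filter; foldr; length; lookup; map; tabulate; take; upTo)
open import Data.List.Properties using (++-assoc; drop-[]; filter-accept; filter-reject; length-++; length-drop; length-map; length-tabulate; length-take; length-upTo; map-++; map-∘; take++drop≡id)
open import Data.List.Membership.Propositional using (_∈_; find; lose)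
open import Data.List.Membership.Propositional.Properties using (∈-++⁺ʳ; ∈-++⁺ˡ; ∈-++⁻; ∈-allFin; ∈-cartesianProductWith⁺; ∈-cartesianProductWith⁻; ∈-cartesianProduct⁺; ∈-cartesianProduct⁻; ∈-concatMap⁺; ∈-concatMap⁻; ∈-filter⁺; ∈-filter⁻; ∈-lookup; ∈-map⁺; ∈-map⁻; ∈-tabulate⁺; ∈-upTo⁺; ∈-upTo⁻)
open import Data.List.Relation.Unary.Any as Any using (Any; here; there)
open import Function using (_∘_)
open import Relation.Nullary.Decidable using (_×-dec_; _⊎-dec_; decidable-stable; map′; ¬?; ¬¬-excluded-middle)
open import Relation.Binary.Core using (Rel)
open import Relation.Binary.Definitions using (tri<; tri>; tri≈)
import Algebra.Properties.CommutativeMonoid.Sum as MonoidSum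
import Algebra.Properties.Semiring.Sum as SemiringSum
import Data.Integer.Tactic.RingSolver as ℤSolver
open import Data.Fin.Permutation using (Permutation′; permutation)
open import Data.Sum as Sum using (_⊎_; inj₁; inj₂)
open import Data.Integer.Divisibility.Signed using (_∣?_; _∣_; divides)
import Data.List.Relation.Unary.AllPairs.Properties as AllPairs
open import Data.Nat.Tactic.RingSolver using (solve-∀)
open import Data.Nat.ListAction using (sum)
open import Data.List.Relation.Unary.All as All using (All; []; _∷_)
open import Data.List.Relation.Unary.AllPairs using (AllPairs; []; _∷_)
open import Data.List.Relation.Unary.Unique.Propositional using (Unique)
import Data.List.Relation.Unary.Unique.Propositional.Properties as Unique
open import Data.Sum.Properties using (inj₁-injective; inj₂-injective)
open import Data.Product.Properties using (,-injectiveʳ; ,-injectiveˡ)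
open import Data.Nat.ListAction.Properties using (sum-++)
open import Data.List.Relation.Unary.Any.Properties using (lookup-index)
open ≡ using (_≡_; _≢_)

-- Write n = |A|. With m words of each length the left side of the inequality is about m n²/2k, so
-- 2k words per length are just too few, while 2k + 1 exceed n² by n²/2k. This surplus has to pay
-- for the short lengths, where only j + 1 factors are available; the price is of order k² n, and a
-- contradiction needs n > 4k³ + 2k². In the power case exponents of both signs give a sum of about
-- n³/(3|u|k²), and a contradiction needs n > 3|u|k², which is at most 6k³. Both follow from 8k³ <
-- n.
--
-- The word u is too long for the bound on N: with |u| up to 2k it admits up to k² lines. It serves
-- only to produce the homomorphism to the dihedral group; this in turn yields the short word t,
-- with which the lines are counted again.
--
-- Whenever A replaces G as a place where elements can be compared, the budget is q b k < n: q words
-- of length at most b drive at most q b k points out of A, so some point stays in A along all of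
-- them. The final constant 4 arises from 2|N| ≤ k and 8k³ < n.

module Combinatorics where

  open import Level using (Level)
  open import Data.Nat
  open import Data.Nat.Properties
  open import Data.Nat.Tactic.RingSolver using (solve-∀)
  open import Data.Fin as Fin using (Fin; combine; fromℕ<; toℕ)
  open import Data.Fin.Properties as Fin using (combine-injective; injective⇒≤; pigeonhole; toℕ-fromℕ<; toℕ<n)
  open import Data.List using (List; []; _++_; _∷_; applyUpTo; cartesianProduct; drop; length; lookup; map; take; upTo)
  open import Data.Nat.ListAction using (sum)
  open import Data.Nat.ListAction.Properties using (sum-++)
  open import Data.List.Properties using (drop-drop; length-++; length-map; map-++; map-applyUpTo; map-∘; take-[]; take-take; ≡-dec)
  open import Data.List.Membership.Propositional using (_∈_)
  open import Data.List.Membership.Propositional.Properties using (∈-lookup)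
  open import Data.List.Relation.Unary.All as All using (All)
  open import Data.List.Relation.Unary.AllPairs using (AllPairs; []; _∷_)
  open import Data.List.Relation.Unary.Unique.Propositional using (Unique)
  open import Data.List.Membership.Setoid.Properties using (index-injective)
  open import Data.List.Relation.Unary.Any using (here; index; there)
  open import Data.Product using (_,_; _×_; proj₁; proj₂; ∃)
  open import Data.Sum using (_⊎_; inj₁; inj₂)
  open import Data.Empty using (⊥; ⊥-elim)
  open import Function using (_∘_)
  open import Relation.Nullary using (no; yes; ¬_)
  open import Relation.Binary.PropositionalEquality
  open import Relation.Nullary.Decidable using (¬?)
  open import Relation.Binary.Definitions using (DecidableEquality; tri<; tri>; tri≈)

  -- Finite search, injections and finite sums.

  module Counting where

    private variable
      a p q : Level
      X Y : Set a

    injection⇒length≤ : ∀ {m} (f : Fin m → X) → (∀ {i j} → f i ≡ f j → i ≡ j) →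
                        (ys : List X) → (∀ i → f i ∈ ys) → m ≤ length ys
    injection⇒length≤ f inj ys f∈ = injective⇒≤ {f = λ i → index (f∈ i)}
      (λ {i} {j} eq → inj (index-injective (setoid _) (f∈ i) (f∈ j) eq))

    injection⇒≤* : ∀ {m u v} (f : Fin m → Fin u × Fin v) → (∀ {i j} → f i ≡ f j → i ≡ j) → m ≤ u * v
    injection⇒≤* f inj = injective⇒≤ {f = λ i → combine (proj₁ (f i)) (proj₂ (f i))}
      (λ {i} {j} eq → inj (let (e₁ , e₂) = combine-injective (proj₁ (f i)) (proj₂ (f i)) _ _ eq
                           in cong₂ _,_ e₁ e₂))

    -- `P` and `Q` need be neither decidable nor complementary: each index reports one of them, and
    -- this keeps the search constructive.
    all-or-some : ∀ {n} {P : Fin n → Set p} {Q : Fin n → Set q} → (∀ i → P i ⊎ Q i) → (∀ i → P i) ⊎ ∃ Q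
    all-or-some {n = zero} d = inj₁ λ ()
    all-or-some {n = suc n} {P} d with d Fin.zero | all-or-some (d ∘ Fin.suc)
    ... | inj₂ q | _ = inj₂ (_ , q)
    ... | inj₁ _ | inj₂ (i , q) = inj₂ (_ , q)
    ... | inj₁ p₀ | inj₁ ps = inj₁ λ { Fin.zero → p₀ ; (Fin.suc i) → ps i }

    all-or-someˡ : {P : X → Set p} {Q : X → Set q} (xs : List X) →
      (∀ x → x ∈ xs → P x ⊎ Q x) → (∀ x → x ∈ xs → P x) ⊎ (∃ λ x → x ∈ xs × Q x)
    all-or-someˡ [] d = inj₁ λ _ ()
    all-or-someˡ (x ∷ xs) d with d x (here refl) | all-or-someˡ xs (λ y → d y ∘ there)
    ... | inj₂ q | _ = inj₂ (_ , here refl , q)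
    ... | inj₁ _ | inj₂ (y , m , q) = inj₂ (y , there m , q)
    ... | inj₁ p₀ | inj₁ ps = inj₁ λ { _ (here refl) → p₀ ; y (there m) → ps y m }

    -- Double negation passes through a finite conjunction, so finitely many instances of excluded
    -- middle may be assumed together on the way to a contradiction.
    ¬¬-all : {P : X → Set p} (xs : List X) → (∀ x → x ∈ xs → ¬ ¬ P x) → ¬ ¬ (∀ x → x ∈ xs → P x)
    ¬¬-all [] d k = k λ _ ()
    ¬¬-all (x ∷ xs) d k = d x (here refl) λ p₀ → ¬¬-all xs (λ y → d y ∘ there) λ ps →
      k λ { _ (here refl) → p₀ ; y (there m) → ps y m }

    ∑< : ℕ → (ℕ → ℕ) → ℕ
    ∑< zero f = 0
    ∑< (suc m) f = f 0 + ∑< m (f ∘ suc)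

    ∑<-mono : ∀ m {f g : ℕ → ℕ} → (∀ i → f i ≤ g i) → ∑< m f ≤ ∑< m g
    ∑<-mono zero h = z≤n
    ∑<-mono (suc m) h = +-mono-≤ (h 0) (∑<-mono m (h ∘ suc))

    ∑<-cong : ∀ m {f g : ℕ → ℕ} → (∀ i → f i ≡ g i) → ∑< m f ≡ ∑< m g
    ∑<-cong zero h = refl
    ∑<-cong (suc m) h = cong₂ _+_ (h 0) (∑<-cong m (h ∘ suc))

    ∑<-* : ∀ c m (f : ℕ → ℕ) → c * ∑< m f ≡ ∑< m (λ i → c * f i)
    ∑<-* c zero f = *-zeroʳ c
    ∑<-* c (suc m) f = trans (*-distribˡ-+ c (f 0) _) (cong (λ z → c * f 0 + z) (∑<-* c m (f ∘ suc)))

    ∑<-snoc : ∀ m (f : ℕ → ℕ) → ∑< (suc m) f ≡ ∑< m f + f m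
    ∑<-snoc zero f = +-comm (f 0) 0
    ∑<-snoc (suc m) f = trans (cong (λ z → f 0 + z) (∑<-snoc m (f ∘ suc))) (sym (+-assoc (f 0) _ _))

    ∑<-upTo : ∀ m (f : ℕ → ℕ) → sum (map f (upTo m)) ≡ ∑< m f
    ∑<-upTo m f = trans (cong sum (map-applyUpTo (λ x → x) f m)) (go m f)
      where
      go : ∀ m (f : ℕ → ℕ) → sum (applyUpTo f m) ≡ ∑< m f
      go zero f = refl
      go (suc m) f = cong (λ z → f 0 + z) (go m (f ∘ suc))

    length-cartesianProduct : (xs : List X) (ys : List Y) → length (cartesianProduct xs ys) ≡ length xs * length ys
    length-cartesianProduct [] ys = refl
    length-cartesianProduct (x ∷ xs) ys = trans (length-++ (map (x ,_) ys))
      (cong₂ _+_ (length-map (x ,_) ys) (length-cartesianProduct xs ys))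

    sum-cartesianProduct : (f : X × Y → ℕ) (xs : List X) (ys : List Y) →
      sum (map f (cartesianProduct xs ys)) ≡ sum (map (λ x → sum (map (λ y → f (x , y)) ys)) xs)
    sum-cartesianProduct f [] ys = refl
    sum-cartesianProduct f (x ∷ xs) ys = begin
      sum (map f (map (x ,_) ys ++ cartesianProduct xs ys))
        ≡⟨ cong sum (map-++ f (map (x ,_) ys) _) ⟩
      sum (map f (map (x ,_) ys) ++ map f (cartesianProduct xs ys))
        ≡⟨ sum-++ (map f (map (x ,_) ys)) _ ⟩
      sum (map f (map (x ,_) ys)) + sum (map f (cartesianProduct xs ys))
        ≡⟨ cong₂ _+_ (cong sum (sym (map-∘ ys))) (sum-cartesianProduct f xs ys) ⟩
      _ ∎
      where open ≡-Reasoning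

    ∑<-cartesianProduct : ∀ m (ys : List Y) (f : ℕ × Y → ℕ) →
      sum (map f (cartesianProduct (upTo m) ys)) ≡ ∑< m (λ i → sum (map (λ y → f (i , y)) ys))
    ∑<-cartesianProduct m ys f = trans (sum-cartesianProduct f (upTo m) ys) (∑<-upTo m _)

    lookup-injective : ∀ {r} {R : X → X → Set r} → (∀ {x} → ¬ R x x) → (∀ {x y} → R x y → R y x) →
      ∀ {xs} → AllPairs R xs → ∀ i j → ¬ R (lookup xs i) (lookup xs j) → i ≡ j
    lookup-injective irr sy (_ ∷ _) Fin.zero Fin.zero _ = refl
    lookup-injective irr sy (px ∷ _) Fin.zero (Fin.suc j) ¬r = ⊥-elim (¬r (All.lookup px (∈-lookup j)))
    lookup-injective irr sy (px ∷ _) (Fin.suc i) Fin.zero ¬r = ⊥-elim (¬r (sy (All.lookup px (∈-lookup i))))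
    lookup-injective irr sy (_ ∷ ps) (Fin.suc i) (Fin.suc j) ¬r = cong Fin.suc (lookup-injective irr sy ps i j ¬r)

    unique-lookup : ∀ {xs : List X} → Unique xs → ∀ i j → lookup xs i ≡ lookup xs j → i ≡ j
    unique-lookup u i j e = lookup-injective (λ ¬e → ¬e refl) (λ ¬e → ¬e ∘ sym) u i j (λ ¬e → ¬e e)

  -- Sums of truncated linear and quadratic progressions.

  module Estimates where
    open Counting

    S₁ : ℕ → ℕ → ℕ → ℕ
    S₁ s m y = ∑< m (λ j → y ∸ j * s)

    S₁-suc : ∀ s m y → S₁ s (suc m) y ≡ y + S₁ s m (y ∸ s)
    S₁-suc s m y = cong (λ z → y + z) (∑<-cong m λ j → sym (∸-+-assoc y s (j * s)))

    -- Discrete forms of ∫₀^{y/s} (y - xs) dx = y²/2s and ∫₀^{n/k} (n - xk)² dx = n³/3k.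
    S₁-bound : ∀ s m y → y ≤ m * s → y * y + s * y ≤ 2 * s * S₁ s m y
    S₁-bound s zero zero z≤n rewrite *-zeroʳ s = z≤n
    S₁-bound s (suc m) y y≤ rewrite S₁-suc s m y with ≤-total y s
    ... | inj₁ y≤s = begin
      y * y + s * y                           ≤⟨ +-monoˡ-≤ (s * y) (*-monoˡ-≤ y y≤s) ⟩
      s * y + s * y                           ≡⟨ cong (λ z → s * y + z) (+-identityʳ (s * y)) ⟨
      2 * (s * y)                             ≡⟨ *-assoc 2 s y ⟨
      2 * s * y                               ≤⟨ *-monoʳ-≤ (2 * s) (m≤m+n y _) ⟩
      2 * s * (y + S₁ s m (y ∸ s))            ∎
      where open ≤-Reasoning
    ... | inj₂ s≤y = begin
      y * y + s * y                                   ≡⟨ cong (λ v → v * v + s * v) (m+[n∸m]≡n s≤y) ⟨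
      (s + z) * (s + z) + s * (s + z)                 ≡⟨ expand s z ⟩
      2 * s * (s + z) + (z * z + s * z)               ≤⟨ +-monoʳ-≤ (2 * s * (s + z)) (S₁-bound s m z z≤) ⟩
      2 * s * (s + z) + 2 * s * S₁ s m z              ≡⟨ *-distribˡ-+ (2 * s) (s + z) _ ⟨
      2 * s * (s + z + S₁ s m z)                      ≡⟨ cong (λ v → 2 * s * (v + S₁ s m z)) (m+[n∸m]≡n s≤y) ⟩
      2 * s * (y + S₁ s m z)                          ∎
      where
      open ≤-Reasoning
      z = y ∸ s
      z≤ : z ≤ m * s
      z≤ = ≤-trans (∸-monoˡ-≤ s y≤) (≤-reflexive (m+n∸m≡n s (m * s)))
      expand : ∀ s z → (s + z) * (s + z) + s * (s + z) ≡ 2 * s * (s + z) + (z * z + s * z)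
      expand = solve-∀

    S₂ : ℕ → ℕ → ℕ → ℕ
    S₂ s m y = ∑< m (λ j → (y ∸ j * s) * (y ∸ j * s))

    S₂-suc : ∀ s m y → S₂ s (suc m) y ≡ y * y + S₂ s m (y ∸ s)
    S₂-suc s m y = cong (λ z → y * y + z) (∑<-cong m λ j → let e = sym (∸-+-assoc y s (j * s)) in cong₂ _*_ e e)

    S₂-bound : ∀ s m y → y ≤ m * s → y * y * y ≤ 3 * s * S₂ s m y
    S₂-bound s zero zero z≤n = z≤n
    S₂-bound s (suc m) y y≤ rewrite S₂-suc s m y with ≤-total y s
    ... | inj₁ y≤s = begin
      y * y * y                               ≤⟨ *-monoʳ-≤ (y * y) y≤s ⟩
      y * y * s                               ≡⟨ *-comm (y * y) s ⟩
      s * (y * y)                             ≤⟨ *-monoˡ-≤ (y * y) (m≤m+n s (s + (s + 0))) ⟩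
      3 * s * (y * y)                         ≤⟨ *-monoʳ-≤ (3 * s) (m≤m+n (y * y) _) ⟩
      3 * s * (y * y + S₂ s m (y ∸ s))        ∎
      where open ≤-Reasoning
    ... | inj₂ s≤y = begin
      y * y * y                                         ≡⟨ cong (λ v → v * v * v) (m+[n∸m]≡n s≤y) ⟨
      (s + z) * (s + z) * (s + z)                       ≤⟨ m≤m+n _ (2 * (s * s * s) + 3 * (s * s * z)) ⟩
      (s + z) * (s + z) * (s + z) + (2 * (s * s * s) + 3 * (s * s * z))
                                                        ≡⟨ expand s z ⟩
      3 * s * ((s + z) * (s + z)) + z * z * z           ≤⟨ +-monoʳ-≤ _ (S₂-bound s m z z≤) ⟩
      3 * s * ((s + z) * (s + z)) + 3 * s * S₂ s m z    ≡⟨ *-distribˡ-+ (3 * s) ((s + z) * (s + z)) _ ⟨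
      3 * s * ((s + z) * (s + z) + S₂ s m z)            ≡⟨ cong (λ v → 3 * s * (v * v + S₂ s m z)) (m+[n∸m]≡n s≤y) ⟩
      3 * s * (y * y + S₂ s m z)                        ∎
      where
      open ≤-Reasoning
      z = y ∸ s
      z≤ : z ≤ m * s
      z≤ = ≤-trans (∸-monoˡ-≤ s y≤) (≤-reflexive (m+n∸m≡n s (m * s)))
      expand : ∀ s z → (s + z) * (s + z) * (s + z) + (2 * (s * s * s) + 3 * (s * s * z))
                       ≡ 3 * s * ((s + z) * (s + z)) + z * z * z
      expand = solve-∀

    -- Each square lies above a tangent, (y - js)² ≥ y² - 2yjs, also after truncation, and Σ 2j over
    -- j < m is m² - m. Negative terms are moved across the inequality.
    S₂-lower : ∀ s m y → m * (y * y) + y * s * m ≤ S₂ s m y + y * s * (m * m)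
    S₂-lower s zero y = ≤-reflexive (trans (*-zeroʳ (y * s)) (sym (*-zeroʳ (y * s))))
    S₂-lower s (suc m) y = begin
      suc m * (y * y) + y * s * suc m                      ≡⟨ split y s m ⟩
      m * (y * y) + y * s * m + (y * y + y * s)            ≤⟨ +-mono-≤ (S₂-lower s m y) (+-monoˡ-≤ (y * s) (square y (m * s))) ⟩
      S₂ s m y + y * s * (m * m) + (w * w + 2 * y * (m * s) + y * s)
                                                           ≡⟨ regroup (S₂ s m y) y s m (w * w) ⟩
      S₂ s m y + w * w + y * s * (suc m * suc m)           ≡⟨ cong (_+ y * s * (suc m * suc m)) (∑<-snoc m _) ⟨
      S₂ s (suc m) y + y * s * (suc m * suc m)             ∎
      where
      open ≤-Reasoning
      w = y ∸ m * s
      split : ∀ y s m → suc m * (y * y) + y * s * suc m ≡ m * (y * y) + y * s * m + (y * y + y * s)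
      split = solve-∀
      regroup : ∀ S y s m q → S + y * s * (m * m) + (q + 2 * y * (m * s) + y * s) ≡ S + q + y * s * (suc m * suc m)
      regroup = solve-∀
      square : ∀ y c → y * y ≤ (y ∸ c) * (y ∸ c) + 2 * y * c
      square y c with ≤-total y c
      ... | inj₁ y≤c = begin
        y * y                              ≤⟨ *-monoʳ-≤ y y≤c ⟩
        y * c                              ≤⟨ *-monoˡ-≤ c (m≤m+n y (y + 0)) ⟩
        2 * y * c                          ≤⟨ m≤n+m _ ((y ∸ c) * (y ∸ c)) ⟩
        (y ∸ c) * (y ∸ c) + 2 * y * c      ∎
      ... | inj₂ c≤y = begin
        y * y                              ≡⟨ cong (λ v → v * v) (m∸n+n≡m c≤y) ⟨
        (z + c) * (z + c)                  ≤⟨ m≤m+n _ (c * c) ⟩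
        (z + c) * (z + c) + c * c          ≡⟨ lem z c ⟩
        z * z + 2 * (z + c) * c            ≡⟨ cong (λ v → z * z + 2 * v * c) (m∸n+n≡m c≤y) ⟩
        z * z + 2 * y * c                  ∎
        where
        z = y ∸ c
        lem : ∀ z c → (z + c) * (z + c) + c * c ≡ z * z + 2 * (z + c) * c
        lem = solve-∀

  -- Factors of finite words and the Morse-Hedlund dichotomy.

  module _ {a : Level} {X : Set a} where

    repeat : ℕ → List X → List X
    repeat zero u = []
    repeat (suc m) u = u ++ repeat m u

  module MorseHedlund {a : Level} {X : Set a} (_≟X_ : DecidableEquality X) where

    window : List X → ℕ → ℕ → List X
    window v i m = take m (drop i v)

    take-weaken : ∀ {m n} → m ≤ n → {x y : List X} → take n x ≡ take n y → take m x ≡ take m y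
    take-weaken {m} {n} m≤n {x} {y} e = begin
      take m x           ≡⟨ cong (λ j → take j x) (m≤n⇒m⊓n≡m m≤n) ⟨
      take (m ⊓ n) x     ≡⟨ take-take m n x ⟨
      take m (take n x)  ≡⟨ cong (take m) e ⟩
      take m (take n y)  ≡⟨ take-take m n y ⟩
      take (m ⊓ n) y     ≡⟨ cong (λ j → take j y) (m≤n⇒m⊓n≡m m≤n) ⟩
      take m y           ∎
      where open ≡-Reasoning

    drop1-take : ∀ m (x : List X) → drop 1 (take (suc m) x) ≡ take m (drop 1 x)
    drop1-take m [] = sym (take-[] m)
    drop1-take m (_ ∷ _) = refl

    drop-suc : ∀ i (v : List X) → drop 1 (drop i v) ≡ drop (suc i) v
    drop-suc i v = trans (drop-drop i 1 v) (cong (λ j → drop j v) (+-comm i 1))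

    -- One family of positions encodes complexity at least min(j + 1, m) for all lengths j at once:
    -- different windows stay different when lengthened, so at length j the positions with index at
    -- most j have pairwise different windows.
    Separated : List X → ℕ → ℕ → (ℕ → ℕ) → Set a
    Separated v K m pos = (∀ s → s < m → pos s < K) ×
      (∀ s s' → s < s' → s' < m → window v (pos s) s' ≢ window v (pos s') s')

    extendBy : ℕ → ℕ → (ℕ → ℕ) → ℕ → ℕ
    extendBy m i pos s with s ≟ m
    ... | yes _ = i
    ... | no _ = pos s

    extendBy-new : ∀ m i pos → extendBy m i pos m ≡ i
    extendBy-new m i pos with m ≟ m
    ... | yes _ = refl
    ... | no m≢m = ⊥-elim (m≢m refl)

    extendBy-old : ∀ m i pos {s} → s < m → extendBy m i pos s ≡ pos s
    extendBy-old m i pos {s} s<m with s ≟ m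
    ... | yes refl = ⊥-elim (<-irrefl refl s<m)
    ... | no _ = refl

    Separated-extend : ∀ v K m pos i → Separated v K m pos → i < K →
      (∀ s → s < m → window v (pos s) m ≢ window v i m) → Separated v K (suc m) (extendBy m i pos)
    Separated-extend v K m pos i (bound , sep) i<K new = bound' , sep'
      where
      pos' = extendBy m i pos
      bound' : ∀ s → s < suc m → pos' s < K
      bound' s s<1+m with m<1+n⇒m<n∨m≡n s<1+m
      ... | inj₁ s<m = subst (_< K) (sym (extendBy-old m i pos s<m)) (bound s s<m)
      ... | inj₂ refl = subst (_< K) (sym (extendBy-new m i pos)) i<K
      sep' : ∀ s s' → s < s' → s' < suc m → window v (pos' s) s' ≢ window v (pos' s') s'
      sep' s s' s<s' s'<1+m with m<1+n⇒m<n∨m≡n s'<1+m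
      ... | inj₁ s'<m rewrite extendBy-old m i pos s'<m | extendBy-old m i pos (<-trans s<s' s'<m) = sep s s' s<s' s'<m
      ... | inj₂ refl rewrite extendBy-new m i pos | extendBy-old m i pos s<s' = new s s<s'

    Separated-injective : ∀ v K m pos → Separated v K (suc m) pos → ∀ s s' → s ≤ m → s' ≤ m →
      window v (pos s) m ≡ window v (pos s') m → s ≡ s'
    Separated-injective v K m pos (_ , sep) s s' s≤m s'≤m e with <-cmp s s'
    ... | tri≈ _ s≡s' _ = s≡s'
    ... | tri< s<s' _ _ = ⊥-elim (sep s s' s<s' (s≤s s'≤m) (take-weaken s'≤m e))
    ... | tri> _ _ s'<s = ⊥-elim (sep s' s s'<s (s≤s s≤m) (take-weaken s≤m (sym e)))

    -- A repeated window then propagates to the right.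
    Deterministic : List X → ℕ → ℕ → Set a
    Deterministic v K m = ∀ i i' → i < K → i' < K → window v i m ≡ window v i' m → window v i (suc m) ≡ window v i' (suc m)

    -- Determinism lengthens the common window by a letter, and dropping the first letter gives
    -- equal windows of length `m` one place further on. The bounds by `K` keep all positions where
    -- determinism is known.
    shift-windows : ∀ v K m → Deterministic v K m → ∀ M i i' → i + M ≤ K → i' + M ≤ K →
      window v i m ≡ window v i' m → window v i M ≡ window v i' M
    shift-windows v K m det zero i i' _ _ e = refl
    shift-windows v K m det (suc M) i i' hi hi' e = begin
      take (suc M) (drop i v)    ≡⟨ take-suc M (drop i v) ⟩
      take 1 (drop i v) ++ take M (drop 1 (drop i v))
        ≡⟨ cong₂ _++_ (take-weaken (s≤s z≤n) e⁺)
             (trans (cong (take M) (drop-suc i v)) (trans (shift-windows v K m det M (suc i) (suc i') (h i hi) (h i' hi') e')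
                    (cong (take M) (sym (drop-suc i' v))))) ⟩
      take 1 (drop i' v) ++ take M (drop 1 (drop i' v))  ≡⟨ take-suc M (drop i' v) ⟨
      take (suc M) (drop i' v)   ∎
      where
      open ≡-Reasoning
      h : ∀ j → j + suc M ≤ K → suc j + M ≤ K
      h j = subst (_≤ K) (+-suc j M)
      <K : ∀ j → j + suc M ≤ K → j < K
      <K j hj = ≤-trans (m≤m+n (suc j) M) (h j hj)
      e⁺ : window v i (suc m) ≡ window v i' (suc m)
      e⁺ = det i i' (<K i hi) (<K i' hi') e
      take-suc : ∀ M (x : List X) → take (suc M) x ≡ take 1 x ++ take M (drop 1 x)
      take-suc M [] = sym (take-[] M)
      take-suc M (_ ∷ _) = refl
      e' : window v (suc i) m ≡ window v (suc i') m
      e' = begin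
        take m (drop (suc i) v)            ≡⟨ cong (take m) (drop-suc i v) ⟨
        take m (drop 1 (drop i v))         ≡⟨ drop1-take m (drop i v) ⟨
        drop 1 (take (suc m) (drop i v))   ≡⟨ cong (drop 1) e⁺ ⟩
        drop 1 (take (suc m) (drop i' v))  ≡⟨ drop1-take m (drop i' v) ⟩
        take m (drop 1 (drop i' v))        ≡⟨ cong (take m) (drop-suc i' v) ⟩
        take m (drop (suc i') v)           ∎

    take-+ : ∀ d M (y : List X) → take (d + M) y ≡ take d y ++ take M (drop d y)
    take-+ zero M y = refl
    take-+ (suc d) M [] = sym (take-[] M)
    take-+ (suc d) M (x ∷ y) = cong (x ∷_) (take-+ d M y)

    -- Agreement with the shift by `d` is a period: each block of `d` letters copies the previous
    -- one, and the last block may reach `d` letters beyond the overlap.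
    periodic⇒repeat : ∀ d M (y : List X) → take M y ≡ take M (drop d y) → ∀ N → N * d ≤ d + M →
      take (N * d) y ≡ repeat N (take d y)
    periodic⇒repeat d M y e zero h = refl
    periodic⇒repeat d M y e (suc N) h = begin
      take (d + N * d) y                  ≡⟨ take-+ d (N * d) y ⟩
      take d y ++ take (N * d) (drop d y) ≡⟨ cong (take d y ++_) (take-weaken N*d≤M (sym e)) ⟩
      take d y ++ take (N * d) y          ≡⟨ cong (take d y ++_) (periodic⇒repeat d M y e N (≤-trans N*d≤M (m≤n+m M d))) ⟩
      take d y ++ repeat N (take d y)     ∎
      where
      open ≡-Reasoning
      N*d≤M : N * d ≤ M
      N*d≤M = +-cancelˡ-≤ d _ _ h

    -- The bound `i + d ≤ J` ensures that the base of the power is not cut off by the end of a word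
    -- of length at least `J`.
    HasPower : List X → ℕ → ℕ → Set a
    HasPower v J N = ∃ λ i → ∃ λ d → 1 ≤ d × d ≤ J × window v i (N * d) ≡ repeat N (window v i d) × i + d ≤ J

    -- If no position below `K` offers a new window of length m + 1, then every such window is one
    -- of the m + 1 chosen ones. These already differ at length m, so a window of length m
    -- determines its successor, and a coincidence between two early positions propagates to a
    -- period.
    separate-or-power : ∀ v J N → ∀ m → suc m ≤ J → ∀ pos → Separated v (suc J + N * J) (suc m) pos →
      (∃ λ pos' → Separated v (suc J + N * J) (suc (suc m)) pos') ⊎ HasPower v J N
    separate-or-power v J N m m<J pos sep with anyUpTo? (λ i → allUpTo? (λ s → ¬? (≡-dec _≟X_ (window v (pos s) (suc m)) (window v i (suc m)))) (suc m)) (suc J + N * J)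
    ... | yes (i , i<K , new) = inj₁ (_ , Separated-extend v _ (suc m) pos i sep i<K (λ s s< → new s<))
    ... | no none = inj₂ power
      where
      K = suc J + N * J
      rep : ∀ i → i < K → ∃ λ s → s < suc m × window v (pos s) (suc m) ≡ window v i (suc m)
      rep i i<K with anyUpTo? (λ s → ≡-dec _≟X_ (window v (pos s) (suc m)) (window v i (suc m))) (suc m)
      ... | yes r = r
      ... | no ¬r = ⊥-elim (none (i , i<K , λ {s} s< e → ¬r (s , s< , e)))
      -- Windows agreeing at length m have representatives agreeing at length m, and such
      -- representatives coincide.
      det : Deterministic v K m
      det i i' i<K i'<K e with rep i i<K | rep i' i'<K
      ... | s , s< , es | s' , s'< , es' with Separated-injective v K m pos sep s s' (≤-pred s<) (≤-pred s'<)
              (trans (take-weaken (n≤1+n m) es) (trans e (take-weaken (n≤1+n m) (sym es'))))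
      ... | refl = trans (sym es) es'
      <K : (i : Fin (suc (suc m))) → toℕ i < K
      <K i = s≤s (≤-trans (≤-pred (toℕ<n i)) (≤-trans m<J (m≤m+n J (N * J))))
      class : Fin (suc (suc m)) → Fin (suc m)
      class i = fromℕ< (proj₁ (proj₂ (rep (toℕ i) (<K i))))
      power : HasPower v J N
      power with pigeonhole ≤-refl class
      ... | f , f' , i<i' , ce = i , d , m<n⇒0<n∸m i<i' , ≤-trans (m∸n≤m i' i) i'≤J ,
            periodic⇒repeat d M (drop i v) shifted N bound , subst (_≤ J) (sym i+d) i'≤J
        where
        i = toℕ f
        i' = toℕ f'
        d = i' ∸ i
        M = K ∸ i'
        i'≤J : i' ≤ J
        i'≤J = ≤-trans (≤-pred (toℕ<n f')) m<J
        i+d : i + d ≡ i'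
        i+d = m+[n∸m]≡n (<⇒≤ i<i')
        same : window v i (suc m) ≡ window v i' (suc m)
        same = trans (sym (proj₂ (proj₂ r))) (trans (cong (λ z → window v (pos z) (suc m))
            (trans (sym (toℕ-fromℕ< (proj₁ (proj₂ r)))) (trans (cong toℕ ce) (toℕ-fromℕ< (proj₁ (proj₂ r'))))))
            (proj₂ (proj₂ r')))
          where
          r = rep i (<K f)
          r' = rep i' (<K f')
        i'+M : i' + M ≤ K
        i'+M = ≤-reflexive (m+[n∸m]≡n (<⇒≤ (<K f')))
        shifted : take M (drop i v) ≡ take M (drop d (drop i v))
        shifted = trans (shift-windows v K m det M i i' (≤-trans (+-monoˡ-≤ M (<⇒≤ i<i')) i'+M) i'+M
                          (take-weaken (n≤1+n m) same))
                        (cong (take M) (sym (trans (drop-drop i d v) (cong (λ j → drop j v) i+d))))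
        -- This is what fixes `K`: the second position is at most `J`, so more than `N * J` letters
        -- remain behind it.
        bound : N * d ≤ d + M
        bound = begin
          N * d            ≤⟨ *-monoʳ-≤ N (≤-trans (m∸n≤m i' i) i'≤J) ⟩
          N * J            ≤⟨ n≤1+n _ ⟩
          suc (N * J)      ≡⟨ m+n∸m≡n J (suc (N * J)) ⟨
          J + suc (N * J) ∸ J ≡⟨ cong (_∸ J) (+-suc J (N * J)) ⟩
          K ∸ J            ≤⟨ ∸-monoʳ-≤ K i'≤J ⟩
          M                ≤⟨ m≤n+m M d ⟩
          d + M            ∎
          where open ≤-Reasoning

    morse-hedlund : ∀ v J N → (∃ λ pos → Separated v (suc J + N * J) (suc J) pos) ⊎ HasPower v J N
    morse-hedlund v J N = go J ≤-refl
      where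
      go : ∀ m → m ≤ J → (∃ λ pos → Separated v (suc J + N * J) (suc m) pos) ⊎ HasPower v J N
      go zero _ = inj₁ ((λ _ → 0) , (λ _ _ → s≤s z≤n) , λ { _ zero () _ ; _ (suc _) _ (s≤s ()) })
      go (suc m) m<J with go m (<⇒≤ m<J)
      ... | inj₂ p = inj₂ p
      ... | inj₁ (pos , sep) = separate-or-power v J N m m<J pos sep

open Combinatorics
open Counting
open Estimates

-- Integer powers and the cosets of a cyclic subgroup.

module Powers {c ℓ : Level} (G : Group c ℓ) where
  open Group G
  open GroupNotions G
  open GroupProperties G
  open import Relation.Binary.Reasoning.Setoid setoid

  cancel-inner : ∀ x y → x ∙ (x ⁻¹ ∙ y) ≈ y
  cancel-inner x y = trans (sym (assoc x (x ⁻¹) y)) (trans (∙-congʳ (inverseʳ x)) (identityˡ y))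

  cancel-inner′ : ∀ x y → x ⁻¹ ∙ (x ∙ y) ≈ y
  cancel-inner′ x y = trans (sym (assoc (x ⁻¹) x y)) (trans (∙-congʳ (inverseˡ x)) (identityˡ y))

  ^-suc : ∀ g m → g ^ᶻ (ℤ.suc m) ≈ g ∙ g ^ᶻ m
  ^-suc g (+ n) = refl
  ^-suc g -[1+ zero ] = sym (cancel-inner g ε)
  ^-suc g -[1+ suc n ] = sym (cancel-inner g _)

  ^-pred : ∀ g m → g ^ᶻ (ℤ.pred m) ≈ g ⁻¹ ∙ g ^ᶻ m
  ^-pred g m = begin
    g ^ᶻ (ℤ.pred m)                     ≈⟨ cancel-inner′ g _ ⟨
    g ⁻¹ ∙ (g ∙ g ^ᶻ (ℤ.pred m))        ≈⟨ ∙-congˡ (^-suc g (ℤ.pred m)) ⟨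
    g ⁻¹ ∙ g ^ᶻ (ℤ.suc (ℤ.pred m))      ≡⟨ ≡.cong (λ j → g ⁻¹ ∙ g ^ᶻ j) (ℤ.suc-pred m) ⟩
    g ⁻¹ ∙ g ^ᶻ m                       ∎

  ^-+ : ∀ g m n → g ^ᶻ (m ℤ.+ n) ≈ g ^ᶻ m ∙ g ^ᶻ n
  ^-+ g (+ zero) n = begin
    g ^ᶻ (0ℤ ℤ.+ n) ≡⟨ ≡.cong (g ^ᶻ_) (ℤ.+-identityˡ n) ⟩
    g ^ᶻ n          ≈⟨ identityˡ _ ⟨
    ε ∙ g ^ᶻ n      ∎
  ^-+ g (+ suc m) n = begin
    g ^ᶻ (+ suc m ℤ.+ n)              ≡⟨ ≡.cong (g ^ᶻ_) (ℤ.+-assoc 1ℤ (+ m) n) ⟩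
    g ^ᶻ (ℤ.suc (+ m ℤ.+ n))          ≈⟨ ^-suc g (+ m ℤ.+ n) ⟩
    g ∙ g ^ᶻ (+ m ℤ.+ n)              ≈⟨ ∙-congˡ (^-+ g (+ m) n) ⟩
    g ∙ (g ^ᶻ (+ m) ∙ g ^ᶻ n)         ≈⟨ assoc _ _ _ ⟨
    g ^ᶻ (+ suc m) ∙ g ^ᶻ n           ∎
  ^-+ g -[1+ zero ] n = begin
    g ^ᶻ (ℤ.pred n)                   ≈⟨ ^-pred g n ⟩
    g ⁻¹ ∙ g ^ᶻ n                     ≈⟨ ∙-congʳ (identityʳ _) ⟨
    (g ⁻¹ ∙ ε) ∙ g ^ᶻ n               ∎
  ^-+ g -[1+ suc m ] n = begin
    g ^ᶻ (-[1+ suc m ] ℤ.+ n)         ≡⟨ ≡.cong (g ^ᶻ_) (ℤ.+-assoc (ℤ.- 1ℤ) -[1+ m ] n) ⟩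
    g ^ᶻ (ℤ.pred (-[1+ m ] ℤ.+ n))    ≈⟨ ^-pred g (-[1+ m ] ℤ.+ n) ⟩
    g ⁻¹ ∙ g ^ᶻ (-[1+ m ] ℤ.+ n)      ≈⟨ ∙-congˡ (^-+ g -[1+ m ] n) ⟩
    g ⁻¹ ∙ (g ^ᶻ -[1+ m ] ∙ g ^ᶻ n)   ≈⟨ assoc _ _ _ ⟨
    g ^ᶻ -[1+ suc m ] ∙ g ^ᶻ n        ∎

  ^-neg : ∀ g m → g ^ᶻ (ℤ.- m) ≈ (g ^ᶻ m) ⁻¹
  ^-neg g m = inverseˡ-unique _ _ (begin
    g ^ᶻ (ℤ.- m) ∙ g ^ᶻ m  ≈⟨ ^-+ g (ℤ.- m) m ⟨
    g ^ᶻ (ℤ.- m ℤ.+ m)     ≡⟨ ≡.cong (g ^ᶻ_) (ℤ.+-inverseˡ m) ⟩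
    ε                      ∎)

  ^-*⁺ : ∀ g m n → g ^ᶻ (+ n ℤ.* m) ≈ (g ^ᶻ m) ^ℕ n
  ^-*⁺ g m zero = refl
  ^-*⁺ g m (suc n) = begin
    g ^ᶻ (+ suc n ℤ.* m)            ≡⟨ ≡.cong (g ^ᶻ_) (ℤ.suc-* (+ n) m) ⟩
    g ^ᶻ (m ℤ.+ + n ℤ.* m)          ≈⟨ ^-+ g m (+ n ℤ.* m) ⟩
    g ^ᶻ m ∙ g ^ᶻ (+ n ℤ.* m)       ≈⟨ ∙-congˡ (^-*⁺ g m n) ⟩
    g ^ᶻ m ∙ (g ^ᶻ m) ^ᶻ (+ n)      ∎
  ^-* : ∀ g m n → g ^ᶻ (n ℤ.* m) ≈ (g ^ᶻ m) ^ᶻ n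
  ^-* g m (+ n) = ^-*⁺ g m n
  ^-* g m -[1+ n ] = begin
    g ^ᶻ (-[1+ n ] ℤ.* m)           ≡⟨ ≡.cong (g ^ᶻ_) (ℤ.neg-distribˡ-* (+ suc n) m) ⟨
    g ^ᶻ (ℤ.- (+ suc n ℤ.* m))      ≈⟨ ^-neg g (+ suc n ℤ.* m) ⟩
    (g ^ᶻ (+ suc n ℤ.* m)) ⁻¹       ≈⟨ ⁻¹-cong (^-*⁺ g m (suc n)) ⟩
    ((g ^ᶻ m) ^ᶻ (+ suc n)) ⁻¹      ≈⟨ ^-neg (g ^ᶻ m) (+ suc n) ⟨
    (g ^ᶻ m) ^ᶻ -[1+ n ]            ∎

  ε^ : ∀ m → ε ^ᶻ m ≈ ε
  ε^ m = begin
    ε ^ᶻ m               ≈⟨ ^-* ε 0ℤ m ⟨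
    ε ^ᶻ (m ℤ.* 0ℤ)      ≡⟨ ≡.cong (ε ^ᶻ_) (ℤ.*-zeroʳ m) ⟩
    ε                    ∎

  ^ℕ-cong : ∀ {x y} n → x ≈ y → x ^ℕ n ≈ y ^ℕ n
  ^ℕ-cong zero e = refl
  ^ℕ-cong (suc n) e = ∙-cong e (^ℕ-cong n e)

  ^-cong : ∀ {x y} m → x ≈ y → x ^ᶻ m ≈ y ^ᶻ m
  ^-cong (+ n) e = ^ℕ-cong n e
  ^-cong -[1+ n ] e = ^ℕ-cong (suc n) (⁻¹-cong e)

  Torsion : Carrier → Set ℓ
  Torsion t = ∃ λ n → t ^ℕ suc n ≈ ε

  torsion-residue : ∀ t n → t ^ℕ suc n ≈ ε → ∀ m → ∃ λ r → r ℕ.< suc n × t ^ᶻ m ≈ t ^ℕ r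
  torsion-residue t n e m = r , n%ℕd<d m (suc n) , (begin
    t ^ᶻ m                                ≡⟨ ≡.cong (t ^ᶻ_) (a≡a%ℕn+[a/ℕn]*n m (suc n)) ⟩
    t ^ᶻ (+ r ℤ.+ q ℤ.* + suc n)          ≈⟨ ^-+ t (+ r) (q ℤ.* + suc n) ⟩
    t ^ℕ r ∙ t ^ᶻ (q ℤ.* + suc n)         ≈⟨ ∙-congˡ (^-* t (+ suc n) q) ⟩
    t ^ℕ r ∙ (t ^ℕ suc n) ^ᶻ q            ≈⟨ ∙-congˡ (^-cong q e) ⟩
    t ^ℕ r ∙ ε ^ᶻ q                       ≈⟨ ∙-congˡ (ε^ q) ⟩
    t ^ℕ r ∙ ε                            ≈⟨ identityʳ _ ⟩
    t ^ℕ r                                ∎)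
    where
    r = m %ℕ suc n
    q = m /ℕ suc n

  shift-exponent : ∀ t m m' {x y} → t ^ᶻ m ∙ x ≈ t ^ᶻ m' ∙ y → x ≈ t ^ᶻ (m' ℤ.- m) ∙ y
  shift-exponent t m m' {x} {y} e = begin
    x                                     ≈⟨ cancel-inner′ (t ^ᶻ m) x ⟨
    (t ^ᶻ m) ⁻¹ ∙ (t ^ᶻ m ∙ x)            ≈⟨ ∙-congˡ e ⟩
    (t ^ᶻ m) ⁻¹ ∙ (t ^ᶻ m' ∙ y)           ≈⟨ assoc _ _ _ ⟨
    ((t ^ᶻ m) ⁻¹ ∙ t ^ᶻ m') ∙ y           ≈⟨ ∙-congʳ (∙-congʳ (^-neg t m)) ⟨
    (t ^ᶻ (ℤ.- m) ∙ t ^ᶻ m') ∙ y          ≈⟨ ∙-congʳ (^-+ t (ℤ.- m) m') ⟨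
    t ^ᶻ (ℤ.- m ℤ.+ m') ∙ y               ≡⟨ ≡.cong (λ j → t ^ᶻ j ∙ y) (ℤ.+-comm (ℤ.- m) m') ⟩
    t ^ᶻ (m' ℤ.- m) ∙ y                   ∎

  infix 4 _∼[_]_
  -- Equality of the cosets ⟨t⟩x and ⟨t⟩y; the exponent is kept as data and later becomes a
  -- coordinate.
  _∼[_]_ : Carrier → Carrier → Carrier → Set ℓ
  x ∼[ t ] y = ∃ λ m → x ≈ t ^ᶻ m ∙ y

  ∼-reflexive : ∀ {t x y} → x ≈ y → x ∼[ t ] y
  ∼-reflexive e = 0ℤ , trans e (sym (identityˡ _))

  ∼-cancel : ∀ {t x y} m m' → t ^ᶻ m ∙ x ≈ t ^ᶻ m' ∙ y → x ∼[ t ] y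
  ∼-cancel {t} m m' e = m' ℤ.- m , shift-exponent t m m' e

  ∼-sym : ∀ {t x y} → x ∼[ t ] y → y ∼[ t ] x
  ∼-sym (m , e) = ∼-cancel m 0ℤ (trans (sym e) (sym (identityˡ _)))

  ∼-trans : ∀ {t x y z} → x ∼[ t ] y → y ∼[ t ] z → x ∼[ t ] z
  ∼-trans {t} (m , e) (m' , e') = m ℤ.+ m' , trans e (trans (∙-congˡ e') (trans (sym (assoc _ _ _)) (∙-congʳ (sym (^-+ t m m')))))

  ∼-∙ : ∀ {t x y} z → x ∼[ t ] y → x ∙ z ∼[ t ] y ∙ z
  ∼-∙ z (m , e) = m , trans (∙-congʳ e) (assoc _ _ _)

  ∼-∙⁻ : ∀ {t x y} z → x ∙ z ∼[ t ] y ∙ z → x ∼[ t ] y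
  ∼-∙⁻ z (m , e) = m , ∙-cancelʳ z _ _ (trans e (sym (assoc _ _ _)))

  -- A partial transversal: the points lie in different cosets, but need not meet all of them.
  Transversal : Carrier → ∀ {m} → (Fin m → Carrier) → Set ℓ
  Transversal t y = ∀ s s' → y s ∼[ t ] y s' → s ≡ s'

  module InfiniteOrder (t : Carrier) (inf : ¬ Torsion t) where

    exponent-zero : ∀ m → t ^ᶻ m ≈ ε → m ≡ 0ℤ
    exponent-zero (+ zero) _ = ≡.refl
    exponent-zero (+ suc n) e = ⊥-elim (inf (n , e))
    exponent-zero -[1+ n ] e = ⊥-elim (inf (n , (begin
      t ^ᶻ (ℤ.- -[1+ n ])     ≈⟨ ^-neg t -[1+ n ] ⟩
      (t ^ᶻ -[1+ n ]) ⁻¹      ≈⟨ ⁻¹-cong e ⟩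
      ε ⁻¹                    ≈⟨ ε⁻¹≈ε ⟩
      ε                       ∎)))

    exponent-unique : ∀ m m' {x} → t ^ᶻ m ∙ x ≈ t ^ᶻ m' ∙ x → m ≡ m'
    exponent-unique m m' {x} e = ≡.sym (ℤ.i-j≡0⇒i≡j m' m (exponent-zero (m' ℤ.- m)
      (sym (∙-cancelʳ x _ _ (trans (identityˡ x) (shift-exponent t m m' e))))))

-- Words in the generators and their shortlex order.

module Words {c ℓ : Level} (G : Group c ℓ) {β : ℕ} (g : Fin β → Group.Carrier G)
             (inv : Fin β → Fin β) (g-inv : ∀ b → Group._≈_ G (g (inv b)) (Group._⁻¹ G (g b))) where
  open Group G
  open GroupNotions G
  open GroupProperties G
  open Powers G
  open import Relation.Binary.Reasoning.Setoid setoid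

  Word : Set
  Word = List (Fin β)

  ⟦_⟧ : Word → Carrier
  ⟦ [] ⟧ = ε
  ⟦ b ∷ w ⟧ = g b ∙ ⟦ w ⟧

  ⟦⟧-++ : ∀ v w → ⟦ v ++ w ⟧ ≈ ⟦ v ⟧ ∙ ⟦ w ⟧
  ⟦⟧-++ [] w = sym (identityˡ _)
  ⟦⟧-++ (b ∷ v) w = trans (∙-congˡ (⟦⟧-++ v w)) (sym (assoc _ _ _))

  invert : Word → Word
  invert [] = []
  invert (b ∷ w) = invert w ∷ʳ inv b

  ⟦⟧-invert : ∀ w → ⟦ invert w ⟧ ≈ ⟦ w ⟧ ⁻¹
  ⟦⟧-invert [] = sym ε⁻¹≈ε
  ⟦⟧-invert (b ∷ w) = begin
    ⟦ invert w ∷ʳ inv b ⟧        ≈⟨ ⟦⟧-++ (invert w) _ ⟩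
    ⟦ invert w ⟧ ∙ (g (inv b) ∙ ε) ≈⟨ ∙-cong (⟦⟧-invert w) (trans (identityʳ _) (g-inv b)) ⟩
    ⟦ w ⟧ ⁻¹ ∙ g b ⁻¹             ≈⟨ ⁻¹-anti-homo-∙ (g b) ⟦ w ⟧ ⟨
    (g b ∙ ⟦ w ⟧) ⁻¹              ∎

  length-invert : ∀ w → length (invert w) ≡ length w
  length-invert [] = ≡.refl
  length-invert (b ∷ w) = ≡.trans (length-++ (invert w)) (≡.trans (ℕ.+-comm _ 1) (≡.cong suc (length-invert w)))

  ⟦⟧-repeat : ∀ m u → ⟦ repeat m u ⟧ ≈ ⟦ u ⟧ ^ℕ m
  ⟦⟧-repeat zero u = refl
  ⟦⟧-repeat (suc m) u = trans (⟦⟧-++ u _) (∙-congˡ (⟦⟧-repeat m u))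

  length-repeat : ∀ m (u : Word) → length (repeat m u) ≡ m * length u
  length-repeat zero u = ≡.refl
  length-repeat (suc m) u = ≡.trans (length-++ u) (≡.cong (length u ℕ.+_) (length-repeat m u))

  repeat-+ : ∀ i j (u : Word) → repeat (i + j) u ≡ repeat i u ++ repeat j u
  repeat-+ zero j u = ≡.refl
  repeat-+ (suc i) j u = ≡.trans (≡.cong (u ++_) (repeat-+ i j u)) (≡.sym (++-assoc u _ _))

  power : Word → ℤ → Word
  power u (+ m) = repeat m u
  power u -[1+ m ] = repeat (suc m) (invert u)

  ⟦⟧-power : ∀ u m → ⟦ power u m ⟧ ≈ ⟦ u ⟧ ^ᶻ m
  ⟦⟧-power u (+ m) = ⟦⟧-repeat m u
  ⟦⟧-power u -[1+ m ] = trans (⟦⟧-repeat (suc m) (invert u)) (^ℕ-cong (suc m) (⟦⟧-invert u))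

  length-power : ∀ u m → length (power u m) ≡ ∣ m ∣ * length u
  length-power u (+ m) = length-repeat m u
  length-power u -[1+ m ] = ≡.trans (length-repeat (suc m) (invert u)) (≡.cong (suc m *_) (length-invert u))

  words : ℕ → List Word
  words zero = [] ∷ []
  words (suc d) = cartesianProductWith _∷_ (allFin β) (words d)

  ∈-words⁺ : ∀ w → w ∈ words (length w)
  ∈-words⁺ [] = here ≡.refl
  ∈-words⁺ (b ∷ w) = ∈-cartesianProductWith⁺ _∷_ (∈-allFin b) (∈-words⁺ w)

  ∈-words⁻ : ∀ d {w} → w ∈ words d → length w ≡ d
  ∈-words⁻ zero (here ≡.refl) = ≡.refl
  ∈-words⁻ (suc d) m with ∈-cartesianProductWith⁻ _∷_ (allFin β) (words d) m
  ... | _ , w , _ , w∈ , ≡.refl = ≡.cong suc (∈-words⁻ d w∈)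

  shorter : ℕ → List Word
  shorter d = concatMap words (upTo d)

  ∈-shorter⁺ : ∀ {d} w → length w < d → w ∈ shorter d
  ∈-shorter⁺ w w<d = ∈-concatMap⁺ words (lose (∈-upTo⁺ w<d) (∈-words⁺ w))

  ∈-shorter⁻ : ∀ {d w} → w ∈ shorter d → length w < d
  ∈-shorter⁻ {d} {w} m with find (∈-concatMap⁻ words {xs = upTo d} m)
  ... | j , j∈ , w∈ = ≡.subst (_< d) (≡.sym (∈-words⁻ j w∈)) (∈-upTo⁻ j∈)

  -- Bijective base-β numeration: it orders words by length, then lexicographically.
  cost : Word → ℕ
  cost [] = 0
  cost (b ∷ w) = suc (toℕ b) + β * cost w

  digit-≤ : ∀ (b : Fin β) {x y} → x < y → suc (toℕ b) + β * x ≤ β * y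
  digit-≤ b {x} {y} x<y = ℕ.≤-trans (ℕ.+-monoˡ-≤ (β * x) (Fin.toℕ<n b))
    (ℕ.≤-trans (ℕ.≤-reflexive (≡.sym (ℕ.*-suc β x))) (ℕ.*-monoʳ-≤ β x<y))

  cost-∷-mono : ∀ (b b' : Fin β) {x y} → x < y → suc (toℕ b) + β * x < suc (toℕ b') + β * y
  cost-∷-mono b b' x<y = ℕ.≤-<-trans (digit-≤ b x<y) (ℕ.m<n+m _ (s≤s z≤n))

  cost-injective : ∀ v w → cost v ≡ cost w → v ≡ w
  cost-injective [] [] _ = ≡.refl
  cost-injective (b ∷ v) (b' ∷ w) e with ℕ.<-cmp (cost v) (cost w)
  ... | tri< lt _ _ = ⊥-elim (ℕ.<-irrefl e (cost-∷-mono b b' lt))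
  ... | tri> _ _ gt = ⊥-elim (ℕ.<-irrefl (≡.sym e) (cost-∷-mono b' b gt))
  ... | tri≈ _ eq _ = ≡.cong₂ _∷_ (Fin.toℕ-injective (ℕ.suc-injective (ℕ.+-cancelʳ-≡ (β * cost w) _ _
                        (≡.subst (λ z → suc (toℕ b) + β * z ≡ suc (toℕ b') + β * cost w) eq e))))
                        (cost-injective v w eq)

  cost-++-< : ∀ b v w → cost w < cost (b ∷ v ++ w)
  cost-++-< b v w = s≤s (ℕ.≤-trans (≤-cost v) (ℕ.≤-trans (ℕ.≤-trans (ℕ.m≤m*n _ β) (ℕ.≤-reflexive (ℕ.*-comm _ β))) (ℕ.m≤n+m _ (toℕ b))))
    where
    instance
      β≢0 : ℕ.NonZero β
      β≢0 = Fin.nonZeroIndex b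
    ≤-cost : ∀ v → cost w ≤ cost (v ++ w)
    ≤-cost [] = ℕ.≤-refl
    ≤-cost (b' ∷ v) = ℕ.<⇒≤ (cost-++-< b' v w)

  -- The first letter is the least significant digit: if the tails differ they decide, and otherwise
  -- the first letters do. Appending `q` changes neither case. With invariance on the other side,
  -- factors of least words are least.
  cost-++-monoˡ : ∀ v w q → cost v < cost w → cost (v ++ q) < cost (w ++ q)
  cost-++-monoˡ [] (b ∷ w) q _ = cost-++-< b w q
  cost-++-monoˡ (b ∷ v) (b' ∷ w) q lt with ℕ.<-cmp (cost v) (cost w)
  ... | tri< v<w _ _ = cost-∷-mono b b' (cost-++-monoˡ v w q v<w)
  ... | tri> _ _ v>w = ⊥-elim (ℕ.<-asym lt (cost-∷-mono b' b v>w))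
  ... | tri≈ _ eq _ with cost-injective v w eq
  ... | ≡.refl = ℕ.+-monoˡ-< (β * cost (w ++ q)) (ℕ.+-cancelʳ-< (β * cost w) _ _ lt)

  cost-++-monoʳ : ∀ p v w → cost v < cost w → cost (p ++ v) < cost (p ++ w)
  cost-++-monoʳ [] v w lt = lt
  cost-++-monoʳ (b ∷ p) v w lt = cost-∷-mono b b (cost-++-monoʳ p v w lt)

  Least : Word → Set ℓ
  Least w = ∀ v → cost v < cost w → ¬ ⟦ v ⟧ ≈ ⟦ w ⟧

  -- For least words, different words have different values; this supplies the injectivity in the
  -- growth inequality.
  least-unique : ∀ v w → Least v → Least w → ⟦ v ⟧ ≈ ⟦ w ⟧ → v ≡ w
  least-unique v w lv lw e with ℕ.<-cmp (cost v) (cost w)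
  ... | tri< lt _ _ = ⊥-elim (lw v lt e)
  ... | tri≈ _ eq _ = cost-injective v w eq
  ... | tri> _ _ gt = ⊥-elim (lv w gt (sym e))

  least-prefix : ∀ p q → Least (p ++ q) → Least p
  least-prefix p q l v lt e = l (v ++ q) (cost-++-monoˡ v p q lt)
    (trans (⟦⟧-++ v q) (trans (∙-congʳ e) (sym (⟦⟧-++ p q))))

  least-suffix : ∀ p q → Least (p ++ q) → Least q
  least-suffix p q l v lt e = l (p ++ v) (cost-++-monoʳ p v q lt)
    (trans (⟦⟧-++ p v) (trans (∙-congˡ e) (sym (⟦⟧-++ p q))))

  least-window : ∀ i m w → Least w → Least (take m (drop i w))
  least-window i m w l = least-prefix (take m (drop i w)) (drop m (drop i w))
    (≡.subst Least (≡.sym (take++drop≡id m (drop i w)))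
      (least-suffix (take i w) (drop i w) (≡.subst Least (≡.sym (take++drop≡id i w)) l)))

  -- Descent on `cost`. A smaller word of equal value cannot be searched for without deciding
  -- equality, hence the double negation.
  least-exists : ∀ w → ¬ ¬ (∃ λ v → Least v × ⟦ v ⟧ ≈ ⟦ w ⟧)
  least-exists w = go w (<-wellFounded (cost w))
    where
    go : ∀ w → Acc _<_ (cost w) → ¬ ¬ (∃ λ v → Least v × ⟦ v ⟧ ≈ ⟦ w ⟧)
    go w (acc rs) k = k (w , (λ v lt e → go v (rs lt) (λ (u , lu , eu) → k (u , lu , trans eu e))) , refl)

  -- Shortest words modulo a right-invariant relation: equality, or the cosets of a cyclic subgroup.

  module Covering {r : Level} (_~_ : Rel Carrier r) (~-reflexive : ∀ {x y} → x ≈ y → x ~ y)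
                  (~-trans : ∀ {x y z} → x ~ y → y ~ z → x ~ z) (~-∙ : ∀ {x y} z → x ~ y → (x ∙ z) ~ (y ∙ z))
                  (generated : ∀ x → ∃ λ w → x ≈ ⟦ w ⟧) where

    CoveredBelow : ℕ → Set (c ⊔ r)
    CoveredBelow d = ∀ x → ∃ λ v → length v < d × x ~ ⟦ v ⟧

    Shortest : Word → Set r
    Shortest w = ∀ v → length v < length w → ¬ ⟦ w ⟧ ~ ⟦ v ⟧

    -- A word is read letter by letter while its prefix is kept equivalent to a word shorter than
    -- `d`. A further letter gives length at most `d`, and right invariance lets the reduction be
    -- applied to the prefix alone.
    reducible⇒covered : ∀ d → (∀ w → length w ≡ d → ∃ λ v → length v < d × ⟦ w ⟧ ~ ⟦ v ⟧) → CoveredBelow d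
    reducible⇒covered zero red with red [] ≡.refl
    ... | _ , () , _
    reducible⇒covered (suc d) red x =
      let (w , x≈w) = generated x
          (v , v<d , e) = go w [] ε (s≤s z≤n) (~-reflexive refl)
      in v , v<d , ~-trans (~-reflexive (trans x≈w (sym (identityˡ _)))) e
      where
      go : ∀ w v y → length v < suc d → y ~ ⟦ v ⟧ → ∃ λ v' → length v' < suc d × (y ∙ ⟦ w ⟧) ~ ⟦ v' ⟧
      go [] v y v<d y~v = v , v<d , ~-trans (~-reflexive (identityʳ y)) y~v
      go (b ∷ w) v y v<d y~v = continue (reduce (v ∷ʳ b) len)
        where
        len : length (v ∷ʳ b) ≤ suc d
        len = ≡.subst (_≤ suc d) (≡.sym (≡.trans (length-++ v) (ℕ.+-comm _ 1))) v<d
        reduce : ∀ u → length u ≤ suc d → ∃ λ v' → length v' < suc d × ⟦ u ⟧ ~ ⟦ v' ⟧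
        reduce u u≤ with ℕ.m≤n⇒m<n∨m≡n u≤
        ... | inj₁ lt = u , lt , ~-reflexive refl
        ... | inj₂ eq = red u eq
        continue : (∃ λ v' → length v' < suc d × ⟦ v ∷ʳ b ⟧ ~ ⟦ v' ⟧) → ∃ λ v' → length v' < suc d × (y ∙ ⟦ b ∷ w ⟧) ~ ⟦ v' ⟧
        continue (v' , v'<d , e) =
          let (v″ , lt , e″) = go w v' (y ∙ g b) v'<d (~-trans (~-∙ (g b) y~v)
                (~-trans (~-reflexive (sym (trans (⟦⟧-++ v _) (∙-congˡ (identityʳ _))))) e))
          in v″ , lt , ~-trans (~-reflexive (sym (assoc _ _ _))) e″

    Decided : ℕ → Set r
    Decided Q = ∀ v w → length v ≤ Q → length w ≤ Q → Dec (⟦ w ⟧ ~ ⟦ v ⟧)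

    -- If some length d has no shortest word, then all words of length d are reducible, and so
    -- everything is covered by shorter words.
    shortest-or-covered : ∀ Q → Decided Q →
      (∀ d → d ≤ Q → ∃ λ w → length w ≡ d × Shortest w) ⊎ (∃ λ d → d ≤ Q × CoveredBelow d)
    shortest-or-covered Q dec = go Q ℕ.≤-refl
      where
      reduce? : ∀ d → d ≤ Q → ∀ w → length w ≡ d → (∃ λ v → length v < d × ⟦ w ⟧ ~ ⟦ v ⟧) ⊎ Shortest w
      reduce? d d≤Q w ≡.refl with all-or-someˡ (shorter (length w)) test
        where
        test : ∀ v → v ∈ shorter (length w) → ¬ (⟦ w ⟧ ~ ⟦ v ⟧) ⊎ ⟦ w ⟧ ~ ⟦ v ⟧
        test v v∈ with dec v w (ℕ.<⇒≤ (ℕ.<-≤-trans (∈-shorter⁻ v∈) d≤Q)) d≤Q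
        ... | yes e = inj₂ e
        ... | no ¬e = inj₁ ¬e
      ... | inj₁ none = inj₂ λ v v<w → none v (∈-shorter⁺ v v<w)
      ... | inj₂ (v , v∈ , e) = inj₁ (v , ∈-shorter⁻ v∈ , e)
      level : ∀ d → d ≤ Q → CoveredBelow d ⊎ (∃ λ w → length w ≡ d × Shortest w)
      level d d≤Q with all-or-someˡ (words d) (λ w w∈ → reduce? d d≤Q w (∈-words⁻ d w∈))
      ... | inj₁ red = inj₁ (reducible⇒covered d λ { w ≡.refl → red w (∈-words⁺ w) })
      ... | inj₂ (w , w∈ , s) = inj₂ (w , ∈-words⁻ d w∈ , s)
      go : ∀ e → e ≤ Q → (∀ d → d ≤ e → ∃ λ w → length w ≡ d × Shortest w) ⊎ (∃ λ d → d ≤ Q × CoveredBelow d)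
      go e e≤Q with level e e≤Q
      ... | inj₁ cov = inj₂ (e , e≤Q , cov)
      go zero _ | inj₂ s = inj₁ λ { zero _ → s }
      go (suc e) e≤Q | inj₂ s with go e (ℕ.<⇒≤ e≤Q)
      ... | inj₂ cov = inj₂ cov
      ... | inj₁ all = inj₁ λ d d≤ → pick d (ℕ.m≤n⇒m<n∨m≡n d≤)
        where
        pick : ∀ d → d < suc e ⊎ d ≡ suc e → ∃ λ w → length w ≡ d × Shortest w
        pick d (inj₁ (s≤s d≤e)) = all d d≤e
        pick d (inj₂ ≡.refl) = s

    ¬¬-decided : ∀ Q → ¬ ¬ Decided Q
    ¬¬-decided Q k = ¬¬-all (shorter (suc Q)) (λ v _ → ¬¬-all (shorter (suc Q)) (λ w _ → ¬¬-excluded-middle))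
      λ all → k λ v w v≤ w≤ → all v (∈-shorter⁺ v (s≤s v≤)) w (∈-shorter⁺ w (s≤s w≤))

  module Finiteness (generated : ∀ x → ∃ λ w → x ≈ ⟦ w ⟧) (infinite : Infinite) where

    module ≈-Cover = Covering _≈_ (λ e → e) trans (λ _ → ∙-congʳ) generated
    module ∼-Cover (t : Carrier) = Covering (_∼[ t ]_) ∼-reflexive ∼-trans ∼-∙ generated

    ≈-uncovered : ∀ d → ¬ ≈-Cover.CoveredBelow d
    ≈-uncovered d cov = infinite (map ⟦_⟧ (shorter d) , λ x → let (v , v<d , e) = cov x in
      Any.map (trans e ∘ reflexive) (∈-map⁺ ⟦_⟧ (∈-shorter⁺ v v<d)))

    -- Finitely many cosets of a finite cyclic group would make G finite.
    covered⇒¬torsion : ∀ t d → ∼-Cover.CoveredBelow t d → ¬ Torsion t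
    covered⇒¬torsion t d cov (n , e) = infinite (cartesianProductWith (λ r v → t ^ℕ r ∙ ⟦ v ⟧) (upTo (suc n)) (shorter d) , λ x →
      let (v , v<d , m , x≈) = cov x
          (r , r< , t^m≈) = torsion-residue t n e m
      in Any.map (λ e' → trans x≈ (trans (∙-congʳ t^m≈) (reflexive e')))
           (∈-cartesianProductWith⁺ (λ r v → t ^ℕ r ∙ ⟦ v ⟧) (∈-upTo⁺ r<) (∈-shorter⁺ v v<d)))

    -- An infinite group has a word of length `L` not equal to any shorter one; the least word of
    -- the same value is then no shorter than `L`.
    long-least-word : ∀ L → ¬ ¬ (∃ λ w → Least w × L ≤ length w)
    long-least-word L k = ≈-Cover.¬¬-decided L λ dec → decide (≈-Cover.shortest-or-covered L dec)
      where
      decide : (∀ d → d ≤ L → ∃ λ w → length w ≡ d × ≈-Cover.Shortest w) ⊎ (∃ λ d → d ≤ L × ≈-Cover.CoveredBelow d) → ⊥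
      decide (inj₂ (d , _ , cov)) = ≈-uncovered d cov
      decide (inj₁ s) with s L ℕ.≤-refl
      ... | w , ≡.refl , shortest = least-exists w λ (v , least , e) →
        k (v , least , ℕ.≮⇒≥ λ v<w → shortest v v<w (sym e))

-- Integer identities for signs and translations.

module IntegerSigns where

  signum : ℤ → ℤ
  signum (+ _) = 1ℤ
  signum -[1+ _ ] = -1ℤ

  signum-* : ∀ i j → i ≢ 0ℤ → j ≢ 0ℤ → signum (i ℤ.* j) ≡ signum i ℤ.* signum j
  signum-* (+ zero) _ i≢0 _ = ⊥-elim (i≢0 ≡.refl)
  signum-* (+ suc _) (+ zero) _ j≢0 = ⊥-elim (j≢0 ≡.refl)
  signum-* -[1+ _ ] (+ zero) _ j≢0 = ⊥-elim (j≢0 ≡.refl)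
  signum-* (+ suc _) (+ suc _) _ _ = ≡.refl
  signum-* (+ suc _) -[1+ _ ] _ _ = ≡.refl
  signum-* -[1+ _ ] (+ suc _) _ _ = ≡.refl
  signum-* -[1+ _ ] -[1+ _ ] _ _ = ≡.refl

  signum-square : ∀ i → signum i ℤ.* signum i ≡ 1ℤ
  signum-square (+ _) = ≡.refl
  signum-square -[1+ _ ] = ≡.refl

  signum-cases : ∀ i → signum i ≡ 1ℤ ⊎ signum i ≡ -1ℤ
  signum-cases (+ _) = inj₁ ≡.refl
  signum-cases -[1+ _ ] = inj₂ ≡.refl

  signum-positive : ∀ i → i ≢ 0ℤ → 0ℤ ℤ.< signum i ℤ.* i
  signum-positive (+ zero) i≢0 = ⊥-elim (i≢0 ≡.refl)
  signum-positive (+ suc n) _ = ≡.subst (0ℤ ℤ.<_) (≡.sym (ℤ.*-identityˡ (+ suc n))) (ℤ.+<+ (s≤s z≤n))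
  signum-positive -[1+ n ] _ = ≡.subst (0ℤ ℤ.<_) (≡.sym (ℤ.-1*i≡-i -[1+ n ])) (ℤ.+<+ (s≤s z≤n))

  solve-inverse : ∀ s p q → p ℤ.+ s ℤ.* q ≡ 0ℤ → (s ℤ.* s) ℤ.* q ≡ ℤ.- (s ℤ.* p)
  solve-inverse s p q e = ≡.trans (expand s p q) (≡.trans (≡.cong (λ z → s ℤ.* z ℤ.- s ℤ.* p) e)
    (≡.trans (≡.cong (ℤ._- s ℤ.* p) (ℤ.*-zeroʳ s)) (ℤ.+-identityˡ _)))
    where
    expand : ∀ s p q → (s ℤ.* s) ℤ.* q ≡ s ℤ.* (p ℤ.+ s ℤ.* q) ℤ.- s ℤ.* p
    expand = ℤSolver.solve-∀

  square-out : ∀ s p → s ℤ.* s ≡ 1ℤ → (s ℤ.* p) ℤ.* s ≡ p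
  square-out s p e = ≡.trans (regroup s p) (≡.trans (≡.cong (ℤ._* p) e) (ℤ.*-identityˡ p))
    where
    regroup : ∀ s p → (s ℤ.* p) ℤ.* s ≡ (s ℤ.* s) ℤ.* p
    regroup = ℤSolver.solve-∀

  telescope : ∀ s p q → s ℤ.* s ≡ 1ℤ → p ℤ.+ s ℤ.* q ℤ.+ s ℤ.* ℤ.- (s ℤ.* p) ≡ s ℤ.* q
  telescope s p q e = ≡.trans (regroup s p q) (≡.trans (≡.cong (λ z → p ℤ.- z ℤ.* p ℤ.+ s ℤ.* q) e) (collapse p (s ℤ.* q)))
    where
    regroup : ∀ s p q → p ℤ.+ s ℤ.* q ℤ.+ s ℤ.* ℤ.- (s ℤ.* p) ≡ p ℤ.- (s ℤ.* s) ℤ.* p ℤ.+ s ℤ.* q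
    regroup = ℤSolver.solve-∀
    collapse : ∀ p r → p ℤ.- 1ℤ ℤ.* p ℤ.+ r ≡ r
    collapse = ℤSolver.solve-∀

  neg-solution : ∀ m p q → m ℤ.* p ℤ.+ q ≡ 0ℤ → q ≡ ℤ.- m ℤ.* p
  neg-solution m p q e = ≡.trans (expand m p q) (≡.trans (≡.cong (ℤ._- m ℤ.* p) e)
    (≡.trans (ℤ.+-identityˡ _) (ℤ.neg-distribˡ-* m p)))
    where
    expand : ∀ m p q → q ≡ (m ℤ.* p ℤ.+ q) ℤ.- m ℤ.* p
    expand = ℤSolver.solve-∀

  cancel-exponent : ∀ m q p → p ≢ 0ℤ → m ℤ.* p ℤ.+ q ℤ.* p ≡ 0ℤ → m ≡ ℤ.- q
  cancel-exponent m q p p≢0 e with ℤ.i*j≡0⇒i≡0∨j≡0 (m ℤ.+ q) (≡.trans (ℤ.*-distribʳ-+ p m q) e)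
  ... | inj₁ e' = ≡.trans (expand m q) (≡.trans (≡.cong (ℤ._- q) e') (ℤ.+-identityˡ _))
    where
    expand : ∀ m q → m ≡ (m ℤ.+ q) ℤ.- q
    expand = ℤSolver.solve-∀
  ... | inj₂ p≡0 = ⊥-elim (p≢0 p≡0)

  collect : ∀ h q₀ q₁ p → h ℤ.* (q₀ ℤ.* p) ℤ.+ q₁ ℤ.* p ≡ (h ℤ.* q₀ ℤ.+ q₁) ℤ.* p
  collect = ℤSolver.solve-∀

  1≢-1 : 1ℤ ≢ -1ℤ
  1≢-1 ()

  +suc≢0 : ∀ {n} → + suc n ≢ 0ℤ
  +suc≢0 ()

  subtract-multiple : ∀ ρ q p → (ρ ℤ.+ q ℤ.* p) ℤ.+ ℤ.- q ℤ.* p ≡ ρ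
  subtract-multiple = ℤSolver.solve-∀

-- A homomorphism to the infinite dihedral group ℤ ⋊ {±1}: `y` acts on the line by m ↦ τ y + σ y ·
-- m.
record SignedHom {c ℓ : Level} (G : Group c ℓ) : Set (c ⊔ ℓ) where
  open Group G
  field
    σ τ : Carrier → ℤ
    σ-cong : ∀ {y z} → y ≈ z → σ y ≡ σ z
    τ-cong : ∀ {y z} → y ≈ z → τ y ≡ τ z
    σ-∙ : ∀ y z → σ (y ∙ z) ≡ σ y ℤ.* σ z
    τ-∙ : ∀ y z → τ (y ∙ z) ≡ τ y ℤ.+ σ y ℤ.* τ z
    σ-cases : ∀ y → σ y ≡ 1ℤ ⊎ σ y ≡ -1ℤ

-- Powers, inverses, conjugates and the kernel of a signed homomorphism.

module SignedHomProperties {c ℓ : Level} (G : Group c ℓ) (h : SignedHom G) where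
  open Group G
  open GroupNotions G
  open GroupProperties G
  open Powers G
  open SignedHom h
  open IntegerSigns

  σ-square : ∀ y → σ y ℤ.* σ y ≡ 1ℤ
  σ-square y with σ y | σ-cases y
  ... | _ | inj₁ ≡.refl = ≡.refl
  ... | _ | inj₂ ≡.refl = ≡.refl

  σ-ε : σ ε ≡ 1ℤ
  σ-ε = ≡.trans (σ-cong (sym (identityˡ ε))) (≡.trans (σ-∙ ε ε) (σ-square ε))

  σ-⁻¹ : ∀ y → σ (y ⁻¹) ≡ σ y
  σ-⁻¹ y = ≡.trans (≡.sym (ℤ.*-identityˡ _)) (≡.trans (≡.cong (ℤ._* σ (y ⁻¹)) (≡.sym (σ-square y)))
    (≡.trans (ℤ.*-assoc (σ y) (σ y) _) (≡.trans (≡.cong (σ y ℤ.*_)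
      (≡.trans (≡.sym (σ-∙ y (y ⁻¹))) (≡.trans (σ-cong (inverseʳ y)) σ-ε))) (ℤ.*-identityʳ (σ y)))))

  σ-^ : ∀ y m → σ y ≡ 1ℤ → σ (y ^ᶻ m) ≡ 1ℤ
  σ-^ y (+ zero) σy = σ-ε
  σ-^ y (+ suc m) σy = ≡.trans (σ-∙ y _) (≡.cong₂ ℤ._*_ σy (σ-^ y (+ m) σy))
  σ-^ y -[1+ m ] σy = go (suc m)
    where
    go : ∀ m → σ ((y ⁻¹) ^ℕ m) ≡ 1ℤ
    go zero = σ-ε
    go (suc m) = ≡.trans (σ-∙ (y ⁻¹) _) (≡.cong₂ ℤ._*_ (≡.trans (σ-⁻¹ y) σy) (go m))

  τ-∙⁺ : ∀ y z → σ y ≡ 1ℤ → τ (y ∙ z) ≡ τ y ℤ.+ τ z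
  τ-∙⁺ y z σy = ≡.trans (τ-∙ y z) (≡.cong (λ q → τ y ℤ.+ q) (≡.trans (≡.cong (ℤ._* τ z) σy) (ℤ.*-identityˡ _)))

  τ-ε : τ ε ≡ 0ℤ
  τ-ε = GroupProperties.identityʳ-unique (AbelianGroup.group ℤ.+-0-abelianGroup) (τ ε) (τ ε) (≡.trans (≡.sym (τ-∙⁺ ε ε σ-ε)) (τ-cong (identityˡ ε)))

  τ-⁻¹ : ∀ y → τ (y ⁻¹) ≡ ℤ.- (σ y ℤ.* τ y)
  τ-⁻¹ y = ≡.trans (≡.sym (ℤ.*-identityˡ _)) (≡.trans (≡.cong (ℤ._* τ (y ⁻¹)) (≡.sym (σ-square y)))
    (solve-inverse (σ y) (τ y) (τ (y ⁻¹)) (≡.trans (≡.sym (τ-∙ y (y ⁻¹))) (≡.trans (τ-cong (inverseʳ y)) τ-ε))))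

  τ-^ℕ : ∀ y m → σ y ≡ 1ℤ → τ (y ^ℕ m) ≡ + m ℤ.* τ y
  τ-^ℕ y zero σy = τ-ε
  τ-^ℕ y (suc m) σy = ≡.trans (τ-∙⁺ y _ σy) (≡.trans (≡.cong (λ q → τ y ℤ.+ q) (τ-^ℕ y m σy)) (≡.sym (ℤ.suc-* (+ m) (τ y))))

  τ-^ : ∀ y m → σ y ≡ 1ℤ → τ (y ^ᶻ m) ≡ m ℤ.* τ y
  τ-^ y (+ m) σy = τ-^ℕ y m σy
  τ-^ y -[1+ m ] σy = ≡.trans (τ-^ℕ (y ⁻¹) (suc m) (≡.trans (σ-⁻¹ y) σy)) (≡.trans (≡.cong (+ suc m ℤ.*_)
    (≡.trans (τ-⁻¹ y) (≡.cong ℤ.-_ (≡.trans (≡.cong (ℤ._* τ y) σy) (ℤ.*-identityˡ _)))))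
    (≡.trans (≡.sym (ℤ.neg-distribʳ-* (+ suc m) (τ y))) (ℤ.neg-distribˡ-* (+ suc m) (τ y))))

  nonzero⇒¬torsion : ∀ y → σ y ≡ 1ℤ → τ y ≢ 0ℤ → ¬ Torsion y
  nonzero⇒¬torsion y σy τy≢0 (q , e) with ℤ.i*j≡0⇒i≡0∨j≡0 (+ suc q) (≡.trans (≡.sym (τ-^ℕ y (suc q) σy)) (≡.trans (τ-cong e) τ-ε))
  ... | inj₁ ()
  ... | inj₂ τy≡0 = τy≢0 τy≡0

  -- On a coset ⟨u⟩z the value of τ moves in steps of τ u ≠ 0, so it identifies the element. Hence
  -- elements of equal τ are separated by the cosets of ⟨u⟩.
  same-τ⇒≈ : ∀ u m {y z} → σ u ≡ 1ℤ → τ u ≢ 0ℤ → y ≈ u ^ᶻ m ∙ z → τ y ≡ τ z → y ≈ z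
  same-τ⇒≈ u m {y} {z} σu τu≢0 e τ≡ with ℤ.i*j≡0⇒i≡0∨j≡0 m (GroupProperties.identityˡ-unique (AbelianGroup.group ℤ.+-0-abelianGroup) (m ℤ.* τ u) (τ z)
      (≡.trans (≡.cong (ℤ._+ τ z) (≡.sym (τ-^ u m σu))) (≡.trans (≡.sym (τ-∙⁺ (u ^ᶻ m) z (σ-^ u m σu))) (≡.trans (≡.sym (τ-cong e)) τ≡))))
  ... | inj₁ ≡.refl = trans e (identityˡ z)
  ... | inj₂ τu≡0 = ⊥-elim (τu≢0 τu≡0)

  Ker : Carrier → Set
  Ker y = σ y ≡ 1ℤ × τ y ≡ 0ℤ

  ker-cong : ∀ {y z} → y ≈ z → Ker y → Ker z
  ker-cong e (σy , τy) = ≡.trans (σ-cong (sym e)) σy , ≡.trans (τ-cong (sym e)) τy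

  ker? : ∀ y → Dec (Ker y)
  ker? y = (σ y ℤ.≟ 1ℤ) ×-dec (τ y ℤ.≟ 0ℤ)

  ker-∙ : ∀ {y z} → Ker y → Ker z → Ker (y ∙ z)
  ker-∙ {y} {z} (σy , τy) (σz , τz) = ≡.trans (σ-∙ y z) (≡.cong₂ ℤ._*_ σy σz) , ≡.trans (τ-∙⁺ y z σy) (≡.cong₂ ℤ._+_ τy τz)

  ker-⁻¹ : ∀ {y} → Ker y → Ker (y ⁻¹)
  ker-⁻¹ {y} (σy , τy) = ≡.trans (σ-⁻¹ y) σy , ≡.trans (τ-⁻¹ y) (≡.cong ℤ.-_ (≡.trans (≡.cong (σ y ℤ.*_) τy) (ℤ.*-zeroʳ (σ y))))

  σ-conjugate : ∀ y z → σ ((y ∙ z) ∙ y ⁻¹) ≡ σ z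
  σ-conjugate y z = ≡.trans (σ-∙ (y ∙ z) (y ⁻¹)) (≡.trans (≡.cong₂ ℤ._*_ (σ-∙ y z) (σ-⁻¹ y)) (square-out (σ y) (σ z) (σ-square y)))

  τ-conjugate : ∀ y z → σ z ≡ 1ℤ → τ ((y ∙ z) ∙ y ⁻¹) ≡ σ y ℤ.* τ z
  τ-conjugate y z σz = ≡.trans (τ-∙ (y ∙ z) (y ⁻¹)) (≡.trans
    (≡.cong₂ (λ p q → p ℤ.+ σ (y ∙ z) ℤ.* q) (τ-∙ y z) (τ-⁻¹ y))
    (≡.trans (≡.cong (λ p → τ y ℤ.+ σ y ℤ.* τ z ℤ.+ p ℤ.* ℤ.- (σ y ℤ.* τ y)) (≡.trans (σ-∙ y z) (≡.trans (≡.cong (σ y ℤ.*_) σz) (ℤ.*-identityʳ (σ y)))))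
      (telescope (σ y) (τ y) (τ z) (σ-square y))))

  ker-conjugate : ∀ y {z} → Ker z → Ker ((y ∙ z) ∙ y ⁻¹)
  ker-conjugate y {z} (σz , τz) = ≡.trans (σ-conjugate y z) σz ,
    ≡.trans (τ-conjugate y z σz) (≡.trans (≡.cong (σ y ℤ.*_) τz) (ℤ.*-zeroʳ (σ y)))

-- The sign-twisted transfer into an infinite cyclic subgroup of finite index.

module Transfer {c ℓ : Level} (G : Group c ℓ) (t : Group.Carrier G) (inf : ¬ Powers.Torsion G t)
  {P : ℕ} (x : Fin P → Group.Carrier G) (cover : ∀ y → ∃ λ j → Powers._∼[_]_ G y t (x j))
  (distinct : Powers.Transversal G t x) where

  open Group G
  open GroupNotions G
  open GroupProperties G
  open Powers G
  open InfiniteOrder t inf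
  open IntegerSigns
  open import Relation.Binary.Reasoning.Setoid setoid
  open MonoidSum ℤ.+-0-commutativeMonoid using (∑-distrib-+; sum-permute; sum-cong-≗) renaming (sum to ∑)
  open SemiringSum (ℤ.+-*-semiring) using (*-distribˡ-sum)

  index : Carrier → Fin P
  index y = proj₁ (cover y)

  height : Carrier → ℤ
  height y = proj₁ (proj₂ (cover y))

  coordinates : ∀ y → y ≈ t ^ᶻ height y ∙ x (index y)
  coordinates y = proj₂ (proj₂ (cover y))

  index-unique : ∀ {y j} → y ∼[ t ] x j → index y ≡ j
  index-unique {y} y∼ = distinct _ _ (∼-trans (∼-sym (height y , coordinates y)) y∼)

  height-unique : ∀ {y j} m → y ≈ t ^ᶻ m ∙ x j → height y ≡ m
  height-unique {y} m e with index-unique (m , e)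
  ... | ≡.refl = exponent-unique (height y) m (trans (sym (coordinates y)) e)

  record Conjugates (y : Carrier) (e f : ℤ) : Set ℓ where
    constructor conjugates
    field equation : y ∙ t ^ᶻ e ≈ t ^ᶻ f ∙ y
  open Conjugates

  conjugate-^ : ∀ {y z w} → y ∙ z ≈ w ∙ y → ∀ q → y ∙ z ^ᶻ q ≈ w ^ᶻ q ∙ y
  conjugate-^ {y} {z} {w} e (+ q) = go e q
    where
    go : ∀ {z w} → y ∙ z ≈ w ∙ y → ∀ q → y ∙ z ^ℕ q ≈ w ^ℕ q ∙ y
    go e zero = trans (identityʳ y) (sym (identityˡ y))
    go {z} {w} e (suc q) = begin
      y ∙ (z ∙ z ^ℕ q)     ≈⟨ assoc _ _ _ ⟨
      (y ∙ z) ∙ z ^ℕ q     ≈⟨ ∙-congʳ e ⟩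
      (w ∙ y) ∙ z ^ℕ q     ≈⟨ assoc _ _ _ ⟩
      w ∙ (y ∙ z ^ℕ q)     ≈⟨ ∙-congˡ (go e q) ⟩
      w ∙ (w ^ℕ q ∙ y)     ≈⟨ assoc _ _ _ ⟨
      (w ∙ w ^ℕ q) ∙ y     ∎
  conjugate-^ {y} {z} {w} e -[1+ q ] = conjugate-^ flipped (+ suc q)
    where
    flipped : y ∙ z ⁻¹ ≈ w ⁻¹ ∙ y
    flipped = begin
      y ∙ z ⁻¹                        ≈⟨ cancel-inner′ w _ ⟨
      w ⁻¹ ∙ (w ∙ (y ∙ z ⁻¹))         ≈⟨ ∙-congˡ (assoc _ _ _) ⟨
      w ⁻¹ ∙ ((w ∙ y) ∙ z ⁻¹)         ≈⟨ ∙-congˡ (∙-congʳ e) ⟨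
      w ⁻¹ ∙ ((y ∙ z) ∙ z ⁻¹)         ≈⟨ ∙-congˡ (trans (assoc _ _ _) (trans (∙-congˡ (inverseʳ z)) (identityʳ y))) ⟩
      w ⁻¹ ∙ y                        ∎

  conjugates-scale : ∀ {y e f} q → Conjugates y e f → Conjugates y (q ℤ.* e) (q ℤ.* f)
  conjugates-scale {y} {e} {f} q h = conjugates (begin
    y ∙ t ^ᶻ (q ℤ.* e)        ≈⟨ ∙-congˡ (^-* t e q) ⟩
    y ∙ (t ^ᶻ e) ^ᶻ q         ≈⟨ conjugate-^ (equation h) q ⟩
    (t ^ᶻ f) ^ᶻ q ∙ y         ≈⟨ ∙-congʳ (^-* t f q) ⟨
    t ^ᶻ (q ℤ.* f) ∙ y        ∎)

  conjugates-unique : ∀ {y e f f'} → Conjugates y e f → Conjugates y e f' → f ≡ f'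
  conjugates-unique {f = f} {f'} h h' = exponent-unique f f' (trans (sym (equation h)) (equation h'))

  conjugates-nonzero : ∀ {y e f} → e ≢ 0ℤ → Conjugates y e f → f ≢ 0ℤ
  conjugates-nonzero {y} {e} e≢0 h ≡.refl = e≢0 (exponent-zero e (∙-cancelˡ y _ _ (trans (equation h) (trans (identityˡ y) (sym (identityʳ y))))))

  abstract
    -- Among the P + 1 elements y tⁱ with i ≤ P two lie in the same coset of ⟨t⟩; their quotient is
    -- a relation y tᵉ = tᶠ y with e > 0.
    conjugator : ∀ y → ∃ λ e → ∃ λ f → Conjugates y (+ suc e) f
    conjugator y with Fin.pigeonhole ℕ.≤-refl (λ (i : Fin (suc P)) → index (y ∙ t ^ℕ toℕ i))
    ... | i , i' , i<i' , eq = o , m , conjugates (∙-cancelʳ (t ^ℕ toℕ i) _ _ (begin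
      (y ∙ t ^ℕ suc o) ∙ t ^ℕ toℕ i        ≈⟨ assoc _ _ _ ⟩
      y ∙ (t ^ℕ suc o ∙ t ^ℕ toℕ i)        ≈⟨ ∙-congˡ (^-+ t (+ suc o) (+ toℕ i)) ⟨
      y ∙ t ^ℕ (suc o ℕ.+ toℕ i)           ≡⟨ ≡.cong (λ q → y ∙ t ^ℕ q) sum-o ⟩
      y ∙ t ^ℕ toℕ i'                      ≈⟨ proj₂ related ⟩
      t ^ᶻ m ∙ (y ∙ t ^ℕ toℕ i)            ≈⟨ assoc _ _ _ ⟨
      (t ^ᶻ m ∙ y) ∙ t ^ℕ toℕ i            ∎))
      where
      o : ℕ
      o = proj₁ (ℕ.m≤n⇒∃[o]m+o≡n i<i')
      sum-o : suc o ℕ.+ toℕ i ≡ toℕ i'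
      sum-o = ≡.trans (≡.cong suc (ℕ.+-comm o (toℕ i))) (proj₂ (ℕ.m≤n⇒∃[o]m+o≡n i<i'))
      related : y ∙ t ^ℕ toℕ i' ∼[ t ] y ∙ t ^ℕ toℕ i
      related = ∼-trans (proj₂ (cover _)) (∼-trans (∼-reflexive (reflexive (≡.cong x (≡.sym eq)))) (∼-sym (proj₂ (cover _))))
      m : ℤ
      m = proj₁ related

  σ : Carrier → ℤ
  σ y = signum (proj₁ (proj₂ (conjugator y)))

  -- Two such relations, scaled to a common exponent, have the same right side, and scaling by a
  -- positive factor preserves signs. So σ does not depend on the relation found by pigeonhole.
  σ-unique : ∀ {y} e {f} → Conjugates y (+ suc e) f → σ y ≡ signum f
  σ-unique {y} e {f} h with conjugator y
  ... | e' , f' , h' = begin-sign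
    where
    scaled : (+ suc e) ℤ.* f' ≡ (+ suc e') ℤ.* f
    scaled = conjugates-unique (conjugates-scale (+ suc e) h')
      (≡.subst (λ z → Conjugates y z ((+ suc e') ℤ.* f)) (ℤ.*-comm (+ suc e') (+ suc e)) (conjugates-scale (+ suc e') h))
    positive-scale : ∀ q j → j ≢ 0ℤ → signum j ≡ signum ((+ suc q) ℤ.* j)
    positive-scale q j j≢0 = ≡.sym (≡.trans (signum-* (+ suc q) j (λ ()) j≢0) (ℤ.*-identityˡ (signum j)))
    begin-sign : signum f' ≡ signum f
    begin-sign = ≡.trans (positive-scale e f' (conjugates-nonzero (λ ()) h'))
      (≡.trans (≡.cong signum scaled) (≡.sym (positive-scale e' f (conjugates-nonzero (λ ()) h))))

  σ-cong : ∀ {y y'} → y ≈ y' → σ y ≡ σ y'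
  σ-cong {y} {y'} y≈ with conjugator y'
  ... | e , f , h = σ-unique e (conjugates (trans (∙-congʳ y≈) (trans (equation h) (∙-congˡ (sym y≈)))))

  σ-∙ : ∀ y z → σ (y ∙ z) ≡ σ y ℤ.* σ z
  σ-∙ y z with conjugator y | conjugator z
  ... | e , f , h | e' , f' , h' = ≡.trans (σ-unique (e' ℕ.+ e ℕ.* suc e') product)
        (≡.trans (signum-* f' f (conjugates-nonzero (λ ()) h') (conjugates-nonzero (λ ()) h)) (ℤ.*-comm (signum f') (signum f)))
    where
    product : Conjugates (y ∙ z) (+ (suc e ℕ.* suc e')) (f' ℤ.* f)
    product = conjugates (begin
      (y ∙ z) ∙ t ^ᶻ (+ (suc e ℕ.* suc e'))       ≈⟨ assoc _ _ _ ⟩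
      y ∙ (z ∙ t ^ᶻ (+ (suc e ℕ.* suc e')))       ≡⟨ ≡.cong (λ q → y ∙ (z ∙ t ^ᶻ q)) (ℤ.pos-* (suc e) (suc e')) ⟩
      y ∙ (z ∙ t ^ᶻ (+ suc e ℤ.* + suc e'))       ≈⟨ ∙-congˡ (equation (conjugates-scale (+ suc e) h')) ⟩
      y ∙ (t ^ᶻ (+ suc e ℤ.* f') ∙ z)             ≈⟨ assoc _ _ _ ⟨
      (y ∙ t ^ᶻ (+ suc e ℤ.* f')) ∙ z             ≡⟨ ≡.cong (λ q → (y ∙ t ^ᶻ q) ∙ z) (ℤ.*-comm (+ suc e) f') ⟩
      (y ∙ t ^ᶻ (f' ℤ.* + suc e)) ∙ z             ≈⟨ ∙-congʳ (equation (conjugates-scale f' h)) ⟩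
      (t ^ᶻ (f' ℤ.* f) ∙ y) ∙ z                   ≈⟨ assoc _ _ _ ⟩
      t ^ᶻ (f' ℤ.* f) ∙ (y ∙ z)                   ∎)

  σ-square : ∀ y → σ y ℤ.* σ y ≡ 1ℤ
  σ-square y = signum-square (proj₁ (proj₂ (conjugator y)))

  σ-cases : ∀ y → σ y ≡ 1ℤ ⊎ σ y ≡ -1ℤ
  σ-cases y = signum-cases (proj₁ (proj₂ (conjugator y)))

  σ-power : ∀ m → σ (t ^ᶻ m) ≡ 1ℤ
  σ-power m = σ-unique 0 {1ℤ} (conjugates (begin
    t ^ᶻ m ∙ t ^ᶻ 1ℤ        ≈⟨ ^-+ t m 1ℤ ⟨
    t ^ᶻ (m ℤ.+ 1ℤ)         ≡⟨ ≡.cong (t ^ᶻ_) (ℤ.+-comm m 1ℤ) ⟩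
    t ^ᶻ (1ℤ ℤ.+ m)         ≈⟨ ^-+ t 1ℤ m ⟩
    t ^ᶻ 1ℤ ∙ t ^ᶻ m        ∎))

  σ-x : ∀ {y j m} → y ≈ t ^ᶻ m ∙ x j → σ y ≡ σ (x j)
  σ-x {y} {j} {m} e = ≡.trans (σ-cong e) (≡.trans (σ-∙ _ _) (≡.trans (≡.cong (ℤ._* σ (x j)) (σ-power m)) (ℤ.*-identityˡ _)))

  -- The transfer into ⟨ t ⟩, twisted by σ: together (σ , τ) is a homomorphism to ℤ ⋊ {±1}.
  τ : Carrier → ℤ
  τ y = ∑ (λ j → σ (x j) ℤ.* height (x j ∙ y))

  next : Carrier → Fin P → Fin P
  next y j = index (x j ∙ y)

  next-inverse : ∀ y z → y ∙ z ≈ ε → ∀ j → next z (next y j) ≡ j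
  next-inverse y z yz≈ε j = index-unique (∼-trans (∼-∙ z (∼-sym (height (x j ∙ y) , coordinates (x j ∙ y))))
    (∼-reflexive (trans (assoc _ _ _) (trans (∙-congˡ yz≈ε) (identityʳ _)))))

  next-permutation : Carrier → Permutation′ P
  next-permutation y = permutation (next y) (next (y ⁻¹)) (next-inverse (y ⁻¹) y (inverseˡ y)) (next-inverse y (y ⁻¹) (inverseʳ y))

  -- Heights add along x j ∙ y ∙ z, the second one taken at the representative `next y j`. There σ
  -- (x j) = σ y · σ (x (next y j)) releases the factor σ y, and what remains is τ z reindexed by
  -- the permutation of the cosets.
  τ-∙ : ∀ y z → τ (y ∙ z) ≡ τ y ℤ.+ σ y ℤ.* τ z
  τ-∙ y z = ≡.trans (sum-cong-≗ term) (≡.trans (∑-distrib-+ (λ j → σ (x j) ℤ.* height (x j ∙ y)) (λ j → σ y ℤ.* h (next y j))) (≡.cong (λ q → τ y ℤ.+ q)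
      (≡.trans (≡.sym (*-distribˡ-sum (σ y) (λ j → h (next y j)))) (≡.cong (σ y ℤ.*_) (≡.sym (sum-permute h (next-permutation y)))))))
    where
    h : Fin P → ℤ
    h j = σ (x j) ℤ.* height (x j ∙ z)
    height-∙ : ∀ j → height (x j ∙ (y ∙ z)) ≡ height (x j ∙ y) ℤ.+ height (x (next y j) ∙ z)
    height-∙ j = height-unique {j = next z (next y j)} _ (begin
      x j ∙ (y ∙ z)                                                      ≈⟨ assoc _ _ _ ⟨
      (x j ∙ y) ∙ z                                                      ≈⟨ ∙-congʳ (coordinates (x j ∙ y)) ⟩
      (t ^ᶻ height (x j ∙ y) ∙ x (next y j)) ∙ z                         ≈⟨ assoc _ _ _ ⟩
      t ^ᶻ height (x j ∙ y) ∙ (x (next y j) ∙ z)                         ≈⟨ ∙-congˡ (coordinates (x (next y j) ∙ z)) ⟩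
      t ^ᶻ height (x j ∙ y) ∙ (t ^ᶻ height (x (next y j) ∙ z) ∙ x (next z (next y j))) ≈⟨ assoc _ _ _ ⟨
      (t ^ᶻ height (x j ∙ y) ∙ t ^ᶻ height (x (next y j) ∙ z)) ∙ x (next z (next y j)) ≈⟨ ∙-congʳ (^-+ t (height (x j ∙ y)) (height (x (next y j) ∙ z))) ⟨
      t ^ᶻ (height (x j ∙ y) ℤ.+ height (x (next y j) ∙ z)) ∙ x (next z (next y j)) ∎)
    σ-next : ∀ j → σ (x j) ≡ σ y ℤ.* σ (x (next y j))
    σ-next j = ≡.trans (≡.sym (ℤ.*-identityʳ _)) (≡.trans (≡.cong (σ (x j) ℤ.*_) (≡.sym (σ-square y)))
      (≡.trans (≡.sym (ℤ.*-assoc (σ (x j)) (σ y) (σ y))) (≡.trans (ℤ.*-comm _ (σ y)) (≡.cong (σ y ℤ.*_)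
        (≡.trans (≡.sym (σ-∙ (x j) y)) (σ-x {m = height (x j ∙ y)} (coordinates (x j ∙ y))))))))
    term : ∀ j → σ (x j) ℤ.* height (x j ∙ (y ∙ z)) ≡ σ (x j) ℤ.* height (x j ∙ y) ℤ.+ σ y ℤ.* h (next y j)
    term j = ≡.trans (≡.cong (σ (x j) ℤ.*_) (height-∙ j)) (≡.trans (ℤ.*-distribˡ-+ (σ (x j)) _ _)
      (≡.cong (λ q → σ (x j) ℤ.* height (x j ∙ y) ℤ.+ q)
        (≡.trans (≡.cong (ℤ._* height (x (next y j) ∙ z)) (σ-next j)) (ℤ.*-assoc (σ y) _ _))))

  τ-cong : ∀ {y y'} → y ≈ y' → τ y ≡ τ y'
  τ-cong {y} {y'} e = sum-cong-≗ λ j → ≡.cong (σ (x j) ℤ.*_) (height-unique _ (trans (∙-congˡ e) (coordinates (x j ∙ y'))))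

  transfer : SignedHom G
  transfer = record { σ = σ ; τ = τ ; σ-cong = σ-cong ; τ-cong = τ-cong ; σ-∙ = σ-∙ ; τ-∙ = τ-∙ ; σ-cases = σ-cases }

  open SignedHomProperties G transfer using (τ-^ℕ)

  common-conjugator : ∀ {q} (p : Fin q → Carrier) → ∃ λ e → ∀ s → ∃ λ f → Conjugates (p s) (+ suc e) f
  common-conjugator {zero} p = 0 , λ ()
  common-conjugator {suc q} p with conjugator (p Fin.zero) | common-conjugator (p ∘ Fin.suc)
  ... | e , f , h | e' , hs = e' ℕ.+ e ℕ.* suc e' , λ
        { Fin.zero → _ , ≡.subst (λ z → Conjugates (p Fin.zero) z ((+ suc e') ℤ.* f))
            (≡.trans (ℤ.*-comm (+ suc e') (+ suc e)) (≡.sym (ℤ.pos-* (suc e) (suc e')))) (conjugates-scale (+ suc e') h)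
        ; (Fin.suc s) → _ , ≡.subst (λ z → Conjugates (p (Fin.suc s)) z ((+ suc e) ℤ.* proj₁ (hs s)))
            (≡.sym (ℤ.pos-* (suc e) (suc e'))) (conjugates-scale (+ suc e) (proj₂ (hs s))) }

  ∑-positive : ∀ {q} (h : Fin q → ℤ) → (∀ s → 0ℤ ℤ.< h s) → Fin q → 0ℤ ℤ.< ∑ h
  ∑-positive {suc q} h pos _ = ℤ.+-mono-<-≤ (pos Fin.zero) (nonneg (h ∘ Fin.suc) (pos ∘ Fin.suc))
    where
    nonneg : ∀ {q} (h : Fin q → ℤ) → (∀ s → 0ℤ ℤ.< h s) → 0ℤ ℤ.≤ ∑ h
    nonneg {zero} h pos = ℤ.≤-refl
    nonneg {suc q} h pos = ℤ.+-mono-≤ (ℤ.<⇒≤ (pos Fin.zero)) (nonneg (h ∘ Fin.suc) (pos ∘ Fin.suc))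

  σ-t : σ t ≡ 1ℤ
  σ-t = ≡.trans (σ-cong (sym (identityʳ t))) (σ-power 1ℤ)

  -- For an exponent e common to all representatives, x j tᵉ has height f j, and σ (x j) is the sign
  -- of f j. All terms of τ (tᵉ) are thus positive; the index of ε shows that there is at least one.
  τ-t≢0 : τ t ≢ 0ℤ
  τ-t≢0 τt≡0 = ℤ.<-irrefl (≡.sym zero-sum) (∑-positive _ positive (index ε))
    where
    e = proj₁ (common-conjugator x)
    f : Fin P → ℤ
    f j = proj₁ (proj₂ (common-conjugator x) j)
    h : ∀ j → Conjugates (x j) (+ suc e) (f j)
    h j = proj₂ (proj₂ (common-conjugator x) j)
    positive : ∀ j → 0ℤ ℤ.< σ (x j) ℤ.* height (x j ∙ t ^ℕ suc e)
    positive j = ≡.subst (0ℤ ℤ.<_) (≡.cong₂ ℤ._*_ (≡.sym (σ-unique e (h j))) (≡.sym (height-unique (f j) (equation (h j)))))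
      (signum-positive (f j) (conjugates-nonzero (λ ()) (h j)))
    zero-sum : τ (t ^ℕ suc e) ≡ 0ℤ
    zero-sum = ≡.trans (τ-^ℕ t (suc e) σ-t) (≡.trans (≡.cong (+ suc e ℤ.*_) τt≡0) (ℤ.*-zeroʳ (+ suc e)))

-- Kernel and image of a signed homomorphism; a short word of infinite order.

module Image {c ℓ : Level} (G : Group c ℓ) {β : ℕ} (g : Fin β → Group.Carrier G)
  (inv : Fin β → Fin β) (g-inv : ∀ b → Group._≈_ G (g (inv b)) (Group._⁻¹ G (g b)))
  (generated : ∀ x → ∃ λ w → Group._≈_ G x (Words.⟦_⟧ G g inv g-inv w))
  (t : Group.Carrier G) {P : ℕ} (x : Fin P → Group.Carrier G)
  (cover : ∀ y → ∃ λ j → Powers._∼[_]_ G y t (x j)) (distinct : Powers.Transversal G t x)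
  (h : SignedHom G) (σ-t : SignedHom.σ h t ≡ 1ℤ) (τ-t≢0 : SignedHom.τ h t ≢ 0ℤ) where

  open Group G
  open GroupNotions G
  open GroupProperties G
  open Powers G
  open Words G g inv g-inv using (Word; ⟦_⟧)
  open SignedHom h
  open SignedHomProperties G h
  open IntegerSigns
  open import Relation.Binary.Reasoning.Setoid setoid

  σ-power : ∀ m → σ (t ^ᶻ m) ≡ 1ℤ
  σ-power m = σ-^ t m σ-t

  index : Carrier → Fin P
  index y = proj₁ (cover y)

  height : Carrier → ℤ
  height y = proj₁ (proj₂ (cover y))

  coordinates : ∀ y → y ≈ t ^ᶻ height y ∙ x (index y)
  coordinates y = proj₂ (proj₂ (cover y))

  σ-x : ∀ {y j m} → y ≈ t ^ᶻ m ∙ x j → σ y ≡ σ (x j)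
  σ-x {y} {j} {m} e = ≡.trans (σ-cong e) (≡.trans (σ-∙ _ _) (≡.trans (≡.cong (ℤ._* σ (x j)) (σ-power m)) (ℤ.*-identityˡ _)))

  τ-x : ∀ m j → τ (t ^ᶻ m ∙ x j) ≡ m ℤ.* τ t ℤ.+ τ (x j)
  τ-x m j = ≡.trans (τ-∙⁺ (t ^ᶻ m) (x j) (σ-power m)) (≡.cong (ℤ._+ τ (x j)) (τ-^ t m σ-t))

  -- A coset of ⟨t⟩ has at most one element with τ = 0, and this is it if it exists. The default
  -- `x j` has τ ≠ 0 and is discarded by the filter defining `N`, so the kernel is listed by
  -- filtering one element per coset.
  candidate : Fin P → Carrier
  candidate j with τ t ∣? τ (x j)
  ... | yes (divides q _) = t ^ᶻ (ℤ.- q) ∙ x j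
  ... | no _ = x j

  candidate-coset : ∀ j → candidate j ∼[ t ] x j
  candidate-coset j with τ t ∣? τ (x j)
  ... | yes (divides q _) = ℤ.- q , refl
  ... | no _ = ∼-reflexive refl

  N : List Carrier
  N = filter ker? (tabulate candidate)

  N-distinct : Distinct N
  N-distinct = AllPairs.filter⁺ ker? (AllPairs.tabulate⁺ λ {i} {j} i≢j e → i≢j (distinct i j
    (∼-trans (∼-sym (candidate-coset i)) (∼-trans (∼-reflexive e) (candidate-coset j)))))

  ∈N⇒ker : ∀ {y} → y ∈ₗ N → Ker y
  ∈N⇒ker m with find m
  ... | z , z∈ , e = ker-cong (sym e) (proj₂ (∈-filter⁻ ker? {xs = tabulate candidate} z∈))

  candidate-ker : ∀ m j → Ker (t ^ᶻ m ∙ x j) → t ^ᶻ m ∙ x j ≈ candidate j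
  candidate-ker m j (_ , τ≡0) with τ t ∣? τ (x j)
  ... | yes (divides q eq) = ∙-congʳ (reflexive (≡.cong (t ^ᶻ_) (cancel-exponent m q (τ t) τ-t≢0
          (≡.trans (≡.cong (λ z → m ℤ.* τ t ℤ.+ z) (≡.sym eq)) (≡.trans (≡.sym (τ-x m j)) τ≡0)))))
  ... | no ¬d = ⊥-elim (¬d (divides (ℤ.- m) (neg-solution m (τ t) _ (≡.trans (≡.sym (τ-x m j)) τ≡0))))

  ker⇒∈N : ∀ {y} → Ker y → y ∈ₗ N
  ker⇒∈N {y} ky = Any.map (λ e → trans y≈ (reflexive e)) (∈-filter⁺ ker? (∈-tabulate⁺ (index y)) (ker-cong y≈ ky))
    where
    y≈ : y ≈ candidate (index y)
    y≈ = trans (coordinates y) (candidate-ker (height y) (index y) (ker-cong (coordinates y) ky))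

  N-normal : IsNormalSubgroup N
  N-normal = ker⇒∈N (σ-ε , τ-ε) , (λ _ _ p q → ker⇒∈N (ker-∙ (∈N⇒ker p) (∈N⇒ker q))) ,
    (λ _ p → ker⇒∈N (ker-⁻¹ (∈N⇒ker p))) , (λ y _ p → ker⇒∈N (ker-conjugate y (∈N⇒ker p)))

  N-lookup-ker : ∀ s → Ker (lookup N s)
  N-lookup-ker s = ∈N⇒ker (Any.map reflexive (∈-lookup s))

  N-lookup-injective : ∀ i j → lookup N i ≈ lookup N j → i ≡ j
  N-lookup-injective i j e = lookup-injective (λ ¬e → ¬e refl) (λ ¬e → ¬e ∘ sym) N-distinct i j (λ ¬e → ¬e e)

  IsGenerator : Carrier → Set c
  IsGenerator r = σ r ≡ 1ℤ × (∀ y → σ y ≡ 1ℤ → ∃ λ q → Ker (y ⁻¹ ∙ r ^ᶻ q))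

  -- Every element is a power of t times some `x j`, so divisibility of all translation lengths is
  -- tested on finitely many values.
  divisors⇒generator : ∀ r → σ r ≡ 1ℤ → τ r ∣ τ t → (∀ j → σ (x j) ≡ 1ℤ → τ r ∣ τ (x j)) → IsGenerator r
  divisors⇒generator r σr (divides q₀ e₀) dx = σr , λ y σy → exponent y σy
    where
    exponent : ∀ y → σ y ≡ 1ℤ → ∃ λ q → Ker (y ⁻¹ ∙ r ^ᶻ q)
    exponent y σy with dx (index y) (≡.trans (≡.sym (σ-x {m = height y} (coordinates y))) σy)
    ... | divides q₁ e₁ = q , ≡.trans (σ-∙ (y ⁻¹) _) (≡.cong₂ ℤ._*_ (≡.trans (σ-⁻¹ y) σy) (σ-^ r q σr)) ,
          (≡.trans (τ-∙⁺ (y ⁻¹) _ (≡.trans (σ-⁻¹ y) σy)) (≡.trans (≡.cong₂ ℤ._+_ (≡.trans (τ-⁻¹ y) (≡.cong ℤ.-_ value)) (τ-^ r q σr))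
            (ℤ.+-inverseˡ (q ℤ.* τ r))))
      where
      q = height y ℤ.* q₀ ℤ.+ q₁
      value : σ y ℤ.* τ y ≡ q ℤ.* τ r
      value = ≡.trans (≡.cong (ℤ._* τ y) σy) (≡.trans (ℤ.*-identityˡ (τ y)) (≡.trans (τ-cong (coordinates y))
        (≡.trans (τ-x (height y) (index y)) (≡.trans (≡.cong₂ (λ u v → height y ℤ.* u ℤ.+ v) e₀ e₁) (collect (height y) q₀ q₁ (τ r))))))

  -- Euclid's algorithm on the values of τ.
  generator : ∃ IsGenerator
  generator = descend t σ-t τ-t≢0 (<-wellFounded ∣ τ t ∣)
    where
    reduce : ∀ r → σ r ≡ 1ℤ → τ r ≢ 0ℤ → ∀ y → σ y ≡ 1ℤ → τ r ∣ τ y ⊎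
      (∃ λ r' → σ r' ≡ 1ℤ × τ r' ≢ 0ℤ × ∣ τ r' ∣ ℕ.< ∣ τ r ∣)
    reduce r σr τr≢0 y σy = split (τ y % τ r) (a≡a%n+[a/n]*n (τ y) (τ r)) (n%d<d (τ y) (τ r))
      where
      instance
        nz : ℤ.NonZero (τ r)
        nz = ℤ.≢-nonZero τr≢0
      q = τ y / τ r
      r' = y ∙ r ^ᶻ (ℤ.- q)
      split : ∀ ρ → τ y ≡ + ρ ℤ.+ q ℤ.* τ r → ρ ℕ.< ∣ τ r ∣ → τ r ∣ τ y ⊎
        (∃ λ r' → σ r' ≡ 1ℤ × τ r' ≢ 0ℤ × ∣ τ r' ∣ ℕ.< ∣ τ r ∣)
      split zero e _ = inj₁ (divides q (≡.trans e (ℤ.+-identityˡ _)))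
      split (suc ρ) e ρ< = inj₂ (r' , ≡.trans (σ-∙ y _) (≡.cong₂ ℤ._*_ σy (σ-^ r (ℤ.- q) σr)) ,
          (λ z → +suc≢0 (≡.trans (≡.sym value) z)) , ≡.subst (ℕ._< ∣ τ r ∣) (≡.cong ∣_∣ (≡.sym value)) ρ<)
        where
        value : τ r' ≡ + suc ρ
        value = ≡.trans (τ-∙⁺ y _ σy) (≡.trans (≡.cong₂ ℤ._+_ e (τ-^ r (ℤ.- q) σr)) (subtract-multiple (+ suc ρ) q (τ r)))
    descend : ∀ r → σ r ≡ 1ℤ → τ r ≢ 0ℤ → Acc ℕ._<_ ∣ τ r ∣ → ∃ IsGenerator
    descend r σr τr≢0 (acc rs) with reduce r σr τr≢0 t σ-t
    ... | inj₂ (r' , σr' , τr'≢0 , lt) = descend r' σr' τr'≢0 (rs lt)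
    ... | inj₁ dt with all-or-some (λ j → reduce-x j)
      where
      reduce-x : ∀ j → (σ (x j) ≡ 1ℤ → τ r ∣ τ (x j)) ⊎ (∃ λ r' → σ r' ≡ 1ℤ × τ r' ≢ 0ℤ × ∣ τ r' ∣ ℕ.< ∣ τ r ∣)
      reduce-x j with σ (x j) ℤ.≟ 1ℤ
      ... | no σ≢1 = inj₁ (⊥-elim ∘ σ≢1)
      ... | yes σ≡1 with reduce r σr τr≢0 (x j) σ≡1
      ... | inj₁ dj = inj₁ λ _ → dj
      ... | inj₂ smaller = inj₂ smaller
    ... | inj₁ dx = r , divisors⇒generator r σr dt dx
    ... | inj₂ (_ , r' , σr' , τr'≢0 , lt) = descend r' σr' τr'≢0 (rs lt)

  -- If σ is trivial on the generators, the image consists of translations and is cyclic. Otherwise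
  -- a generator with σ = -1 is a reflection, and multiplying by it reduces every element to a
  -- translation.
  quotient : QuotientCyclic N ⊎ QuotientDihedral N
  quotient with generator | all-or-some (λ b → σ-cases (g b))
  ... | r , σr , r-generates | inj₁ positive = inj₁ (r , λ y → let (q , ky) = r-generates y (all-positive y) in q , ker⇒∈N ky)
    where
    word-positive : ∀ w → σ ⟦ w ⟧ ≡ 1ℤ
    word-positive [] = σ-ε
    word-positive (b ∷ w) = ≡.trans (σ-∙ (g b) ⟦ w ⟧) (≡.cong₂ ℤ._*_ (positive b) (word-positive w))
    all-positive : ∀ y → σ y ≡ 1ℤ
    all-positive y = ≡.trans (σ-cong (proj₂ (generated y))) (word-positive (proj₁ (generated y)))
  ... | r , σr , r-generates | inj₂ (b , σs) = inj₂ (r , s , ker⇒∈N square , ker⇒∈N conjugation , (λ q m → separate q (∈N⇒ker m)) , classify)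
    where
    s = g b
    σss : σ (s ∙ s) ≡ 1ℤ
    σss = ≡.trans (σ-∙ s s) (σ-square s)
    τss : τ (s ∙ s) ≡ 0ℤ
    τss = ≡.trans (τ-∙ s s) (≡.trans (≡.cong (λ z → τ s ℤ.+ z ℤ.* τ s) σs)
      (≡.trans (≡.cong (λ z → τ s ℤ.+ z) (ℤ.-1*i≡-i (τ s))) (ℤ.+-inverseʳ (τ s))))
    square : Ker ((s ∙ s) ⁻¹ ∙ ε)
    square = ker-∙ (ker-⁻¹ (σss , τss)) (σ-ε , τ-ε)
    srs : Carrier
    srs = (s ∙ r) ∙ s ⁻¹
    σsrs : σ srs ≡ 1ℤ
    σsrs = ≡.trans (σ-conjugate s r) σr
    τsrs : τ srs ≡ ℤ.- τ r
    τsrs = ≡.trans (τ-conjugate s r σr) (≡.trans (≡.cong (ℤ._* τ r) σs) (ℤ.-1*i≡-i (τ r)))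
    σsrs⁻¹ : σ (srs ⁻¹) ≡ 1ℤ
    σsrs⁻¹ = ≡.trans (σ-⁻¹ srs) σsrs
    negate : ∀ y → σ y ≡ 1ℤ → τ (y ⁻¹) ≡ ℤ.- τ y
    negate y σy = ≡.trans (τ-⁻¹ y) (≡.cong ℤ.-_ (≡.trans (≡.cong (ℤ._* τ y) σy) (ℤ.*-identityˡ (τ y))))
    conjugation : Ker (srs ⁻¹ ∙ r ⁻¹)
    conjugation = ≡.trans (σ-∙ (srs ⁻¹) (r ⁻¹)) (≡.cong₂ ℤ._*_ σsrs⁻¹ (≡.trans (σ-⁻¹ r) σr)) ,
      ≡.trans (τ-∙⁺ (srs ⁻¹) (r ⁻¹) σsrs⁻¹) (≡.trans (≡.cong₂ ℤ._+_ (≡.trans (negate srs σsrs) (≡.trans (≡.cong ℤ.-_ τsrs) (ℤ.neg-involutive (τ r)))) (negate r σr))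
        (ℤ.+-inverseʳ (τ r)))
    separate : ∀ q → ¬ Ker (s ⁻¹ ∙ r ^ᶻ q)
    separate q (σ≡1 , _) with ≡.trans (≡.sym σ≡1) (≡.trans (σ-∙ (s ⁻¹) _) (≡.cong₂ ℤ._*_ (≡.trans (σ-⁻¹ s) σs) (σ-^ r q σr)))
    ... | ()
    classify : ∀ y → ∃ λ q → (y ≡[ N ] (r ^ᶻ q)) ⊎ (y ≡[ N ] ((r ^ᶻ q) ∙ s))
    classify y with σ-cases y
    ... | inj₁ σy = let (q , ky) = r-generates y σy in q , inj₁ (ker⇒∈N ky)
    ... | inj₂ σy with r-generates (y ∙ s ⁻¹) (≡.trans (σ-∙ y (s ⁻¹)) (≡.cong₂ ℤ._*_ σy (≡.trans (σ-⁻¹ s) σs)))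
    -- Conjugation by s⁻¹ turns (y s⁻¹)⁻¹ rᵠ = s y⁻¹ rᵠ into y⁻¹ rᵠ s, and the kernel is normal.
    ... | q , ky = q , inj₂ (ker⇒∈N (ker-cong rearrange (ker-conjugate (s ⁻¹) ky)))
      where
      rearrange : (s ⁻¹ ∙ ((y ∙ s ⁻¹) ⁻¹ ∙ r ^ᶻ q)) ∙ (s ⁻¹) ⁻¹ ≈ y ⁻¹ ∙ (r ^ᶻ q ∙ s)
      rearrange = begin
        (s ⁻¹ ∙ ((y ∙ s ⁻¹) ⁻¹ ∙ r ^ᶻ q)) ∙ (s ⁻¹) ⁻¹        ≈⟨ ∙-cong (∙-congˡ (∙-congʳ (⁻¹-anti-homo-∙ y (s ⁻¹)))) (⁻¹-involutive s) ⟩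
        (s ⁻¹ ∙ (((s ⁻¹) ⁻¹ ∙ y ⁻¹) ∙ r ^ᶻ q)) ∙ s           ≈⟨ ∙-congʳ (∙-congˡ (assoc _ _ _)) ⟩
        (s ⁻¹ ∙ ((s ⁻¹) ⁻¹ ∙ (y ⁻¹ ∙ r ^ᶻ q))) ∙ s           ≈⟨ ∙-congʳ (cancel-inner (s ⁻¹) _) ⟩
        (y ⁻¹ ∙ r ^ᶻ q) ∙ s                                  ≈⟨ assoc _ _ _ ⟩
        y ⁻¹ ∙ (r ^ᶻ q ∙ s)                                  ∎

  -- The points are N itself, or N ∪ N b when the word is b b' with b and b' reflections.
  ShortWitness : Set (c ⊔ ℓ)
  ShortWitness = ∃ λ w → 1 ℕ.≤ length w × length w ℕ.≤ 2 × ¬ Torsion ⟦ w ⟧ ×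
    (∃ λ (y : Fin (length w ℕ.* length N) → Carrier) → Transversal ⟦ w ⟧ y)

  letter-witness : ∀ b → σ (g b) ≡ 1ℤ → τ (g b) ≢ 0ℤ → ShortWitness
  letter-witness b σb τb≢0 = b ∷ [] , s≤s z≤n , s≤s z≤n , nonzero⇒¬torsion u σu τu≢0 ,
      (lookup N ∘ place) , transversal
    where
    place : Fin (1 ℕ.* length N) → Fin (length N)
    place = Fin.cast (ℕ.*-identityˡ (length N))
    u = ⟦ b ∷ [] ⟧
    σu : σ u ≡ 1ℤ
    σu = ≡.trans (σ-cong (identityʳ (g b))) σb
    τu≢0 : τ u ≢ 0ℤ
    τu≢0 = τb≢0 ∘ ≡.trans (τ-cong (sym (identityʳ (g b))))
    place-injective : ∀ {s s' : Fin (1 ℕ.* length N)} → place s ≡ place s' → s ≡ s'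
    place-injective {s} {s'} e = Fin.toℕ-injective (≡.trans (≡.sym (Fin.toℕ-cast _ s)) (≡.trans (≡.cong toℕ e) (Fin.toℕ-cast _ s')))
    transversal : Transversal u (lookup N ∘ place)
    transversal s s' (m , e) = place-injective (N-lookup-injective (place s) (place s') (same-τ⇒≈ u m σu τu≢0 e
      (≡.trans (proj₂ (N-lookup-ker (place s))) (≡.sym (proj₂ (N-lookup-ker (place s')))))))

  -- The product translates by τ b - τ b' ≠ 0. Since it has σ = 1, its cosets separate `N` from
  -- `N b` by sign; within each half τ is constant, so equal cosets mean equal elements.
  reflections-witness : ∀ b b' → σ (g b) ≡ -1ℤ → σ (g b') ≡ -1ℤ → τ (g b) ≢ τ (g b') → ShortWitness
  reflections-witness b b' σb σb' τ≢ = b ∷ b' ∷ [] , s≤s z≤n , s≤s (s≤s z≤n) , nonzero⇒¬torsion u σu τu≢0 , y , transversal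
    where
    u = ⟦ b ∷ b' ∷ [] ⟧
    u≈ : u ≈ g b ∙ g b'
    u≈ = ∙-congˡ (identityʳ (g b'))
    σu : σ u ≡ 1ℤ
    σu = ≡.trans (σ-cong u≈) (≡.trans (σ-∙ (g b) (g b')) (≡.cong₂ ℤ._*_ σb σb'))
    τu : τ u ≡ τ (g b) ℤ.- τ (g b')
    τu = ≡.trans (τ-cong u≈) (≡.trans (τ-∙ (g b) (g b')) (≡.cong (λ z → τ (g b) ℤ.+ z) (≡.trans (≡.cong (ℤ._* τ (g b')) σb) (ℤ.-1*i≡-i (τ (g b'))))))
    τu≢0 : τ u ≢ 0ℤ
    τu≢0 z = τ≢ (ℤ.i-j≡0⇒i≡j (τ (g b)) (τ (g b')) (≡.trans (≡.sym τu) z))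
    shift : Fin 2 → Carrier
    shift Fin.zero = ε
    shift (Fin.suc _) = g b
    element : Fin 2 → Fin (length N) → Carrier
    element f s = lookup N s ∙ shift f
    σ-element : ∀ f s → σ (element f s) ≡ σ (shift f)
    σ-element f s = ≡.trans (σ-∙ _ _) (≡.trans (≡.cong (ℤ._* σ (shift f)) (proj₁ (N-lookup-ker s))) (ℤ.*-identityˡ _))
    τ-element : ∀ f s → τ (element f s) ≡ τ (shift f)
    τ-element f s = ≡.trans (τ-∙⁺ _ _ (proj₁ (N-lookup-ker s))) (≡.trans (≡.cong (ℤ._+ τ (shift f)) (proj₂ (N-lookup-ker s))) (ℤ.+-identityˡ _))
    shift-sign : ∀ f f' → σ (shift f) ≡ σ (shift f') → f ≡ f'
    shift-sign Fin.zero Fin.zero _ = ≡.refl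
    shift-sign (Fin.suc Fin.zero) (Fin.suc Fin.zero) _ = ≡.refl
    shift-sign Fin.zero (Fin.suc Fin.zero) e with ≡.trans (≡.sym σ-ε) (≡.trans e σb)
    ... | ()
    shift-sign (Fin.suc Fin.zero) Fin.zero e with ≡.trans (≡.sym σb) (≡.trans e σ-ε)
    ... | ()
    side : Fin (2 ℕ.* length N) → Fin 2
    side i = proj₁ (Fin.remQuot {2} (length N) i)
    place : Fin (2 ℕ.* length N) → Fin (length N)
    place i = proj₂ (Fin.remQuot {2} (length N) i)
    y : Fin (2 ℕ.* length N) → Carrier
    y i = element (side i) (place i)
    separate : ∀ f s f' s' → element f s ∼[ u ] element f' s' → f ≡ f' × s ≡ s'
    separate f s f' s' (m , e) with shift-sign f f' (≡.trans (≡.sym (σ-element f s)) (≡.trans (σ-cong e) (≡.trans (σ-∙ _ _)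
          (≡.trans (≡.cong (ℤ._* σ (element f' s')) (σ-^ u m σu)) (≡.trans (ℤ.*-identityˡ _) (σ-element f' s'))))))
    ... | ≡.refl = ≡.refl , N-lookup-injective s s' (∙-cancelʳ (shift f) _ _ (same-τ⇒≈ u m σu τu≢0 e
            (≡.trans (τ-element f s) (≡.sym (τ-element f s')))))
    transversal : Transversal u y
    transversal i i' e with separate (side i) (place i) (side i') (place i') e
    ... | e₁ , e₂ = ≡.trans (≡.sym (Fin.combine-remQuot {2} (length N) i)) (≡.trans (≡.cong₂ (Fin.combine {2} {length N}) e₁ e₂) (Fin.combine-remQuot {2} (length N) i'))

  -- A generating translation is sought first, then two generating reflections with different
  -- centres. If both searches fail, the image of G fixes a point, although t translates.
  short-witness : ShortWitness
  short-witness with all-or-some letters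
    where
    letters : ∀ b → (σ (g b) ≡ 1ℤ → τ (g b) ≡ 0ℤ) ⊎ (σ (g b) ≡ 1ℤ × τ (g b) ≢ 0ℤ)
    letters b with σ (g b) ℤ.≟ 1ℤ | τ (g b) ℤ.≟ 0ℤ
    ... | no σ≢1 | _ = inj₁ (⊥-elim ∘ σ≢1)
    ... | yes _ | yes τ≡0 = inj₁ λ _ → τ≡0
    ... | yes σ≡1 | no τ≢0 = inj₂ (σ≡1 , τ≢0)
  ... | inj₂ (b , σb , τb≢0) = letter-witness b σb τb≢0
  ... | inj₁ flat = reflections (all-or-some (λ b → σ-cases (g b)))
    where
    reflections : (∀ b → σ (g b) ≡ 1ℤ) ⊎ (∃ λ b → σ (g b) ≡ -1ℤ) → ShortWitness
    reflections found with axis found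
      where
      axis : (∀ b → σ (g b) ≡ 1ℤ) ⊎ (∃ λ b → σ (g b) ≡ -1ℤ) → ∃ λ a → (∀ b → σ (g b) ≡ -1ℤ → τ (g b) ≡ a) ⊎ ShortWitness
      -- Without reflections the condition on the centre is empty, and 0 is a placeholder.
      axis (inj₁ positive) = 0ℤ , inj₁ λ b σb → ⊥-elim (1≢-1 (≡.trans (≡.sym (positive b)) σb))
      axis (inj₂ (b , σb)) with all-or-some compare
        where
        compare : ∀ b' → (σ (g b') ≡ -1ℤ → τ (g b') ≡ τ (g b)) ⊎ (σ (g b') ≡ -1ℤ × τ (g b) ≢ τ (g b'))
        compare b' with σ (g b') ℤ.≟ -1ℤ | τ (g b) ℤ.≟ τ (g b')
        ... | no σ≢ | _ = inj₁ (⊥-elim ∘ σ≢)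
        ... | yes _ | yes e = inj₁ λ _ → ≡.sym e
        ... | yes σ≡ | no τ≢ = inj₂ (σ≡ , τ≢)
      ... | inj₁ same = τ (g b) , inj₁ same
      ... | inj₂ (b' , σb' , τ≢) = 0ℤ , inj₂ (reflections-witness b b' σb σb' τ≢)
    ... | _ , inj₂ witness = witness
    ... | a , inj₁ same = ⊥-elim (τ-t≢0 (t-flat (bounded (proj₁ (generated t)))))
      where
      -- All generators would fix the point a/2 of the line, hence so would t.
      Bounded : Carrier → Set
      Bounded z = (σ z ≡ 1ℤ × τ z ≡ 0ℤ) ⊎ (σ z ≡ -1ℤ × τ z ≡ a)
      bounded : ∀ w → Bounded ⟦ w ⟧
      bounded [] = inj₁ (σ-ε , τ-ε)
      bounded (b ∷ w) with σ-cases (g b) | bounded w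
      ... | inj₁ σb | inj₁ (σw , τw) = inj₁ (ker-∙ (σb , flat b σb) (σw , τw))
      ... | inj₁ σb | inj₂ (σw , τw) = inj₂ (≡.trans (σ-∙ (g b) ⟦ w ⟧) (≡.cong₂ ℤ._*_ σb σw) ,
              ≡.trans (τ-∙⁺ (g b) ⟦ w ⟧ σb) (≡.trans (≡.cong₂ ℤ._+_ (flat b σb) τw) (ℤ.+-identityˡ a)))
      ... | inj₂ σb | inj₁ (σw , τw) = inj₂ (≡.trans (σ-∙ (g b) ⟦ w ⟧) (≡.cong₂ ℤ._*_ σb σw) ,
              ≡.trans (τ-∙ (g b) ⟦ w ⟧) (≡.trans (≡.cong₂ ℤ._+_ (same b σb) (≡.trans (≡.cong (σ (g b) ℤ.*_) τw) (ℤ.*-zeroʳ (σ (g b))))) (ℤ.+-identityʳ a)))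
      ... | inj₂ σb | inj₂ (σw , τw) = inj₁ (≡.trans (σ-∙ (g b) ⟦ w ⟧) (≡.cong₂ ℤ._*_ σb σw) ,
              ≡.trans (τ-∙ (g b) ⟦ w ⟧) (≡.trans (≡.cong₂ ℤ._+_ (same b σb) (≡.trans (≡.cong₂ ℤ._*_ σb τw) (ℤ.-1*i≡-i a))) (ℤ.+-inverseʳ a)))
      t-flat : Bounded ⟦ proj₁ (generated t) ⟧ → τ t ≡ 0ℤ
      t-flat (inj₁ (_ , τw)) = ≡.trans (τ-cong (proj₂ (generated t))) τw
      t-flat (inj₂ (σw , _)) = ⊥-elim (1≢-1 (≡.trans (≡.sym σ-t) (≡.trans (σ-cong (proj₂ (generated t))) σw)))


module VirtuallyCyclic {c ℓ : Level} (G : Group c ℓ) {β : ℕ} (g : Fin β → Group.Carrier G)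
  (inv : Fin β → Fin β) (g-inv : ∀ b → Group._≈_ G (g (inv b)) (Group._⁻¹ G (g b)))
  (generated : ∀ x → ∃ λ w → Group._≈_ G x (Words.⟦_⟧ G g inv g-inv w)) where

  open Group G
  open GroupNotions G
  open Powers G
  open Words G g inv g-inv using (Word; ⟦_⟧)

  -- This forgets the subgroup used for the transfer. Besides the quotient it keeps a short word
  -- with enough separated points to bound `N` later.
  record CyclicOrDihedral : Set (c ⊔ ℓ) where
    field
      N : List Carrier
      N-distinct : Distinct N
      N-normal : IsNormalSubgroup N
      quotient : QuotientCyclic N ⊎ QuotientDihedral N
      word : Word
      word-nonempty : 1 ℕ.≤ length word
      word-short : length word ℕ.≤ 2
      word-infinite : ¬ Torsion ⟦ word ⟧
      points : Fin (length word ℕ.* length N) → Carrier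
      points-transversal : Transversal ⟦ word ⟧ points

  cyclic-or-dihedral : ∀ t → ¬ Torsion t → ∀ {P} (x : Fin P → Carrier) → (∀ y → ∃ λ j → y ∼[ t ] x j) →
    Transversal t x → CyclicOrDihedral
  cyclic-or-dihedral t inf x cover distinct = fromHom (Tr.transfer G t inf x cover distinct)
      (Tr.σ-t G t inf x cover distinct) (Tr.τ-t≢0 G t inf x cover distinct)
    where
    module Tr = Transfer
    fromHom : (h : SignedHom G) → SignedHom.σ h t ≡ 1ℤ → SignedHom.τ h t ≢ 0ℤ → CyclicOrDihedral
    fromHom h σ-t τ-t≢0 with Image.short-witness G g inv g-inv generated t x cover distinct h σ-t τ-t≢0
    ... | w , 1≤w , w≤2 , w-inf , y , transversal = record
      { N = Im.N ; N-distinct = Im.N-distinct ; N-normal = Im.N-normal ; quotient = Im.quotient ; word = w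
      ; word-nonempty = 1≤w ; word-short = w≤2 ; word-infinite = w-inf ; points = y ; points-transversal = transversal }
      where module Im = Image G g inv g-inv generated t x cover distinct h σ-t τ-t≢0

-- Numerical consequences of 8k³ < n.

module CubicBounds where

  ℕ-+-interchange : ∀ a b c d → (a + b) + (c + d) ≡ (a + c) + (b + d)
  ℕ-+-interchange = solve-∀

  -- Every budget below has the form p k³ + q k² < n; for k ≥ 1 the square is absorbed by the cube,
  -- so p + q ≤ 8 is enough.
  cubic≤ : ∀ p q x → 1 ≤ x → p + q ≤ 8 → p * (x * x * x) + q * (x * x) ≤ 8 * (x * x * x)
  cubic≤ p q x@(suc _) _ p+q≤8 = begin
    p * (x * x * x) + q * (x * x)      ≤⟨ ℕ.+-monoʳ-≤ (p * (x * x * x)) (ℕ.*-monoʳ-≤ q (ℕ.m≤m*n (x * x) x)) ⟩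
    p * (x * x * x) + q * (x * x * x)  ≡⟨ ℕ.*-distribʳ-+ (x * x * x) p q ⟨
    (p + q) * (x * x * x)              ≤⟨ ℕ.*-monoˡ-≤ (x * x * x) p+q≤8 ⟩
    8 * (x * x * x)                    ∎
    where open ℕ.≤-Reasoning

  cubic₁ : ∀ x → suc (2 * x) * (2 * x) * x ≡ 4 * (x * x * x) + 2 * (x * x)
  cubic₁ = solve-∀

  cubic₂ : ∀ x → suc x * x * x ≡ 1 * (x * x * x) + 1 * (x * x)
  cubic₂ = solve-∀

  cubic₃ : ∀ x → 1 * (2 * (x * x)) * x ≡ 2 * (x * x * x) + 0 * (x * x)
  cubic₃ = solve-∀

  cubic₄ : ∀ x → 2 * (2 * (x * x) + x) * x ≡ 4 * (x * x * x) + 2 * (x * x)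
  cubic₄ = solve-∀

open CubicBounds

-- A = { a i } is the given finite set, ∂A = { d z } = BA ∖ A, and g enumerates B.
record BoundaryData {c ℓ : Level} (G : Group c ℓ) : Set (c ⊔ ℓ) where
  open Group G
  open GroupNotions G
  field
    β n k : ℕ
    g : Fin β → Carrier
    inv : Fin β → Fin β
    g-inv : ∀ b → g (inv b) ≈ g b ⁻¹
    generated : ∀ x → ∃ λ w → x ≈ Words.⟦_⟧ G g inv g-inv w
    infinite : Infinite
    a : Fin n → Carrier
    d : Fin k → Carrier
    a-injective : ∀ i j → a i ≈ a j → i ≡ j
    step : ∀ b i → (∃ λ j → g b ∙ a i ≈ a j) ⊎ (∃ λ z → g b ∙ a i ≈ d z)
    large : 8 * (k * k * k) < n

-- Paths in A and their exits through the boundary.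

module Boundary {c ℓ : Level} {G : Group c ℓ} (D : BoundaryData G) where

  open BoundaryData D
  open Group G
  open GroupNotions G
  open GroupProperties G
  open Powers G
  open Words G g inv g-inv
  open Finiteness generated infinite
  open import Relation.Binary.Reasoning.Setoid setoid

  Stays : Word → Fin n → Set ℓ
  Stays w i = ∀ r → ∃ λ j → ⟦ drop r w ⟧ ∙ a i ≈ a j

  -- Words act on the left, so a path runs through the suffixes of `w`. The phase `r` and the
  -- boundary point `z` determine `y` by cancellation; hence at most `length w * k` points exit.
  Exits : Word → Carrier → Set ℓ
  Exits w y = ∃ λ (r : Fin (length w)) → ∃ λ z → ⟦ drop (toℕ r) w ⟧ ∙ y ≈ d z

  run : ∀ w i → Stays w i ⊎ Exits w (a i)
  run [] i = inj₁ λ r → i , trans (∙-congʳ (reflexive (≡.cong ⟦_⟧ (drop-[] r)))) (identityˡ _)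
  run (b ∷ w) i with run w i
  ... | inj₂ (r , z , e) = inj₂ (Fin.suc r , z , e)
  ... | inj₁ stays with stays 0
  ... | j , e with step b j
  ... | inj₁ (j' , e') = inj₁ λ { zero → j' , trans (assoc _ _ _) (trans (∙-congˡ e) e') ; (suc r) → stays r }
  ... | inj₂ (z , e') = inj₂ (Fin.zero , z , trans (assoc _ _ _) (trans (∙-congˡ e) e'))

  n>0 : 0 < n
  n>0 = ℕ.≤-<-trans z≤n large

  -- Without boundary A would be closed under the generators, so G would embed in A by acting on a
  -- single point.
  boundary-nonempty : ¬ ¬ Fin k
  boundary-nonempty none = infinite (map (λ j → a j ∙ a i₀ ⁻¹) (allFin n) , λ x → covered x (generated x))
    where
    i₀ = fromℕ< n>0
    covered : ∀ x → (∃ λ w → x ≈ ⟦ w ⟧) → x ∈ₗ map (λ j → a j ∙ a i₀ ⁻¹) (allFin n)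
    covered x (w , x≈w) with run w i₀
    ... | inj₂ (_ , z , _) = ⊥-elim (none z)
    ... | inj₁ stays with stays 0
    ... | j , e = Any.map (λ e' → trans x≈a (reflexive e')) (∈-map⁺ (λ j → a j ∙ a i₀ ⁻¹) (∈-allFin j))
      where
      x≈a : x ≈ a j ∙ a i₀ ⁻¹
      x≈a = begin
        x                               ≈⟨ x≈w ⟩
        ⟦ w ⟧                           ≈⟨ identityʳ _ ⟨
        ⟦ w ⟧ ∙ ε                       ≈⟨ ∙-congˡ (inverseʳ (a i₀)) ⟨
        ⟦ w ⟧ ∙ (a i₀ ∙ a i₀ ⁻¹)        ≈⟨ assoc _ _ _ ⟨
        (⟦ w ⟧ ∙ a i₀) ∙ a i₀ ⁻¹        ≈⟨ ∙-congʳ e ⟩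
        a j ∙ a i₀ ⁻¹                   ∎

  k>0 : 1 ≤ k
  k>0 = ℕ.n≢0⇒n>0 λ k≡0 → boundary-nonempty λ z → Fin.¬Fin0 (≡.subst Fin k≡0 z)

  small : ∀ p q {x} → x ≡ p * (k * k * k) + q * (k * k) → p + q ≤ 8 → x < n
  small p q ≡.refl p+q≤8 = ℕ.≤-<-trans (cubic≤ p q k k>0 p+q≤8) large

  -- If every point exited along some word, then word, phase and boundary point would encode the n
  -- points injectively by fewer than n codes.
  common-point : ∀ {q} b (p : Fin q → Word) → (∀ s → length (p s) ≤ b) → q * b * k < n →
    ∃ λ i → ∀ s → Stays (p s) i
  common-point {q} b p p≤b few with all-or-some {P = λ i → ∃ λ s → Exits (p s) (a i)} {Q = λ i → ∀ s → Stays (p s) i}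
      (λ i → Sum.swap (all-or-some (λ s → run (p s) i)))
  ... | inj₂ r = r
  ... | inj₁ exits = ⊥-elim (ℕ.<⇒≱ few (injection⇒≤* code code-injective))
    where
    code : Fin n → Fin (q * b) × Fin k
    code i = let (s , r , z , _) = exits i in combine s (inject≤ r (p≤b s)) , z
    code-injective : ∀ {i j} → code i ≡ code j → i ≡ j
    code-injective {i} {j} e with exits i | exits j | e
    ... | s , r , z , eᵢ | s' , r' , z' , eⱼ | e' with ,-injectiveʳ e' | Fin.combine-injective s _ s' _ (,-injectiveˡ e')
    ... | ≡.refl | ≡.refl , er with Fin.inject≤-injective _ _ r r' er
    ... | ≡.refl = a-injective i j (∙-cancelˡ _ _ _ (trans eᵢ (sym eⱼ)))

  -- A common point carries both values into A, where equality is equality of indices.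
  same-point : ∀ v w b → length v ≤ b → length w ≤ b → 2 * b * k < n → Dec (⟦ v ⟧ ≈ ⟦ w ⟧)
  same-point v w b v≤b w≤b few with common-point b p p≤b few
    where
    p : Fin 2 → Word
    p Fin.zero = v
    p (Fin.suc _) = w
    p≤b : ∀ s → length (p s) ≤ b
    p≤b Fin.zero = v≤b
    p≤b (Fin.suc _) = w≤b
  ... | i , stays with stays Fin.zero 0 | stays (Fin.suc Fin.zero) 0
  ... | j , e | j' , e' with j Fin.≟ j'
  ... | yes ≡.refl = yes (∙-cancelʳ _ _ _ (trans e (sym e')))
  ... | no j≢j' = no λ v≈w → j≢j' (a-injective _ _ (trans (sym e) (trans (∙-congʳ v≈w) e')))

  -- Double counting the triples (x , i , j) with ⟦ e x ⟧ ∙ a i ≈ a j.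
  module Growth {ξ : Level} {X : Set ξ} (e : X → Word) where

    weight : X → ℕ
    weight x = n ∸ length (e x) * k

    loss : X → ℕ
    loss x = length (e x) * k

    -- The pair of `x` and `i` is coded by (i, j) if the path ends at a j in A, and by `x`, phase
    -- and boundary point otherwise. In the first case a j (a i)⁻¹ is the value of the word and
    -- determines `x`; in the second, cancelling the suffix read recovers a i.
    light-growth : ∀ E → Unique E → (∀ x y → x ∈ E → y ∈ E → ⟦ e x ⟧ ≈ ⟦ e y ⟧ → x ≡ y) →
      length E * n ≤ n * n + sum (map loss E)
    light-growth E unique inj = ℕ.≤-trans (injection⇒length≤ code code-injective targets code∈) (ℕ.≤-reflexive length-targets)
      where
      Target = (Fin n × Fin n) ⊎ (X × ℕ × Fin k)
      codeₛ : Fin (length E) → Fin n → Target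
      codeₛ s i with run (e (lookup E s)) i
      ... | inj₁ stays = inj₁ (i , proj₁ (stays 0))
      ... | inj₂ (r , z , _) = inj₂ (lookup E s , toℕ r , z)
      code : Fin (length E * n) → Target
      code f = let (s , i) = remQuot n f in codeₛ s i
      phases : X → List (ℕ × Fin k)
      phases x = cartesianProduct (upTo (length (e x))) (allFin k)
      exitsOf : X → List (X × ℕ × Fin k)
      exitsOf x = map (x ,_) (phases x)
      pairs : List (Fin n × Fin n)
      pairs = cartesianProduct (allFin n) (allFin n)
      targets : List Target
      targets = map inj₁ pairs ++ map inj₂ (concatMap exitsOf E)
      length-allFin : ∀ m → length (allFin m) ≡ m
      length-allFin m = length-tabulate {n = m} (λ i → i)
      length-exits : ∀ E → length (concatMap exitsOf E) ≡ sum (map loss E)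
      length-exits [] = ≡.refl
      length-exits (x ∷ E) = ≡.trans (length-++ (exitsOf x)) (≡.cong₂ _+_
        (≡.trans (length-map (x ,_) (phases x)) (≡.trans (length-cartesianProduct (upTo (length (e x))) (allFin k))
          (≡.cong₂ _*_ (length-upTo (length (e x))) (length-allFin k)))) (length-exits E))
      length-targets : length targets ≡ n * n + sum (map loss E)
      length-targets = ≡.trans (length-++ (map inj₁ pairs)) (≡.cong₂ _+_
        (≡.trans (length-map inj₁ pairs) (≡.trans (length-cartesianProduct (allFin n) (allFin n))
          (≡.cong₂ _*_ (length-allFin n) (length-allFin n))))
        (≡.trans (length-map inj₂ (concatMap exitsOf E)) (length-exits E)))
      codeₛ∈ : ∀ s i → codeₛ s i ∈ targets
      codeₛ∈ s i with run (e (lookup E s)) i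
      ... | inj₁ stays = ∈-++⁺ˡ (∈-map⁺ inj₁ (∈-cartesianProduct⁺ (∈-allFin i) (∈-allFin _)))
      ... | inj₂ (r , z , _) = ∈-++⁺ʳ (map inj₁ pairs) (∈-map⁺ inj₂ (∈-concatMap⁺ exitsOf {xs = E} (lose (∈-lookup s)
              (∈-map⁺ (lookup E s ,_) (∈-cartesianProduct⁺ (∈-upTo⁺ (Fin.toℕ<n r)) (∈-allFin z))))))
      code∈ : ∀ f → code f ∈ targets
      code∈ f = let (s , i) = remQuot n f in codeₛ∈ s i
      codeₛ-injective : ∀ s i s' i' → codeₛ s i ≡ codeₛ s' i' → s ≡ s' × i ≡ i'
      codeₛ-injective s i s' i' eq with run (e (lookup E s)) i | run (e (lookup E s')) i'
      ... | inj₁ stays | inj₁ stays' with stays 0 | stays' 0 | inj₁-injective eq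
      ... | j , ej | j' , ej' | ≡.refl =
        unique-lookup unique s s' (inj _ _ (∈-lookup s) (∈-lookup s') (∙-cancelʳ _ _ _ (trans ej (sym ej')))) , ≡.refl
      codeₛ-injective s i s' i' () | inj₁ _ | inj₂ _
      codeₛ-injective s i s' i' () | inj₂ _ | inj₁ _
      codeₛ-injective s i s' i' eq | inj₂ (r , z , er) | inj₂ (r' , z' , er') with unique-lookup unique s s' (,-injectiveˡ (inj₂-injective eq))
      ... | ≡.refl with ,-injectiveʳ (inj₂-injective eq)
      ... | eq' with Fin.toℕ-injective (,-injectiveˡ eq') | ,-injectiveʳ eq'
      ... | ≡.refl | ≡.refl = ≡.refl , a-injective i i' (∙-cancelˡ _ _ _ (trans er (sym er')))
      code-injective : ∀ {f f'} → code f ≡ code f' → f ≡ f'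
      code-injective {f} {f'} eq with codeₛ-injective _ _ _ _ eq
      ... | e₁ , e₂ = ≡.trans (≡.sym (Fin.combine-remQuot {length E} n f)) (≡.trans (≡.cong₂ combine e₁ e₂) (Fin.combine-remQuot {length E} n f'))

    -- Words whose loss exceeds n have truncated weight 0. They are removed first, since n - loss is
    -- a true difference only for the others.
    growth : ∀ E → Unique E → (∀ x y → x ∈ E → y ∈ E → ⟦ e x ⟧ ≈ ⟦ e y ⟧ → x ≡ y) →
      sum (map weight E) ≤ n * n
    growth E unique inj = ≡.subst (_≤ n * n) (≡.sym (only-light E))
      (ℕ.+-cancelʳ-≤ (sum (map loss L)) _ _ (≡.subst (_≤ n * n + sum (map loss L)) (≡.sym (total E))
        (light-growth L (Unique.filter⁺ light? unique)
          (λ x y x∈ y∈ → inj x y (proj₁ (∈-filter⁻ light? x∈)) (proj₁ (∈-filter⁻ light? y∈))))))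
      where
      light? : ∀ x → Dec (loss x ≤ n)
      light? x = loss x ℕ.≤? n
      L = filter light? E
      only-light : ∀ E → sum (map weight E) ≡ sum (map weight (filter light? E))
      only-light [] = ≡.refl
      only-light (x ∷ E) with light? x
      ... | yes p rewrite filter-accept light? {xs = E} p = ≡.cong (weight x ℕ.+_) (only-light E)
      ... | no ¬p rewrite filter-reject light? {xs = E} ¬p = ≡.cong₂ _+_ (ℕ.m≤n⇒m∸n≡0 (ℕ.≰⇒≥ ¬p)) (only-light E)
      total : ∀ E → sum (map weight (filter light? E)) + sum (map loss (filter light? E)) ≡ length (filter light? E) * n
      total [] = ≡.refl
      total (x ∷ E) with light? x
      ... | no ¬p rewrite filter-reject light? {xs = E} ¬p = total E
      ... | yes p rewrite filter-accept light? {xs = E} p =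
        ≡.trans (ℕ-+-interchange (weight x) _ (loss x) _) (≡.cong₂ _+_ (ℕ.m∸n+n≡m p) (total E))

  -- Along each coset ⟨ ⟦ t ⟧ ⟩ y the path spelled by t is a line; an exit is recorded by its phase in t
  -- together with the boundary point.
  exits-bound : ∀ t {m} (y : Fin m → Carrier) → (∀ s s' → y s ≈ y s' → s ≡ s') → (∀ s → Exits t (y s)) →
    m ≤ length t * k
  exits-bound t {m} y y-injective exits = injection⇒≤* code code-injective
    where
    code : Fin m → Fin (length t) × Fin k
    code s = let (r , z , _) = exits s in r , z
    code-injective : ∀ {s s'} → code s ≡ code s' → s ≡ s'
    code-injective {s} {s'} eq with exits s | exits s' | ,-injectiveˡ eq | ,-injectiveʳ eq
    ... | r , z , e | _ , _ , e' | ≡.refl | ≡.refl = y-injective s s' (∙-cancelˡ _ _ _ (trans e (sym e')))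

  repetition⇒torsion : ∀ t q q' {y} → q < q' → t ^ℕ q ∙ y ≈ t ^ℕ q' ∙ y → Torsion t
  repetition⇒torsion t q q' {y} q<q' e with ℕ.m≤n⇒∃[o]m+o≡n q<q'
  ... | o , ≡.refl = o , (begin
    t ^ℕ suc o                          ≈⟨ identityˡ _ ⟨
    ε ∙ t ^ℕ suc o                      ≈⟨ ∙-congʳ (inverseˡ (t ^ℕ q)) ⟨
    ((t ^ℕ q) ⁻¹ ∙ t ^ℕ q) ∙ t ^ℕ suc o ≈⟨ assoc _ _ _ ⟩
    (t ^ℕ q) ⁻¹ ∙ (t ^ℕ q ∙ t ^ℕ suc o) ≈⟨ ∙-congˡ (^-+ t (+ q) (+ suc o)) ⟨
    (t ^ℕ q) ⁻¹ ∙ t ^ℕ (q + suc o)      ≡⟨ ≡.cong (λ j → (t ^ℕ q) ⁻¹ ∙ t ^ℕ j) (ℕ.+-suc q o) ⟩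
    (t ^ℕ q) ⁻¹ ∙ t ^ℕ (suc q + o)      ≈⟨ ∙-congˡ (∙-cancelʳ y _ _ e) ⟨
    (t ^ℕ q) ⁻¹ ∙ t ^ℕ q                ≈⟨ inverseˡ _ ⟩
    ε                                   ∎)

  stays⇒torsion : ∀ t i → (∀ q → q ≤ n → ∃ λ j → t ^ℕ q ∙ a i ≈ a j) → Torsion t
  stays⇒torsion t i stays with Fin.pigeonhole ℕ.≤-refl (λ (q : Fin (suc n)) → proj₁ (stays (toℕ q) (Fin.toℕ≤pred[n] q)))
  ... | q , q' , q<q' , eq = repetition⇒torsion t (toℕ q) (toℕ q') q<q'
    (trans (proj₂ (stays (toℕ q) _)) (trans (reflexive (≡.cong a eq)) (sym (proj₂ (stays (toℕ q') _)))))

  -- A walk of n steps that never leaves A visits n + 1 points there and must repeat one.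
  forward-exit : ∀ t i → (∃ λ q → Exits t (⟦ t ⟧ ^ℕ q ∙ a i)) ⊎ Torsion ⟦ t ⟧
  forward-exit t i = conclude (walk n)
    where
    Path : ℕ → Set ℓ
    Path m = ∀ q → q ≤ m → ∃ λ j → ⟦ t ⟧ ^ℕ q ∙ a i ≈ a j
    walk : ∀ m → Path m ⊎ (∃ λ q → Exits t (⟦ t ⟧ ^ℕ q ∙ a i))
    walk zero = inj₁ λ { zero z≤n → i , identityˡ _ }
    walk (suc m) with walk m
    ... | inj₂ exit = inj₂ exit
    ... | inj₁ path with path m ℕ.≤-refl
    ... | j , e with run t j
    ... | inj₂ (r , z , e') = inj₂ (m , r , z , trans (∙-congˡ e) e')
    ... | inj₁ stays = inj₁ λ q q≤ → pick q (ℕ.m≤n⇒m<n∨m≡n q≤)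
      where
      pick : ∀ q → q < suc m ⊎ q ≡ suc m → ∃ λ j → ⟦ t ⟧ ^ℕ q ∙ a i ≈ a j
      pick q (inj₁ (s≤s q≤m)) = path q q≤m
      pick q (inj₂ ≡.refl) = proj₁ (stays 0) , trans (assoc _ _ _) (trans (∙-congˡ e) (proj₂ (stays 0)))
    conclude : Path n ⊎ (∃ λ q → Exits t (⟦ t ⟧ ^ℕ q ∙ a i)) → (∃ λ q → Exits t (⟦ t ⟧ ^ℕ q ∙ a i)) ⊎ Torsion ⟦ t ⟧
    conclude (inj₂ exit) = inj₁ exit
    conclude (inj₁ path) = inj₂ (stays⇒torsion ⟦ t ⟧ i path)

  -- The word is undone from its first letter by `inv b`; the points met are those of the suffixes
  -- with r ≥ 1, the last of them, at r = length w, being x itself.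
  run-back : ∀ w j x → ⟦ w ⟧ ∙ x ≈ a j →
    (∃ λ i → x ≈ a i) ⊎ (∃ λ r → 1 ≤ r × r ≤ length w × (∃ λ z → ⟦ drop r w ⟧ ∙ x ≈ d z))
  run-back [] j x e = inj₁ (j , trans (sym (identityˡ x)) e)
  run-back (b ∷ w) j x e with step (inv b) j
  ... | inj₂ (z , e') = inj₂ (1 , s≤s z≤n , s≤s z≤n , z , trans back e')
    where
    back : ⟦ w ⟧ ∙ x ≈ g (inv b) ∙ a j
    back = trans (sym (cancel-inner′ (g b) _)) (∙-cong (sym (g-inv b)) (trans (sym (assoc _ _ _)) e))
  ... | inj₁ (j' , e') with run-back w j' x (trans back e')
    where
    back : ⟦ w ⟧ ∙ x ≈ g (inv b) ∙ a j
    back = trans (sym (cancel-inner′ (g b) _)) (∙-cong (sym (g-inv b)) (trans (sym (assoc _ _ _)) e))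
  ... | inj₁ r = inj₁ r
  ... | inj₂ (r , _ , r≤ , exit) = inj₂ (suc r , s≤s z≤n , s≤s r≤ , exit)

  backward-exit : ∀ t → ¬ Torsion ⟦ t ⟧ → ∀ i → ∃ λ q → Exits t (⟦ t ⟧ ^ᶻ -[1+ q ] ∙ a i)
  backward-exit t inf i = conclude (walk n)
    where
    T⁻ = ⟦ t ⟧ ⁻¹
    Exit : Set ℓ
    Exit = ∃ λ q → Exits t (T⁻ ^ℕ suc q ∙ a i)
    Path : ℕ → Set ℓ
    Path m = ∀ q → q ≤ m → ∃ λ j → T⁻ ^ℕ q ∙ a i ≈ a j
    t-after-T⁻ : ∀ y → ⟦ t ⟧ ∙ (T⁻ ∙ y) ≈ y
    t-after-T⁻ y = cancel-inner ⟦ t ⟧ y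
    normalise : ∀ m → (∃ λ r → 1 ≤ r × r ≤ length t × (∃ λ z → ⟦ drop r t ⟧ ∙ (T⁻ ^ℕ suc m ∙ a i) ≈ d z)) → Exit
    normalise m (r , 1≤r , r≤ , z , e) with ℕ.m≤n⇒m<n∨m≡n r≤
    ... | inj₁ r<l = m , fromℕ< r<l , z , trans (∙-congʳ (reflexive (≡.cong (λ q → ⟦ drop q t ⟧) (Fin.toℕ-fromℕ< r<l)))) e
    -- An exit at the start of this copy of `t` counts as phase 0 of the copy one step further back,
    -- so that phases stay below `length t`.
    ... | inj₂ ≡.refl = suc m , fromℕ< 1≤r , z , (begin
      ⟦ drop (toℕ (fromℕ< 1≤r)) t ⟧ ∙ (T⁻ ^ℕ suc (suc m) ∙ a i)
        ≡⟨ ≡.cong (λ q → ⟦ drop q t ⟧ ∙ (T⁻ ^ℕ suc (suc m) ∙ a i)) (Fin.toℕ-fromℕ< 1≤r) ⟩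
      ⟦ t ⟧ ∙ (T⁻ ^ℕ suc (suc m) ∙ a i)     ≈⟨ ∙-congˡ (assoc _ _ _) ⟩
      ⟦ t ⟧ ∙ (T⁻ ∙ (T⁻ ^ℕ suc m ∙ a i))    ≈⟨ t-after-T⁻ _ ⟩
      T⁻ ^ℕ suc m ∙ a i                     ≈⟨ identityˡ _ ⟨
      ε ∙ (T⁻ ^ℕ suc m ∙ a i)               ≡⟨ ≡.cong (λ w → ⟦ w ⟧ ∙ (T⁻ ^ℕ suc m ∙ a i)) (drop-length t) ⟨
      ⟦ drop (length t) t ⟧ ∙ (T⁻ ^ℕ suc m ∙ a i) ≈⟨ e ⟩
      d z                                   ∎)
      where
      drop-length : ∀ (w : Word) → drop (length w) w ≡ []
      drop-length [] = ≡.refl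
      drop-length (_ ∷ w) = drop-length w
    walk : ∀ m → Path m ⊎ Exit
    walk zero = inj₁ λ { zero z≤n → i , identityˡ _ }
    walk (suc m) with walk m
    ... | inj₂ exit = inj₂ exit
    ... | inj₁ path with path m ℕ.≤-refl
    ... | j , e with run-back t j (T⁻ ^ℕ suc m ∙ a i) (trans (∙-congˡ (assoc _ _ _)) (trans (t-after-T⁻ _) e))
    ... | inj₂ exit = inj₂ (normalise m exit)
    ... | inj₁ stays = inj₁ λ q q≤ → pick q (ℕ.m≤n⇒m<n∨m≡n q≤)
      where
      pick : ∀ q → q < suc m ⊎ q ≡ suc m → ∃ λ j → T⁻ ^ℕ q ∙ a i ≈ a j
      pick q (inj₁ (s≤s q≤m)) = path q q≤m
      pick q (inj₂ ≡.refl) = stays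
    conclude : Path n ⊎ Exit → Exit
    conclude (inj₂ exit) = exit
    conclude (inj₁ path) with stays⇒torsion T⁻ i path
    ... | q , e = ⊥-elim (inf (q , (begin
      ⟦ t ⟧ ^ℕ suc q            ≈⟨ ^-neg ⟦ t ⟧ -[1+ q ] ⟩
      (T⁻ ^ℕ suc q) ⁻¹          ≈⟨ ⁻¹-cong e ⟩
      ε ⁻¹                      ≈⟨ ε⁻¹≈ε ⟩
      ε                         ∎)))

  lines-bound : ∀ t {m} (p : Fin m → Fin n) → Transversal ⟦ t ⟧ (a ∘ p) →
    (∀ i → ∃ λ q → Exits t (⟦ t ⟧ ^ℕ q ∙ a i)) → m ≤ length t * k
  lines-bound t p distinct exits = exits-bound t (λ s → ⟦ t ⟧ ^ℕ proj₁ (exits (p s)) ∙ a (p s))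
    (λ s s' e → distinct s s' (∼-cancel (+ proj₁ (exits (p s))) (+ proj₁ (exits (p s'))) e)) (λ s → proj₂ (exits (p s)))

  -- The exit forward has exponent at least 0 and the exit backward a negative one. With infinite
  -- order these are different points of the line, so every line uses two of the `length t * k`
  -- exits.
  lines-bound₂ : ∀ t {m} (p : Fin m → Fin n) → Transversal ⟦ t ⟧ (a ∘ p) → ¬ Torsion ⟦ t ⟧ → 2 * m ≤ length t * k
  lines-bound₂ t {m} p distinct inf = exits-bound t (λ f → end (side f) (line f)) end-injective (λ f → exits (side f) (line f))
    where
    open InfiniteOrder ⟦ t ⟧ inf
    side : Fin (2 * m) → Fin 2
    side f = proj₁ (remQuot m f)
    line : Fin (2 * m) → Fin m
    line f = proj₂ (remQuot {2} m f)
    forward : ∀ i → ∃ λ q → Exits t (⟦ t ⟧ ^ℕ q ∙ a i)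
    forward i with forward-exit t i
    ... | inj₁ exit = exit
    ... | inj₂ torsion = ⊥-elim (inf torsion)
    exponent : Fin 2 → Fin m → ℤ
    exponent Fin.zero s = + proj₁ (forward (p s))
    exponent (Fin.suc _) s = -[1+ proj₁ (backward-exit t inf (p s)) ]
    end : Fin 2 → Fin m → Carrier
    end f s = ⟦ t ⟧ ^ᶻ exponent f s ∙ a (p s)
    exits : ∀ f s → Exits t (end f s)
    exits Fin.zero s = proj₂ (forward (p s))
    exits (Fin.suc _) s = proj₂ (backward-exit t inf (p s))
    same-side : ∀ f f' s → exponent f s ≡ exponent f' s → f ≡ f'
    same-side Fin.zero Fin.zero s _ = ≡.refl
    same-side (Fin.suc Fin.zero) (Fin.suc Fin.zero) s _ = ≡.refl
    same-side Fin.zero (Fin.suc Fin.zero) s ()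
    same-side (Fin.suc Fin.zero) Fin.zero s ()
    end-injective : ∀ f f' → end (side f) (line f) ≈ end (side f') (line f') → f ≡ f'
    end-injective f f' e = ≡.trans (≡.sym (Fin.combine-remQuot {2} m f)) (≡.trans (≡.cong₂ combine sides lines) (Fin.combine-remQuot {2} m f'))
      where
      lines : line f ≡ line f'
      lines = distinct (line f) (line f') (∼-cancel (exponent (side f) (line f)) (exponent (side f') (line f')) e)
      sides : side f ≡ side f'
      sides = same-side (side f) (side f') (line f) (exponent-unique _ _ (≡.subst
        (λ s → end (side f) (line f) ≈ end (side f') s) (≡.sym lines) e))

  -- Right multiplication by a common point moves all representatives into A and, acting on the
  -- right, keeps cosets ⟨t⟩y apart.
  shortest-transversal : ∀ t q (w : Fin q → Word) b → (∀ s → length (w s) ≤ b) → q * b * k < n →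
    (∀ s s' → ⟦ w s ⟧ ∼[ t ] ⟦ w s' ⟧ → s ≡ s') → ∃ λ (p : Fin q → Fin n) → Transversal t (a ∘ p)
  shortest-transversal t q w b w≤b few distinct with common-point b w w≤b few
  ... | i , stays = (λ s → proj₁ (stays s 0)) , λ s s' e → distinct s s'
        (∼-∙⁻ (a i) (∼-trans (∼-reflexive (proj₂ (stays s 0))) (∼-trans e (∼-reflexive (sym (proj₂ (stays s' 0)))))))

  module _ (t : Carrier) (Q : ℕ) where
    open ∼-Cover t

    by-length : (∀ d → d ≤ Q → ∃ λ w → length w ≡ d × Shortest w) → Fin (suc Q) → Word
    by-length s f = proj₁ (s (toℕ f) (Fin.toℕ≤pred[n] f))

    by-length-length : ∀ s f → length (by-length s f) ≡ toℕ f
    by-length-length s f = proj₁ (proj₂ (s (toℕ f) (Fin.toℕ≤pred[n] f)))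

    -- In a common coset the shorter word would contradict that the longer one is shortest.
    by-length-distinct : ∀ s f f' → ⟦ by-length s f ⟧ ∼[ t ] ⟦ by-length s f' ⟧ → f ≡ f'
    by-length-distinct s f f' e with ℕ.<-cmp (toℕ f) (toℕ f')
    ... | tri≈ _ eq _ = Fin.toℕ-injective eq
    ... | tri< lt _ _ = ⊥-elim (proj₂ (proj₂ (s (toℕ f') _)) (by-length s f)
            (≡.subst₂ _<_ (≡.sym (by-length-length s f)) (≡.sym (by-length-length s f')) lt) (∼-sym e))
    ... | tri> _ _ gt = ⊥-elim (proj₂ (proj₂ (s (toℕ f) _)) (by-length s f')
            (≡.subst₂ _<_ (≡.sym (by-length-length s f')) (≡.sym (by-length-length s f)) gt) e)

    by-length-≤ : ∀ s f → length (by-length s f) ≤ Q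
    by-length-≤ s f = ≡.subst (_≤ Q) (≡.sym (by-length-length s f)) (Fin.toℕ≤pred[n] f)

  module Short (t : Word) (short : length t ≤ 2) where
    open ∼-Cover ⟦ t ⟧

    -- If t were torsion, no finite set of cosets would cover G, so shortest words of the lengths 0
    -- to 2k give 2k + 1 lines meeting A. Each has an exit, but there are at most 2k exits.
    exits⇒¬torsion : (∀ i → ∃ λ q → Exits t (⟦ t ⟧ ^ℕ q ∙ a i)) → ¬ Torsion ⟦ t ⟧
    exits⇒¬torsion exits torsion = ¬¬-decided (2 * k) λ dec → decide (shortest-or-covered (2 * k) dec)
      where
      few : suc (2 * k) * (2 * k) * k < n
      few = small 4 2 (cubic₁ k) (ℕ.m≤m+n 6 2)
      decide : (∀ d → d ≤ 2 * k → ∃ λ w → length w ≡ d × Shortest w) ⊎ (∃ λ d → d ≤ 2 * k × CoveredBelow d) → ⊥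
      decide (inj₂ (d , _ , cov)) = covered⇒¬torsion ⟦ t ⟧ d cov torsion
      decide (inj₁ s) =
        let (p , distinct) = shortest-transversal ⟦ t ⟧ _ (by-length ⟦ t ⟧ (2 * k) s) (2 * k)
              (by-length-≤ ⟦ t ⟧ (2 * k) s) few (by-length-distinct ⟦ t ⟧ (2 * k) s)
        in ℕ.<-irrefl ≡.refl (ℕ.≤-trans (lines-bound t p distinct exits) (ℕ.*-monoˡ-≤ k short))

    few-short : ∀ {q} → q ≤ suc k → q * k * k < n
    few-short {q} q≤ = ℕ.≤-<-trans (ℕ.*-monoˡ-≤ k (ℕ.*-monoˡ-≤ k q≤))
      (small 1 1 (cubic₂ k) (ℕ.m≤m+n 2 6))

    module _ (inf : ¬ Torsion ⟦ t ⟧) where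
      open InfiniteOrder ⟦ t ⟧ inf

      few-lines : ∀ {q} (w : Fin q → Word) → q ≤ suc k → (∀ s → length (w s) ≤ k) →
        (∀ s s' → ⟦ w s ⟧ ∼[ ⟦ t ⟧ ] ⟦ w s' ⟧ → s ≡ s') → 2 * q ≤ length t * k
      few-lines w q≤ w≤ distinct =
        let (p , transversal) = shortest-transversal ⟦ t ⟧ _ w k w≤ (few-short q≤) distinct
        in lines-bound₂ t p transversal inf

      too-many : ¬ 2 * suc k ≤ length t * k
      too-many le = ℕ.<⇒≱ (ℕ.*-monoʳ-< 2 (ℕ.n<1+n k)) (ℕ.≤-trans le (ℕ.*-monoˡ-≤ k short))

      -- Otherwise shortest words of the lengths 0 to k give k + 1 lines with two exits each, while
      -- at most 2k exits exist.
      covered : Decided k → ∃ λ e → e ≤ k × CoveredBelow e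
      covered dec with shortest-or-covered k dec
      ... | inj₂ cov = cov
      ... | inj₁ s = ⊥-elim (too-many (few-lines (by-length ⟦ t ⟧ k s) ℕ.≤-refl (by-length-≤ ⟦ t ⟧ k s) (by-length-distinct ⟦ t ⟧ k s)))

      -- The points are replaced by words shorter than k and moved into A. An inequality of naturals
      -- is stable under double negation, so the cosets may be taken as decided.
      transversal-bound : ∀ {m} (y : Fin m → Carrier) → Transversal ⟦ t ⟧ y → 2 * m ≤ length t * k
      transversal-bound {m} y transversal with m ℕ.≤? suc k
      ... | yes m≤ = bound m≤ y transversal
        where
        bound : ∀ {q} → q ≤ suc k → (y : Fin q → Carrier) → Transversal ⟦ t ⟧ y → 2 * q ≤ length t * k
        bound q≤ y transversal = decidable-stable (_ ℕ.≤? _) λ fails → ¬¬-decided k λ dec → fails (conclude (covered dec))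
          where
          conclude : (∃ λ e → e ≤ k × CoveredBelow e) → _
          conclude (e , e≤k , cov) = few-lines (λ s → proj₁ (cov (y s))) q≤
            (λ s → ℕ.<⇒≤ (ℕ.<-≤-trans (proj₁ (proj₂ (cov (y s)))) e≤k))
            (λ s s' e → transversal s s' (∼-trans (proj₂ (proj₂ (cov (y s)))) (∼-trans e (∼-sym (proj₂ (proj₂ (cov (y s'))))))))
      -- The budget for a common point covers only k + 1 words, but already k + 1 of the points are
      -- too many.
      ... | no m≰ = ⊥-elim (too-many (decidable-stable (_ ℕ.≤? _) λ fails → ¬¬-decided k λ dec → fails (conclude (covered dec))))
        where
        q≤m : suc k ≤ m
        q≤m = ℕ.<⇒≤ (ℕ.≰⇒> m≰)
        y' : Fin (suc k) → Carrier
        y' s = y (inject≤ s q≤m)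
        conclude : (∃ λ e → e ≤ k × CoveredBelow e) → 2 * suc k ≤ length t * k
        conclude (e , e≤k , cov) = few-lines (λ s → proj₁ (cov (y' s))) ℕ.≤-refl
            (λ s → ℕ.<⇒≤ (ℕ.<-≤-trans (proj₁ (proj₂ (cov (y' s)))) e≤k))
            (λ s s' e → Fin.inject≤-injective _ _ s s' (transversal _ _ (∼-trans (proj₂ (proj₂ (cov (y' s)))) (∼-trans e (∼-sym (proj₂ (proj₂ (cov (y' s')))))))))

      drop-length-++ : ∀ (v w : Word) → drop (length v) (v ++ w) ≡ w
      drop-length-++ [] w = ≡.refl
      drop-length-++ (_ ∷ v) w = drop-length-++ v w

      -- If ⟦ w ⟧ ⟦ v ⟧⁻¹ = t ^ m with m large, then the points t ^ s a i (s ≤ k²) of one line in A lie in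
      -- different cosets of ⟨ t ^ m ⟩, more than a word of length 2k admits.
      exponent-small : ∀ v w m → length v ≤ k → length w ≤ k → ⟦ w ⟧ ≈ ⟦ t ⟧ ^ᶻ m ∙ ⟦ v ⟧ → ∣ m ∣ ≤ k * k
      exponent-small v w m v≤ w≤ e = ℕ.≮⇒≥ contradiction
        where
        Y : Word
        Y = w ++ invert v
        Y≈ : ⟦ Y ⟧ ≈ ⟦ t ⟧ ^ᶻ m
        Y≈ = begin
          ⟦ w ++ invert v ⟧                     ≈⟨ ⟦⟧-++ w _ ⟩
          ⟦ w ⟧ ∙ ⟦ invert v ⟧                  ≈⟨ ∙-cong e (⟦⟧-invert v) ⟩
          (⟦ t ⟧ ^ᶻ m ∙ ⟦ v ⟧) ∙ ⟦ v ⟧ ⁻¹       ≈⟨ assoc _ _ _ ⟩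
          ⟦ t ⟧ ^ᶻ m ∙ (⟦ v ⟧ ∙ ⟦ v ⟧ ⁻¹)       ≈⟨ ∙-congˡ (inverseʳ _) ⟩
          ⟦ t ⟧ ^ᶻ m ∙ ε                        ≈⟨ identityʳ _ ⟩
          ⟦ t ⟧ ^ᶻ m                            ∎
        Y-power : ∀ q → ⟦ Y ⟧ ^ᶻ q ≈ ⟦ t ⟧ ^ᶻ (q ℤ.* m)
        Y-power q = trans (^-cong q Y≈) (sym (^-* ⟦ t ⟧ m q))
        Y≤ : length Y ≤ 2 * k
        Y≤ = ℕ.≤-trans (ℕ.≤-reflexive (length-++ w)) (ℕ.+-mono-≤ w≤ (ℕ.≤-trans (ℕ.≤-reflexive (length-invert v)) (ℕ.≤-trans v≤ (ℕ.m≤m+n k 0))))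
        T : Word
        T = repeat (k * k) t
        T≤ : length T ≤ 2 * (k * k)
        T≤ = ℕ.≤-trans (ℕ.≤-reflexive (length-repeat (k * k) t)) (ℕ.≤-trans (ℕ.*-monoʳ-≤ (k * k) short) (ℕ.≤-reflexive (ℕ.*-comm (k * k) 2)))
        few : 1 * (2 * (k * k)) * k < n
        few = small 2 0 (cubic₃ k) (ℕ.m≤m+n 2 6)
        origin : ∃ λ i → ∀ (s : Fin 1) → Stays T i
        origin = common-point (2 * (k * k)) (λ _ → T) (λ _ → T≤) few
        i = proj₁ origin
        on-line : (s : Fin (suc (k * k))) → ∃ λ j → ⟦ t ⟧ ^ℕ toℕ s ∙ a i ≈ a j
        on-line s with proj₂ origin Fin.zero (length (repeat (k * k ∸ toℕ s) t))
        ... | j , e' = j , trans (∙-congʳ (trans (sym (⟦⟧-repeat (toℕ s) t)) (reflexive (≡.cong ⟦_⟧ (≡.sym suffix))))) e'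
          where
          suffix : drop (length (repeat (k * k ∸ toℕ s) t)) T ≡ repeat (toℕ s) t
          suffix = ≡.trans (≡.cong (drop (length (repeat (k * k ∸ toℕ s) t)))
            (≡.trans (≡.cong (λ q → repeat q t) (≡.sym (ℕ.m∸n+n≡m (Fin.toℕ≤pred[n] s)))) (repeat-+ (k * k ∸ toℕ s) (toℕ s) t)))
            (drop-length-++ (repeat (k * k ∸ toℕ s) t) _)
        contradiction : ¬ k * k < ∣ m ∣
        contradiction big = ℕ.<⇒≱ (ℕ.≤-<-trans (ℕ.≤-trans (ℕ.*-monoˡ-≤ k Y≤) (ℕ.≤-reflexive (ℕ.*-assoc 2 k k))) (ℕ.*-monoʳ-< 2 (ℕ.n<1+n (k * k))))
          (lines-bound₂ Y (λ s → proj₁ (on-line s)) distinct Y-inf)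
          where
          m≢0 : m ≢ 0ℤ
          m≢0 ≡.refl = ℕ.n≮0 big
          Y-inf : ¬ Torsion ⟦ Y ⟧
          Y-inf (q , e') with ℤ.i*j≡0⇒i≡0∨j≡0 (+ suc q) (exponent-zero (+ suc q ℤ.* m) (trans (sym (Y-power (+ suc q))) e'))
          ... | inj₁ ()
          ... | inj₂ m≡0 = m≢0 m≡0
          distinct : Transversal ⟦ Y ⟧ (λ s → a (proj₁ (on-line s)))
          distinct s s' (q , e') = Fin.toℕ-injective (ℤ.+-injective (≡.trans relation (≡.cong (λ o → o ℤ.+ + toℕ s') (≡.trans (≡.cong (ℤ._* m) q≡0) ≡.refl))))
            where
            relation : + toℕ s ≡ q ℤ.* m ℤ.+ + toℕ s'
            relation = exponent-unique (+ toℕ s) (q ℤ.* m ℤ.+ + toℕ s') (begin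
              ⟦ t ⟧ ^ℕ toℕ s ∙ a i                                ≈⟨ proj₂ (on-line s) ⟩
              _                                                   ≈⟨ e' ⟩
              ⟦ Y ⟧ ^ᶻ q ∙ a (proj₁ (on-line s'))                 ≈⟨ ∙-cong (Y-power q) (sym (proj₂ (on-line s'))) ⟩
              ⟦ t ⟧ ^ᶻ (q ℤ.* m) ∙ (⟦ t ⟧ ^ℕ toℕ s' ∙ a i)        ≈⟨ assoc _ _ _ ⟨
              (⟦ t ⟧ ^ᶻ (q ℤ.* m) ∙ ⟦ t ⟧ ^ℕ toℕ s') ∙ a i        ≈⟨ ∙-congʳ (^-+ ⟦ t ⟧ (q ℤ.* m) (+ toℕ s')) ⟨
              ⟦ t ⟧ ^ᶻ (q ℤ.* m ℤ.+ + toℕ s') ∙ a i               ∎)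
            difference : q ℤ.* m ≡ + toℕ s ℤ.- + toℕ s'
            difference = ≡.sym (≡.trans (≡.cong (λ o → o ℤ.- + toℕ s') relation) (≡.trans (ℤ.+-assoc (q ℤ.* m) _ _)
              (≡.trans (≡.cong (λ o → q ℤ.* m ℤ.+ o) (ℤ.+-inverseʳ (+ toℕ s'))) (ℤ.+-identityʳ _))))
            q≡0 : q ≡ 0ℤ
            q≡0 = ℤ.∣i∣≡0⇒i≡0 (ℕ.n<1⇒n≡0 (ℕ.*-cancelʳ-< ∣ m ∣ ∣ q ∣ 1 (ℕ.≤-<-trans le
                    (ℕ.<-≤-trans big (ℕ.≤-reflexive (≡.sym (ℕ.*-identityˡ _)))))))
              where
              le : ∣ q ∣ * ∣ m ∣ ≤ k * k
              le = ≡.subst (_≤ k * k) (≡.trans (≡.cong ∣_∣ (≡.sym difference)) (ℤ.abs-* q m))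
                (ℕ.≤-trans (ℕ.≤-reflexive (≡.cong ∣_∣ (ℤ.m-n≡m⊖n (toℕ s) (toℕ s'))))
                  (ℕ.≤-trans (ℤ.∣m⊝n∣≤m⊔n (toℕ s) (toℕ s')) (ℕ.⊔-lub (Fin.toℕ≤pred[n] s) (Fin.toℕ≤pred[n] s'))))

      -- The bound on exponents leaves finitely many m to try, and each trial compares two words
      -- short enough to be moved into A.
      decided : Decided k
      decided v w v≤ w≤ = map′ find-exponent bound-exponent
          (ℕ.anyUpTo? (λ m → test (+ m) ⊎-dec test (ℤ.- + m)) (suc (k * k)))
        where
        -- Length of a power with exponent up to k² of a word of length at most 2, followed by a
        -- word of length at most k.
        b = 2 * (k * k) + k
        few : 2 * b * k < n
        few = small 4 2 (cubic₄ k) (ℕ.m≤m+n 6 2)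
        test : ∀ m → Dec (∣ m ∣ ≤ k * k × ⟦ w ⟧ ≈ ⟦ t ⟧ ^ᶻ m ∙ ⟦ v ⟧)
        test m with ∣ m ∣ ℕ.≤? k * k
        ... | no m≰ = no (m≰ ∘ proj₁)
        ... | yes m≤ = map′ (λ e → m≤ , trans e value) (λ (_ , e) → trans e (sym value))
            (same-point w (power t m ++ v) b (ℕ.≤-trans w≤ (ℕ.m≤n+m k _)) len few)
          where
          value : ⟦ power t m ++ v ⟧ ≈ ⟦ t ⟧ ^ᶻ m ∙ ⟦ v ⟧
          value = trans (⟦⟧-++ (power t m) v) (∙-congʳ (⟦⟧-power t m))
          len : length (power t m ++ v) ≤ b
          len = ℕ.≤-trans (ℕ.≤-reflexive (≡.trans (length-++ (power t m)) (≡.cong (ℕ._+ length v) (length-power t m))))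
            (ℕ.+-mono-≤ (ℕ.≤-trans (ℕ.*-mono-≤ m≤ short) (ℕ.≤-reflexive (ℕ.*-comm (k * k) 2))) v≤)
        find-exponent : (∃ λ m → m < suc (k * k) × (_ ⊎ _)) → ⟦ w ⟧ ∼[ ⟦ t ⟧ ] ⟦ v ⟧
        find-exponent (m , _ , inj₁ (_ , e)) = + m , e
        find-exponent (m , _ , inj₂ (_ , e)) = ℤ.- + m , e
        bound-exponent : ⟦ w ⟧ ∼[ ⟦ t ⟧ ] ⟦ v ⟧ → ∃ λ m → m < suc (k * k) × (_ ⊎ _)
        bound-exponent (+ m , e) = m , s≤s (exponent-small v w (+ m) v≤ w≤ e) , inj₁ (exponent-small v w (+ m) v≤ w≤ e , e)
        bound-exponent (-[1+ m ] , e) = suc m , s≤s (exponent-small v w -[1+ m ] v≤ w≤ e) , inj₂ (exponent-small v w -[1+ m ] v≤ w≤ e , e)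

-- Representatives of an equivalence relation decidable on a finite list.

module Representatives where

  representatives : ∀ {a r} {X : Set a} {R : X → X → Set r} → (∀ {x y z} → R x y → R y z → R x z) →
    (∀ {x y} → R x y → R y x) → (∀ {x} → R x x) → (xs : List X) → (∀ x y → x ∈ xs → y ∈ xs → Dec (R x y)) →
    ∃ λ ys → AllPairs (λ x y → ¬ R x y) ys × (∀ x → x ∈ xs → ∃ λ y → y ∈ ys × R x y)
  representatives {R = R} tr sy rf xs dec = let (ys , p , _ , c) = go xs (λ m → m) in ys , p , c
    where
    go : ∀ zs → (∀ {x} → x ∈ zs → x ∈ xs) → ∃ λ ys → AllPairs (λ x y → ¬ R x y) ys ×
      (∀ {y} → y ∈ ys → y ∈ xs) × (∀ x → x ∈ zs → ∃ λ y → y ∈ ys × R x y)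
    go [] _ = [] , [] , (λ ()) , (λ _ ())
    go (z ∷ zs) sub with go zs (sub ∘ there)
    ... | ys , p , ys⊆ , c with all-or-someˡ {P = λ y → ¬ R z y} {Q = R z} ys test
      where
      test : ∀ y → y ∈ ys → ¬ R z y ⊎ R z y
      test y y∈ with dec z y (sub (here ≡.refl)) (ys⊆ y∈)
      ... | yes r = inj₂ r
      ... | no ¬r = inj₁ ¬r
    ... | inj₂ (y , y∈ , r) = ys , p , ys⊆ , λ { _ (here ≡.refl) → y , y∈ , r ; x (there m) → c x m }
    ... | inj₁ new = z ∷ ys , All.tabulate (new _) ∷ p ,
          (λ { (here ≡.refl) → sub (here ≡.refl) ; (there m) → ys⊆ m }) ,
          (λ { _ (here ≡.refl) → z , here ≡.refl , rf
             ; x (there m) → let (y , y∈ , r) = c x m in y , there y∈ , r })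

-- Numerical forms of the two contradictions with the growth inequality.

module GrowthEstimates where

  m≤m*n : ∀ m {n} → 1 ≤ n → m ≤ m * n
  m≤m*n m {n} 1≤n = ℕ.m≤m*n m n {{ℕ.>-nonZero 1≤n}}

  window-arith : ∀ n k J → n * n * suc J + n * k * suc J ≤ J * n * n + n * k * (suc J * suc J) → 1 ≤ n → n ≤ k * suc J * J
  window-arith n k J h 1≤n = ℕ.*-cancelˡ-≤ n {{ℕ.>-nonZero 1≤n}} (ℕ.+-cancelʳ-≤ (J * n * n + n * k * suc J) _ _
    (≡.subst₂ _≤_ (left n k J) (right n k J) h))
    where
    left : ∀ n k J → n * n * suc J + n * k * suc J ≡ n * n + (J * n * n + n * k * suc J)
    left = solve-∀
    right : ∀ n k J → J * n * n + n * k * (suc J * suc J) ≡ n * (k * suc J * J) + (J * n * n + n * k * suc J)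
    right = solve-∀

  triangle-sum : ℕ → ℕ → ℕ → ℕ
  triangle-sum k J n = ∑< (suc J) (λ s → ∑< n (λ j → n ∸ (s + j) * k))

  -- Row s contributes at least (n - sk)²/2k. There are 2k + 1 rows, so the squares would sum to (2k
  -- + 1)n² up to a linear error in n, against the 2k n² allowed; comparing the two bounds n.
  triangle-bound : ∀ n k → 1 ≤ k → 1 ≤ n → triangle-sum k (2 * k) n ≤ n * n → n ≤ k * suc (2 * k) * (2 * k)
  triangle-bound n k 1≤k 1≤n h = window-arith n k J (begin
    n * n * suc J + n * k * suc J             ≡⟨ ≡.cong (ℕ._+ n * k * suc J) (ℕ.*-comm (n * n) (suc J)) ⟩
    suc J * (n * n) + n * k * suc J           ≤⟨ S₂-lower k (suc J) n ⟩
    S₂ k (suc J) n + n * k * (suc J * suc J)  ≤⟨ ℕ.+-monoˡ-≤ _ squares ⟩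
    J * n * n + n * k * (suc J * suc J)       ∎) 1≤n
    where
    open ℕ.≤-Reasoning
    J = 2 * k
    y : ℕ → ℕ
    y s = n ∸ s * k
    row : ∀ s → ∑< n (λ j → n ∸ (s + j) * k) ≡ S₁ k n (y s)
    row s = ∑<-cong n λ j → ≡.trans (≡.cong (n ∸_) (ℕ.*-distribʳ-+ k s j)) (≡.sym (ℕ.∸-+-assoc n (s * k) (j * k)))
    y≤ : ∀ s → y s ≤ n * k
    y≤ s = ℕ.≤-trans (ℕ.m∸n≤m n (s * k)) (m≤m*n n 1≤k)
    squares : S₂ k (suc J) n ≤ J * n * n
    squares = begin
      S₂ k (suc J) n                              ≤⟨ ∑<-mono (suc J) (λ s → ℕ.≤-trans (ℕ.m≤m+n (y s * y s) (k * y s)) (S₁-bound k n (y s) (y≤ s))) ⟩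
      ∑< (suc J) (λ s → 2 * k * S₁ k n (y s))     ≡⟨ ∑<-* (2 * k) (suc J) (λ s → S₁ k n (y s)) ⟨
      2 * k * ∑< (suc J) (λ s → S₁ k n (y s))     ≡⟨ ≡.cong (2 * k *_) (∑<-cong (suc J) row) ⟨
      2 * k * triangle-sum k J n                  ≤⟨ ℕ.*-monoʳ-≤ (2 * k) h ⟩
      2 * k * (n * n)                             ≡⟨ ℕ.*-assoc (2 * k) n n ⟨
      J * n * n                                   ∎

  wedge-row : ℕ → ℕ → ℕ → ℕ
  wedge-row s n y = ∑< n (λ i → y ∸ i * s) + ∑< n (λ i → y ∸ suc i * s)

  -- The integral of y - |x|s over both signs is y²/s. Doubling `S₁` counts exponent 0 twice, which
  -- the extra `s * y` in `S₁-bound` absorbs.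
  wedge-row-bound : ∀ s n y → 1 ≤ s → y ≤ n → y * y ≤ s * wedge-row s n y
  wedge-row-bound s n y 1≤s y≤n = ℕ.+-cancelʳ-≤ (s * y) _ _ (begin
    y * y + s * y                                  ≤⟨ S₁-bound s n y y≤n*s ⟩
    2 * s * S₁ s n y                               ≡⟨ double s (S₁ s n y) ⟩
    s * S₁ s n y + s * S₁ s n y                    ≤⟨ ℕ.+-monoʳ-≤ (s * S₁ s n y) (ℕ.*-monoʳ-≤ s longer) ⟩
    s * S₁ s n y + s * (y + ∑< n (λ i → y ∸ suc i * s)) ≡⟨ regroup s (S₁ s n y) y _ ⟩
    s * wedge-row s n y + s * y                    ∎)
    where
    open ℕ.≤-Reasoning
    y≤n*s : y ≤ n * s
    y≤n*s = ℕ.≤-trans y≤n (m≤m*n n 1≤s)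
    longer : S₁ s n y ≤ S₁ s (suc n) y
    longer = ℕ.≤-trans (ℕ.m≤m+n _ _) (ℕ.≤-reflexive (≡.sym (∑<-snoc n (λ j → y ∸ j * s))))
    double : ∀ s z → 2 * s * z ≡ s * z + s * z
    double = solve-∀
    regroup : ∀ s u y v → s * u + s * (y + v) ≡ s * (u + v) + s * y
    regroup = solve-∀

  -- The rows sum to at least Σ (n - jk)²/s, hence to at least n³/(3ks).
  wedge-bound : ∀ n k s → 1 ≤ k → 1 ≤ s → 1 ≤ n → ∑< n (λ j → wedge-row s n (n ∸ j * k)) ≤ n * n → n ≤ 3 * k * s
  wedge-bound n k s 1≤k 1≤s 1≤n h = ℕ.*-cancelˡ-≤ (n * n) {{ℕ.>-nonZero (ℕ.*-mono-≤ 1≤n 1≤n)}} (begin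
    n * n * n                                            ≤⟨ S₂-bound k n n (m≤m*n n 1≤k) ⟩
    3 * k * S₂ k n n                                     ≤⟨ ℕ.*-monoʳ-≤ (3 * k) (∑<-mono n {λ j → y j * y j} {λ j → s * wedge-row s n (y j)} λ j → wedge-row-bound s n (y j) 1≤s (ℕ.m∸n≤m n (j * k))) ⟩
    3 * k * ∑< n (λ j → s * wedge-row s n (n ∸ j * k))   ≡⟨ ≡.cong (3 * k *_) (∑<-* s n (λ j → wedge-row s n (y j))) ⟨
    3 * k * (s * ∑< n (λ j → wedge-row s n (n ∸ j * k))) ≤⟨ ℕ.*-monoʳ-≤ (3 * k) (ℕ.*-monoʳ-≤ s h) ⟩
    3 * k * (s * (n * n))                                ≡⟨ rotate (3 * k) s (n * n) ⟩
    n * n * (3 * k * s)                                  ∎)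
    where
    open ℕ.≤-Reasoning
    y : ℕ → ℕ
    y j = n ∸ j * k
    rotate : ∀ p s m → p * (s * m) ≡ m * (p * s)
    rotate = solve-∀

  cubic₅ : ∀ x → x * suc (2 * x) * (2 * x) ≡ 4 * (x * x * x) + 2 * (x * x)
  cubic₅ = solve-∀

  cubic₆ : ∀ x → 3 * x * (2 * x * x) ≡ 6 * (x * x * x) + 0 * (x * x)
  cubic₆ = solve-∀

open GrowthEstimates
open Representatives

-- From growth to a short word of infinite order and the structure of G.

module TwoEnded {c ℓ : Level} {G : Group c ℓ} (D : BoundaryData G) where

  open BoundaryData D
  open Boundary D
  open Group G
  open GroupNotions G
  open Powers G
  open Words G g inv g-inv
  open Finiteness generated infinite
  open MorseHedlund (Fin._≟_ {β})

  -- A long least word either has 2k + 1 positions whose windows are eventually distinct, giving too many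
  -- group elements for the growth inequality, or contains a high power.
  LongPower : ℕ → Set ℓ
  LongPower M = ∃ λ u → length u ≤ 2 * k × (∀ i → i < M → ¬ ⟦ u ⟧ ^ℕ suc i ≈ ε)

  module LongWord (M : ℕ) (v : Word) (least : Least v) (long : suc (2 * k) + M * (2 * k) + (2 * k + n) ≤ length v) where

    J K : ℕ
    J = 2 * k
    K = suc J + M * J

    length-window : ∀ i m → i + m ≤ length v → length (window v i m) ≡ m
    length-window i m h = ≡.trans (length-take m (drop i v)) (ℕ.m≤n⇒m⊓n≡m
      (ℕ.≤-trans (ℕ.m+n≤o⇒m≤o∸n m (≡.subst (_≤ length v) (ℕ.+-comm i m) h)) (ℕ.≤-reflexive (≡.sym (length-drop i v)))))

    -- Position s enters at length s, the first length where it is separated from all earlier ones.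
    -- The words used are different factors of a least word, so they have different values.
    separated⇒⊥ : ∀ pos → Separated v K (suc J) pos → ⊥
    separated⇒⊥ pos (pos<K , separated) = ℕ.<⇒≱ (small 4 2 (cubic₅ k) (ℕ.m≤m+n 6 2)) (triangle-bound n k k>0 n>0 total)
      where
      e : ℕ × ℕ → Word
      e (s , j) = window v (pos s) (s + j)
      open Growth e
      E : List (ℕ × ℕ)
      E = cartesianProduct (upTo (suc J)) (upTo n)
      members : ∀ {s j} → (s , j) ∈ E → s < suc J × j < n
      members m = let (s∈ , j∈) = ∈-cartesianProduct⁻ (upTo (suc J)) (upTo n) m in ∈-upTo⁻ s∈ , ∈-upTo⁻ j∈
      fits : ∀ {s j} → (s , j) ∈ E → length (e (s , j)) ≡ s + j
      fits {s} {j} m with members m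
      -- Positions lie below `K` and windows have length at most 2k + n; `long` leaves room for
      -- both.
      ... | s≤s s≤J , j<n = length-window (pos s) (s + j) (ℕ.≤-trans (ℕ.+-mono-≤ (ℕ.<⇒≤ (pos<K s (s≤s s≤J))) (ℕ.+-mono-≤ s≤J (ℕ.<⇒≤ j<n))) long)
      same-position : ∀ {s j s' j'} → (s , j) ∈ E → (s' , j') ∈ E → s + j ≡ s' + j' → e (s , j) ≡ e (s' , j') → s ≡ s'
      same-position {s} {j} {s'} {j'} m m' len eq with ℕ.<-cmp s s'
      ... | tri≈ _ s≡s' _ = s≡s'
      ... | tri< s<s' _ _ = ⊥-elim (separated s s' s<s' (proj₁ (members m')) (take-weaken (ℕ.m≤m+n s' j')
              (≡.trans (≡.cong (window v (pos s)) (≡.sym len)) eq)))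
      ... | tri> _ _ s'<s = ⊥-elim (separated s' s s'<s (proj₁ (members m)) (take-weaken (ℕ.m≤m+n s j)
              (≡.trans (≡.cong (window v (pos s')) len) (≡.sym eq))))
      e-injective : ∀ x y → x ∈ E → y ∈ E → ⟦ e x ⟧ ≈ ⟦ e y ⟧ → x ≡ y
      e-injective (s , j) (s' , j') m m' eq with least-unique _ _ (least-window (pos s) (s + j) v least) (least-window (pos s') (s' + j') v least) eq
      ... | words≡ with ≡.trans (≡.sym (fits m)) (≡.trans (≡.cong length words≡) (fits m'))
      ... | len with same-position m m' len words≡
      ... | ≡.refl = ≡.cong (s ,_) (ℕ.+-cancelˡ-≡ s j j' len)
      weight≥ : ∀ x → n ∸ (proj₁ x + proj₂ x) * k ≤ weight x
      weight≥ (s , j) = ℕ.∸-monoʳ-≤ n (ℕ.*-monoˡ-≤ k (ℕ.≤-trans (ℕ.≤-reflexive (length-take (s + j) _)) (ℕ.m⊓n≤m (s + j) _)))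
      total : triangle-sum k J n ≤ n * n
      total = begin
        triangle-sum k J n                 ≤⟨ ∑<-mono (suc J) {λ s → ∑< n (λ j → n ∸ (s + j) * k)} {λ s → ∑< n (λ j → weight (s , j))}
                                                (λ s → ∑<-mono n {λ j → n ∸ (s + j) * k} {λ j → weight (s , j)} (λ j → weight≥ (s , j))) ⟩
        ∑< (suc J) (λ s → ∑< n (λ j → weight (s , j))) ≡⟨ ≡.trans (∑<-cartesianProduct (suc J) (upTo n) weight) (∑<-cong (suc J) λ s → ∑<-upTo n (λ j → weight (s , j))) ⟨
        sum (map weight E)                 ≤⟨ growth E (Unique.cartesianProduct⁺ (Unique.upTo⁺ (suc J)) (Unique.upTo⁺ n)) e-injective ⟩
        n * n                              ∎
        where open ℕ.≤-Reasoning

    -- A power of `u` inside a least word is least, and so are its prefixes; a nonempty least word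
    -- cannot have the value of the empty word.
    power⇒long : HasPower v J M → LongPower M
    power⇒long (i , p , 1≤p , p≤J , eq , i+p≤J) = u , ℕ.≤-trans (ℕ.≤-reflexive length-u) p≤J , torsionfree
      where
      u = window v i p
      length-u : length u ≡ p
      length-u = length-window i p (ℕ.≤-trans i+p≤J (ℕ.≤-trans (ℕ.m≤m+n J n) (ℕ.≤-trans (ℕ.m≤n+m _ K) long)))
      least-power : Least (repeat M u)
      least-power = ≡.subst Least eq (least-window i (M * p) v least)
      torsionfree : ∀ q → q < M → ¬ ⟦ u ⟧ ^ℕ suc q ≈ ε
      torsionfree q q<M e = nonempty (repeat (suc q) u) positive least-q (sym (trans (⟦⟧-repeat (suc q) u) e))
        where
        least-q : Least (repeat (suc q) u)
        least-q = least-prefix (repeat (suc q) u) (repeat (M ∸ suc q) u)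
          (≡.subst Least (≡.trans (≡.cong (λ m → repeat m u) (≡.sym (ℕ.m+[n∸m]≡n q<M))) (repeat-+ (suc q) (M ∸ suc q) u)) least-power)
        positive : 1 ≤ length (repeat (suc q) u)
        positive = ℕ.≤-trans (ℕ.≤-trans 1≤p (ℕ.≤-reflexive (≡.sym length-u))) (ℕ.≤-trans (ℕ.m≤m+n (length u) _) (ℕ.≤-reflexive (≡.sym (length-repeat (suc q) u))))
        nonempty : ∀ w → 1 ≤ length w → Least w → ¬ ε ≈ ⟦ w ⟧
        nonempty (b ∷ w) _ l = l [] (s≤s z≤n)

    long-power : LongPower M
    long-power with morse-hedlund v J M
    ... | inj₁ (pos , sep) = ⊥-elim (separated⇒⊥ pos sep)
    ... | inj₂ power = power⇒long power

  long-power-exists : ∀ M → ¬ ¬ LongPower M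
  long-power-exists M no-power = long-least-word _ λ (v , least , long) → no-power (LongWord.long-power M v least long)

  -- If the cosets ⟨ u ⟩ w had representatives of every length up to n, the elements u ^ i w would violate
  -- the growth inequality.
  module Wedge (u : Word) (u≤ : length u ≤ 2 * k) (u-long : ∀ i → i < 2 * n → ¬ ⟦ u ⟧ ^ℕ suc i ≈ ε) where
    open ∼-Cover ⟦ u ⟧

    u≥1 : 1 ≤ length u
    u≥1 = nonempty u (u-long 0 (ℕ.≤-trans n>0 (ℕ.m≤m+n n _)))
      where
      nonempty : ∀ u → ¬ ⟦ u ⟧ ^ℕ 1 ≈ ε → 1 ≤ length u
      nonempty [] h = ⊥-elim (h (identityˡ ε))
      nonempty (_ ∷ _) _ = s≤s z≤n

    Small : ℤ → Set
    Small i = ∣ i ∣ ≤ n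

    -- Exponents of size at most n differ by at most 2n, the range in which `u-long` excludes
    -- torsion.
    exponent-injective : ∀ i i' {y} → Small i → Small i' → ⟦ u ⟧ ^ᶻ i ∙ y ≈ ⟦ u ⟧ ^ᶻ i' ∙ y → i ≡ i'
    exponent-injective i i' {y} i≤ i'≤ e = ≡.sym (ℤ.i-j≡0⇒i≡j i' i (vanishes (i' ℤ.- i) difference≤ difference≈))
      where
      difference≈ : ⟦ u ⟧ ^ᶻ (i' ℤ.- i) ≈ ε
      difference≈ = sym (∙-cancelʳ y _ _ (trans (identityˡ y) (shift-exponent ⟦ u ⟧ i i' e)))
        where open import Algebra.Properties.Group G using (∙-cancelʳ)
      difference≤ : ∣ i' ℤ.- i ∣ ≤ 2 * n
      difference≤ = ℕ.≤-trans (ℤ.∣i-j∣≤∣i∣+∣j∣ i' i) (ℕ.+-mono-≤ i'≤ (ℕ.≤-trans i≤ (ℕ.m≤m+n n 0)))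
      vanishes : ∀ m → ∣ m ∣ ≤ 2 * n → ⟦ u ⟧ ^ᶻ m ≈ ε → m ≡ 0ℤ
      vanishes (+ zero) _ _ = ≡.refl
      vanishes (+ suc m) m≤ e = ⊥-elim (u-long m m≤ e)
      vanishes -[1+ m ] m≤ e = ⊥-elim (u-long m m≤ (trans (^-neg ⟦ u ⟧ -[1+ m ]) (trans (⁻¹-cong e) ε⁻¹≈ε)))
        where open import Algebra.Properties.Group G using (ε⁻¹≈ε)

    module _ (shortest : ∀ d → d ≤ n → ∃ λ w → length w ≡ d × Shortest w) where

      -- Truncation at n makes `rep` total on ℕ; on the indices j < n of `E` it changes nothing.
      level : ℕ → Fin (suc n)
      level j = fromℕ< (s≤s (ℕ.m⊓n≤n j n))

      rep : ℕ → Word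
      rep j = by-length ⟦ u ⟧ n shortest (level j)

      length-rep : ∀ j → length (rep j) ≡ j ⊓ n
      length-rep j = ≡.trans (by-length-length ⟦ u ⟧ n shortest (level j)) (Fin.toℕ-fromℕ< _)

      e : ℕ × ℤ → Word
      e (j , i) = power u i ++ rep j

      open Growth e

      ints : List ℤ
      ints = map +_ (upTo n) ++ map -[1+_] (upTo n)

      E : List (ℕ × ℤ)
      E = cartesianProduct (upTo n) ints

      ints-unique : Unique ints
      ints-unique = Unique.++⁺ (Unique.map⁺ ℤ.+-injective (Unique.upTo⁺ n)) (Unique.map⁺ ℤ.-[1+-injective (Unique.upTo⁺ n)) disjoint
        where
        disjoint : ∀ {z} → ¬ (z ∈ map +_ (upTo n) × z ∈ map -[1+_] (upTo n))
        disjoint (p , q) with ∈-map⁻ +_ p | ∈-map⁻ -[1+_] q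
        ... | _ , _ , ≡.refl | _ , _ , ()

      ints-small : ∀ {i} → i ∈ ints → Small i
      ints-small m with ∈-++⁻ (map +_ (upTo n)) m
      ... | inj₁ p with ∈-map⁻ +_ p
      ... | _ , j∈ , ≡.refl = ℕ.<⇒≤ (∈-upTo⁻ j∈)
      ints-small m | inj₂ q with ∈-map⁻ -[1+_] q
      ... | _ , j∈ , ≡.refl = ∈-upTo⁻ j∈

      value : ∀ j i → ⟦ e (j , i) ⟧ ≈ ⟦ u ⟧ ^ᶻ i ∙ ⟦ rep j ⟧
      value j i = trans (⟦⟧-++ (power u i) (rep j)) (∙-congʳ (⟦⟧-power u i))

      e-injective : ∀ x y → x ∈ E → y ∈ E → ⟦ e x ⟧ ≈ ⟦ e y ⟧ → x ≡ y
      e-injective (j , i) (j' , i') m m' eq with ∈-cartesianProduct⁻ (upTo n) ints m | ∈-cartesianProduct⁻ (upTo n) ints m'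
      ... | j∈ , i∈ | j'∈ , i'∈ with same-level
        where
        eq' : ⟦ u ⟧ ^ᶻ i ∙ ⟦ rep j ⟧ ≈ ⟦ u ⟧ ^ᶻ i' ∙ ⟦ rep j' ⟧
        eq' = trans (sym (value j i)) (trans eq (value j' i'))
        below : ∀ {j} → j ∈ upTo n → toℕ (level j) ≡ j
        below j∈ = ≡.trans (Fin.toℕ-fromℕ< _) (ℕ.m≤n⇒m⊓n≡m (ℕ.<⇒≤ (∈-upTo⁻ j∈)))
        same-level : j ≡ j'
        same-level = ≡.trans (≡.sym (below j∈)) (≡.trans (≡.cong toℕ (by-length-distinct ⟦ u ⟧ n shortest (level j) (level j') (∼-cancel i i' eq'))) (below j'∈))
      ... | ≡.refl = ≡.cong (j ,_) (exponent-injective i i' (ints-small i∈) (ints-small i'∈) (trans (sym (value j i)) (trans eq (value j i'))))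

      S : ℕ
      S = length u * k

      weight≥ : ∀ j i → (n ∸ j * k) ∸ ∣ i ∣ * S ≤ weight (j , i)
      weight≥ j i = ℕ.≤-trans (ℕ.≤-reflexive (ℕ.∸-+-assoc n (j * k) (∣ i ∣ * S))) (ℕ.∸-monoʳ-≤ n (begin
        length (e (j , i)) * k                 ≡⟨ ≡.cong (ℕ._* k) (≡.trans (length-++ (power u i)) (≡.cong₂ _+_ (length-power u i) (length-rep j))) ⟩
        (∣ i ∣ * length u + j ⊓ n) * k         ≤⟨ ℕ.*-monoˡ-≤ k (ℕ.+-monoʳ-≤ (∣ i ∣ * length u) (ℕ.m⊓n≤m j n)) ⟩
        (∣ i ∣ * length u + j) * k             ≡⟨ ℕ.*-distribʳ-+ k (∣ i ∣ * length u) j ⟩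
        ∣ i ∣ * length u * k + j * k           ≡⟨ ≡.cong₂ _+_ (ℕ.*-assoc ∣ i ∣ (length u) k) ≡.refl ⟩
        ∣ i ∣ * S + j * k                      ≡⟨ ℕ.+-comm (∣ i ∣ * S) (j * k) ⟩
        j * k + ∣ i ∣ * S                      ∎))
        where open ℕ.≤-Reasoning

      sum-ints : (f : ℤ → ℕ) → sum (map f ints) ≡ ∑< n (λ i → f (+ i)) + ∑< n (λ i → f -[1+ i ])
      sum-ints f = ≡.trans (≡.cong sum (map-++ f (map +_ (upTo n)) _)) (≡.trans (sum-++ (map f (map +_ (upTo n))) _)
        (≡.cong₂ _+_ (≡.trans (≡.cong sum (≡.sym (map-∘ (upTo n)))) (∑<-upTo n _)) (≡.trans (≡.cong sum (≡.sym (map-∘ (upTo n)))) (∑<-upTo n _))))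

      total : ∑< n (λ j → wedge-row S n (n ∸ j * k)) ≤ n * n
      total = begin
        ∑< n (λ j → wedge-row S n (n ∸ j * k))  ≤⟨ ∑<-mono n {λ j → wedge-row S n (n ∸ j * k)} {λ j → ∑< n (λ i → weight (j , + i)) + ∑< n (λ i → weight (j , -[1+ i ]))}
                                                    (λ j → ℕ.+-mono-≤ (∑<-mono n {λ i → (n ∸ j * k) ∸ i * S} {λ i → weight (j , + i)} (λ i → weight≥ j (+ i)))
                                                                      (∑<-mono n {λ i → (n ∸ j * k) ∸ suc i * S} {λ i → weight (j , -[1+ i ])} (λ i → weight≥ j -[1+ i ]))) ⟩
        ∑< n (λ j → ∑< n (λ i → weight (j , + i)) + ∑< n (λ i → weight (j , -[1+ i ])))
          ≡⟨ ≡.trans (∑<-cartesianProduct n ints weight) (∑<-cong n λ j → sum-ints (λ i → weight (j , i))) ⟨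
        sum (map weight E)                      ≤⟨ growth E (Unique.cartesianProduct⁺ (Unique.upTo⁺ n) ints-unique) e-injective ⟩
        n * n                                   ∎
        where open ℕ.≤-Reasoning

      too-large : ⊥
      -- With S = |u|k ≤ 2k² the wedge estimate gives n ≤ 6k³.
      too-large = ℕ.<⇒≱ (small 6 0 (cubic₆ k) (ℕ.m≤m+n 6 2)) (ℕ.≤-trans (wedge-bound n k S k>0 (ℕ.*-mono-≤ u≥1 k>0) n>0 total)
        (ℕ.*-monoʳ-≤ (3 * k) (ℕ.*-monoˡ-≤ k u≤)))

    covered-by-powers : ¬ ¬ (∃ λ d → CoveredBelow d)
    covered-by-powers uncovered = ¬¬-decided n λ dec → conclude (shortest-or-covered n dec)
      where
      conclude : (∀ d → d ≤ n → ∃ λ w → length w ≡ d × Shortest w) ⊎ (∃ λ d → d ≤ n × CoveredBelow d) → ⊥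
      conclude (inj₁ shortest) = too-large shortest
      conclude (inj₂ (d , _ , cov)) = uncovered (d , cov)

  open VirtuallyCyclic G g inv g-inv generated

  -- Decided cosets allow duplicates to be removed from the covering words, which leaves the full
  -- transversal needed for the transfer.
  covered⇒cyclic-or-dihedral : ∀ t Q → ∼-Cover.Decided ⟦ t ⟧ Q → ∀ d → d ≤ Q → ∼-Cover.CoveredBelow ⟦ t ⟧ d → CyclicOrDihedral
  covered⇒cyclic-or-dihedral t Q dec d d≤Q cov = cyclic-or-dihedral ⟦ t ⟧ (covered⇒¬torsion ⟦ t ⟧ d cov) x cover distinct
    where
    found : ∃ λ ys → AllPairs (λ v w → ¬ ⟦ v ⟧ ∼[ ⟦ t ⟧ ] ⟦ w ⟧) ys × (∀ v → v ∈ shorter d → ∃ λ w → w ∈ ys × ⟦ v ⟧ ∼[ ⟦ t ⟧ ] ⟦ w ⟧)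
    found = representatives ∼-trans ∼-sym (∼-reflexive refl) (shorter d)
      (λ v w v∈ w∈ → dec w v (ℕ.<⇒≤ (ℕ.<-≤-trans (∈-shorter⁻ w∈) d≤Q)) (ℕ.<⇒≤ (ℕ.<-≤-trans (∈-shorter⁻ v∈) d≤Q)))
    reps : List Word
    reps = proj₁ found
    x : Fin (length reps) → Carrier
    x j = ⟦ lookup reps j ⟧
    cover : ∀ y → ∃ λ j → y ∼[ ⟦ t ⟧ ] x j
    cover y with cov y
    ... | v , v<d , y∼v with proj₂ (proj₂ found) v (∈-shorter⁺ v v<d)
    ... | w , w∈ , v∼w = Any.index w∈ , ∼-trans y∼v (∼-trans v∼w (∼-reflexive (reflexive (≡.cong ⟦_⟧ (lookup-index w∈)))))
    distinct : Transversal ⟦ t ⟧ x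
    distinct j j' e = lookup-injective (λ ¬r → ¬r (∼-reflexive refl)) (λ ¬r → ¬r ∘ ∼-sym) (proj₁ (proj₂ found)) j j' (λ ¬r → ¬r e)

  -- The powers of `u` are known to be nontrivial only up to 2n; finite index in an infinite group
  -- upgrades this to infinite order.
  ¬¬-cyclic-or-dihedral : ¬ ¬ CyclicOrDihedral
  ¬¬-cyclic-or-dihedral none = long-power-exists (2 * n) λ (u , u≤ , u-long) → Wedge.covered-by-powers u u≤ u-long λ (d , cov) →
    ∼-Cover.¬¬-decided ⟦ u ⟧ d λ dec → none (covered⇒cyclic-or-dihedral u d dec d ℕ.≤-refl cov)

  -- The existence of a short word of infinite order is only known classically, but for short words the
  -- property is decidable, so one is found by search.
  short-word : ∃ λ t → length t ≤ 2 × ¬ Torsion ⟦ t ⟧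
  short-word with all-or-someˡ (shorter 3) test
    where
    test : ∀ t → t ∈ shorter 3 → Torsion ⟦ t ⟧ ⊎ (∀ i → ∃ λ q → Exits t (⟦ t ⟧ ^ℕ q ∙ a i))
    test t _ with all-or-some (forward-exit t)
    ... | inj₁ exits = inj₂ exits
    ... | inj₂ (_ , torsion) = inj₁ torsion
  ... | inj₂ (t , t∈ , exits) = t , ℕ.≤-pred (∈-shorter⁻ t∈) , Short.exits⇒¬torsion t (ℕ.≤-pred (∈-shorter⁻ t∈)) exits
  -- The structure known up to double negation contains a short word of infinite order, so the
  -- search cannot fail.
  ... | inj₁ torsion = ⊥-elim (¬¬-cyclic-or-dihedral λ o → let open CyclicOrDihedral o in
    word-infinite (torsion word (∈-shorter⁺ word (s≤s word-short))))

  -- The number of separated points carries the factor `length word`, and so does the number of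
  -- exits; it cancels, so words of length 1 and 2 give the same bound.
  kernel-bound : (o : CyclicOrDihedral) → 2 * length (CyclicOrDihedral.N o) ≤ k
  kernel-bound o = ℕ.*-cancelˡ-≤ (length word) {{ℕ.>-nonZero word-nonempty}} (begin
    length word * (2 * length N)    ≡⟨ ℕ.*-comm (length word) (2 * length N) ⟩
    2 * length N * length word      ≡⟨ ℕ.*-assoc 2 (length N) (length word) ⟩
    2 * (length N * length word)    ≡⟨ ≡.cong (2 *_) (ℕ.*-comm (length N) (length word)) ⟩
    2 * (length word * length N)    ≤⟨ Short.transversal-bound word word-short word-infinite points points-transversal ⟩
    length word * k                 ∎)
    where
    open ℕ.≤-Reasoning
    open CyclicOrDihedral o

  short-word⇒cyclic-or-dihedral : ∀ t → length t ≤ 2 → ¬ Torsion ⟦ t ⟧ → CyclicOrDihedral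
  short-word⇒cyclic-or-dihedral t t≤ inf = conclude (Short.decided t t≤ inf)
    where
    conclude : ∼-Cover.Decided ⟦ t ⟧ k → CyclicOrDihedral
    conclude dec = let (d , d≤k , cov) = Short.covered t t≤ inf dec in covered⇒cyclic-or-dihedral t k dec d d≤k cov

  structure : CyclicOrDihedral
  structure = let (t , t≤ , inf) = short-word in short-word⇒cyclic-or-dihedral t t≤ inf

small-normal-subgroup : ∀ {c ℓ} {G : Group c ℓ} (D : BoundaryData G) → let open GroupNotions G in
  Σ (List (Group.Carrier G)) λ N → Distinct N × IsNormalSubgroup N ×
    (QuotientCyclic N ⊎ QuotientDihedral N) × 2 * length N ≤ BoundaryData.k D
small-normal-subgroup {G = G} D = fromStructure structure
  where
  open BoundaryData D using (g; inv; g-inv; generated; k)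
  open TwoEnded D
  open VirtuallyCyclic G g inv g-inv generated using (CyclicOrDihedral)
  open GroupNotions G
  fromStructure : CyclicOrDihedral → Σ (List (Group.Carrier G)) λ N → Distinct N × IsNormalSubgroup N ×
    (QuotientCyclic N ⊎ QuotientDihedral N) × 2 * length N ≤ k
  fromStructure o = N , N-distinct , N-normal , quotient , kernel-bound o
    where open CyclicOrDihedral o

module Cubes where

  -- The right side is `(2 * k) ^ 3` unfolded.
  cube : ∀ k → 8 * (k * k * k) ≡ 2 * k * (2 * k * (2 * k * 1))
  cube = solve-∀

-- From the given lists to indexed families and the boundary.

module FromLists {c ℓ : Level} (G : Group c ℓ) (infinite : GroupNotions.Infinite G)
  (B : List (Group.Carrier G)) (B-symmetric : GroupNotions.Symmetric G B)
  (ε∈B : GroupNotions._∈ₗ_ G (Group.ε G) B) (B-generates : GroupNotions.Generates G B)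
  (A : List (Group.Carrier G)) (A-distinct : GroupNotions.Distinct G A)
  (BA : List (Group.Carrier G)) (BA-enumerates : GroupNotions.Enumerates G (GroupNotions.ProdSet G B A) BA)
  (large : (2 * (length BA ∸ length A)) ^ 3 < length A) where

  open Group G
  open GroupNotions G

  ∈ₗ-lookup : ∀ (L : List Carrier) i → lookup L i ∈ₗ L
  ∈ₗ-lookup L i = Any.map reflexive (∈-lookup i)

  g : Fin (length B) → Carrier
  g = lookup B

  a : Fin (length A) → Carrier
  a = lookup A

  inv : Fin (length B) → Fin (length B)
  inv b = Any.index (B-symmetric (g b) (∈ₗ-lookup B b))

  g-inv : ∀ b → g (inv b) ≈ g b ⁻¹
  g-inv b = sym (lookup-index (B-symmetric (g b) (∈ₗ-lookup B b)))

  open Words G g inv g-inv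

  spell : ∀ ws → All (_∈ₗ B) ws → ∃ λ w → foldr _∙_ ε ws ≈ ⟦ w ⟧
  spell [] [] = [] , refl
  spell (_ ∷ ws) (m ∷ ms) = let (w , e) = spell ws ms in Any.index m ∷ w , ∙-cong (lookup-index m) e

  generated : ∀ x → ∃ λ w → x ≈ ⟦ w ⟧
  generated x = let (ws , ms , e) = B-generates x
                    (w , e') = spell ws ms
                in w , trans e e'

  a-injective : ∀ i j → a i ≈ a j → i ≡ j
  a-injective i j e = lookup-injective (λ ¬e → ¬e refl) (λ ¬e → ¬e ∘ sym) A-distinct i j (λ ¬e → ¬e e)

  product∈ : ∀ b i → (g b ∙ a i) ∈ₗ BA
  product∈ b i = proj₁ (proj₂ BA-enumerates _) (g b , a i , ∈ₗ-lookup B b , ∈ₗ-lookup A i , refl)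

  A⊆BA : ∀ i → a i ∈ₗ BA
  A⊆BA i = proj₁ (proj₂ BA-enumerates _) (ε , a i , ε∈B , ∈ₗ-lookup A i , sym (identityˡ _))

  α : Fin (length A) → Fin (length BA)
  α i = Any.index (A⊆BA i)

  α-injective : ∀ i j → α i ≡ α j → i ≡ j
  α-injective i j e = a-injective i j (trans (lookup-index (A⊆BA i)) (trans (reflexive (≡.cong (lookup BA) e)) (sym (lookup-index (A⊆BA j)))))

  -- Membership in A is decided by comparing positions in the list of BA, since equality of elements
  -- is not decidable.
  inA? : ∀ z → Dec (∃ λ i → α i ≡ z)
  inA? z = Fin.any? (λ i → α i Fin.≟ z)

  ∂A : List (Fin (length BA))
  ∂A = filter (¬? ∘ inA?) (allFin (length BA))

  d : Fin (length ∂A) → Carrier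
  d z = lookup BA (lookup ∂A z)

  step : ∀ b i → (∃ λ j → g b ∙ a i ≈ a j) ⊎ (∃ λ z → g b ∙ a i ≈ d z)
  step b i with inA? (Any.index (product∈ b i))
  ... | yes (j , e) = inj₁ (j , trans (lookup-index (product∈ b i)) (trans (reflexive (≡.cong (lookup BA) (≡.sym e))) (sym (lookup-index (A⊆BA j)))))
  ... | no outside = inj₂ (Any.index m , trans (lookup-index (product∈ b i)) (reflexive (≡.cong (lookup BA) (lookup-index m))))
    where
    m : Any.index (product∈ b i) ∈ ∂A
    m = ∈-filter⁺ (¬? ∘ inA?) (∈-allFin _) outside

  -- The positions of A and those of the boundary are disjoint in the list of BA.
  ∂A-size : length ∂A ≤ length BA ∸ length A
  ∂A-size = ℕ.m+n≤o⇒m≤o∸n (length ∂A) (≡.subst (_≤ length BA) (ℕ.+-comm (length A) (length ∂A)) (Fin.injective⇒≤ {f = place} place-injective))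
    where
    place : Fin (length A + length ∂A) → Fin (length BA)
    place s with Fin.splitAt (length A) s
    ... | inj₁ i = α i
    ... | inj₂ z = lookup ∂A z
    outside : ∀ i z → ¬ α i ≡ lookup ∂A z
    outside i z e = proj₂ (∈-filter⁻ (¬? ∘ inA?) {xs = allFin (length BA)} (∈-lookup {xs = ∂A} z)) (i , e)
    place-injective : ∀ {s s'} → place s ≡ place s' → s ≡ s'
    place-injective {s} {s'} e with Fin.splitAt (length A) s in eq | Fin.splitAt (length A) s' in eq'
    ... | inj₁ i | inj₂ z = ⊥-elim (outside i z e)
    ... | inj₂ z | inj₁ i = ⊥-elim (outside i z (≡.sym e))
    ... | inj₁ i | inj₁ j with α-injective i j e
    ... | ≡.refl = ≡.trans (≡.sym (Fin.splitAt⁻¹-↑ˡ eq)) (Fin.splitAt⁻¹-↑ˡ eq')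
    place-injective {s} {s'} e | inj₂ z | inj₂ z' with unique-lookup (Unique.filter⁺ (¬? ∘ inA?) (Unique.allFin⁺ (length BA))) z z' e
    ... | ≡.refl = ≡.trans (≡.sym (Fin.splitAt⁻¹-↑ʳ eq)) (Fin.splitAt⁻¹-↑ʳ eq')

  cube-< : ∀ m → m ≤ 2 * (length BA ∸ length A) → m ^ 3 < length A
  cube-< m m≤ = ℕ.≤-<-trans (ℕ.^-monoˡ-≤ 3 m≤) large

  boundaryData : BoundaryData G
  boundaryData = record
    { g = g ; inv = inv ; g-inv = g-inv ; generated = generated ; infinite = infinite ; a = a ; d = d
    ; a-injective = a-injective ; step = step
    ; large = ≡.subst (_< length A) (≡.sym (Cubes.cube (length ∂A))) (cube-< (2 * length ∂A) (ℕ.*-monoʳ-≤ 2 ∂A-size)) }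

theorem1p3 : {c ℓ : Level} (G : Group c ℓ) →
    let open Group G using (ε)
        open GroupNotions G
    in Infinite →
       (B : List (Group.Carrier G)) → Distinct B → Symmetric B → ε ∈ₗ B → Generates B →
       (A : List (Group.Carrier G)) → Distinct A →
       (BA : List (Group.Carrier G)) → Enumerates (ProdSet B A) BA →
       -- |BA| < |A| + (1/2)|A|^{1/3}
       (2 * (length BA ∸ length A)) ^ 3 < length A →
       Σ (List (Group.Carrier G)) λ N →
         Distinct N × IsNormalSubgroup N ×
         (QuotientCyclic N ⊎ QuotientDihedral N) ×
         -- |N| < (1/4)|A|^{1/3}
         (4 * length N) ^ 3 < length A
theorem1p3 G infinite B _ B-symmetric ε∈B B-generates A A-distinct BA BA-enumerates large =
  let (N , distinct , normal , quotient , 2N≤k) = small-normal-subgroup boundaryData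
  -- 2|N| ≤ k ≤ |BA| - |A| gives 4|N| ≤ 2(|BA| - |A|), whose cube is below |A|.
  in N , distinct , normal , quotient , cube-< (4 * length N) (≡.subst (_≤ 2 * (length BA ∸ length A))
       (≡.sym (ℕ.*-assoc 2 2 (length N))) (ℕ.*-monoʳ-≤ 2 (ℕ.≤-trans 2N≤k ∂A-size)))
  where open FromLists G infinite B B-symmetric ε∈B B-generates A A-distinct BA BA-enumerates large
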